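{- Let $q \ge 6$ be a positive integer which is not a prime power, and suppose that $q$ satisfies at least one of the following conditions: (1) $q \le 200$ and $q \neq 94, 166$; (2) $q \le 600$ and every prime divisor of $q$ lies in the set $\{2,3,5,7,11\}$. Then there is no perfect $2$-error correcting code with parameters $(n,M)$, $n \ge 5$ and $M \ge 2$, over an alphabet of size $q$.
   Context: Let $q \ge 2$, $e \ge 1$ be integers and let $Z_q$ be a set with $q$ elements (the alphabet). An $e$-error correcting code $C$ with parameters $(n,M)$ is a subset of $Z_q^n$ of size $M$ such that any two distinct elements of $C$ differ in at least $2e+1$ coordinates. Such a code always satisfies $M\sum_{j=0}^{e}\binom{n}{j}(q-1)^j \le q^n$; the code is called perfect if equality holds, i.e. $M\sum_{j=0}^{e}\binom{n}{j}(q-1)^j = q^n$. -}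

module Defs where

open import Data.Nat using (ℕ; zero; suc; _+_; _*_; _∸_; _^_; _≤_; _<_)
open import Data.Nat.Primality using (Prime)
open import Data.Nat.Combinatorics using (_C_)
open import Data.Nat.Divisibility using (_∣_)
open import Data.Fin using (Fin)
open import Data.Vec using (Vec; []; _∷_)
open import Data.List using (List; length)
open import Data.List.Relation.Unary.AllPairs using (AllPairs)
open import Data.Product using (Σ; _×_; ∃)
open import Data.Sum using (_⊎_)
open import Relation.Nullary using (¬_; Dec; yes; no)
open import Relation.Binary.PropositionalEquality using (_≡_)
import Data.Fin.Properties as FinP

IsPrimePower : ℕ → Set
IsPrimePower q = Σ ℕ λ p → Σ ℕ λ k → Prime p × 1 ≤ k × q ≡ p ^ k

hamming : ∀ {q n} → Vec (Fin q) n → Vec (Fin q) n → ℕ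
hamming [] [] = 0
hamming (x ∷ xs) (y ∷ ys) with x FinP.≟ y
... | yes _ = hamming xs ys
... | no  _ = suc (hamming xs ys)

-- An e-error-correcting code of length n over the alphabet Fin q, given as a
-- list of codewords; any two (distinct list positions) differ in ≥ 2e+1 coordinates.
-- (This forces the codewords to be pairwise distinct, so M = length of the list.)
IsECode : (q e n : ℕ) → List (Vec (Fin q) n) → Set
IsECode q e n C = AllPairs (λ x y → 2 * e + 1 ≤ hamming x y) C

ballSize : (q n e : ℕ) → ℕ
ballSize q n zero = 1
ballSize q n (suc e) = ballSize q n e + (n C suc e) * (q ∸ 1) ^ suc e

IsPerfectCode : (q e n : ℕ) → List (Vec (Fin q) n) → Set
IsPerfectCode q e n C = IsECode q e n C × length C * ballSize q n e ≡ q ^ n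

SmallPrimeDivisors : ℕ → Set
SmallPrimeDivisors q = ∀ p → Prime p → p ∣ q →
  (p ≡ 2) ⊎ (p ≡ 3) ⊎ (p ≡ 5) ⊎ (p ≡ 7) ⊎ (p ≡ 11)

{-# OPTIONS --safe #-}
-- Counting the codewords at distance 0, 1 and 2 from a word gives a function annihilated by a quadratic
-- polynomial in the adjacency operator of the Hamming graph, whose eigenvalues are n(q - 1) - qj. So both roots
-- of that quadratic have this form (Lloyd's theorem), say for j = x and j = y, and Vieta's formulas become
--   2(x + y) + q = q(x - y)² + 6,   q - 1 ∣ 2(x + y) - 6,   x y M = 2 qⁿ⁻².
-- where M is the size of the code. By the last equation x and y are composed of primes dividing 2q. The solution
-- {x, y} = {1, 2} belongs to n = 2. All others are excluded by congruences: for every q there is a list of moduli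
-- that leaves no residue class for the exponents in the factorisations of x and y. Only q = 6, where the equation
-- factors, is treated by hand.
module Submission where

open import Defs
open import Data.Nat using (ℕ; _≤_)
open import Data.Fin using (Fin)
open import Data.Vec using (Vec)
open import Data.List using (List; length)
open import Data.Product using (_×_)
open import Data.Sum using (_⊎_)
open import Relation.Nullary using (¬_)
open import Relation.Binary.PropositionalEquality using (_≡_; _≢_)

-- Written as `q - 6 = q(x - y)² - 2(x + y)`, the equation shows that every common divisor of x and
-- y divides q - 6. For q ≠ 6 the powers of a prime dividing both are therefore bounded, and
-- finitely many case distinctions leave each prime with a free exponent in at most one of x and y.
-- For q = 6 there is no such bound, which is why that case stands apart. The other obstacle is the
-- pair {1, 2}. It satisfies the equation for every q, and the condition on the sum modulo every
-- divisor of q - 1, so no congruence can discard a class that contains it. The case distinctions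
-- have to isolate it as a point without free exponents, where `x + y > 3` decides. A modulus may
-- share factors with x and y: a class is constant modulo m as soon as multiplication by the
-- generators fixes the residue of its point. Hence powers of the primes dividing q serve as moduli,
-- next to moduli for which the generators have small order. Lloyd's theorem is obtained over the
-- integers, without characters or eigenvectors: an induction on the word length shows that a
-- function annihilated by a quadratic in the adjacency operator vanishes if no root is an
-- eigenvalue.

module Sieve where

  open import Data.Nat
  open import Data.Nat.Properties
  open import Data.Nat.DivMod using (_%_; _/_; m≡m%n+[m/n]*n; m%n<n; m%n%n≡m%n; %-distribˡ-+; %-distribˡ-*)
  open import Data.Nat.Divisibility
  open import Data.Nat.Coprimality using (Coprime; coprime-divisor)
  open import Data.Nat.Primality using (Prime; prime?; prime⇒nonZero; prime⇒nonTrivial; prime⇒irreducible; euclidsLemma)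
  open import Data.Nat.Primality.Factorisation using (PrimeFactorisation; factorise)
  open import Data.Nat.ListAction using (product)
  open import Data.Nat.Tactic.RingSolver using (solve-∀)
  open import Data.Bool using (Bool; true; false; T; _∧_; _∨_; not; if_then_else_)
  open import Data.Bool.ListAction using (all; any)
  open import Data.Bool.Properties using (T-∧; T-∨; T-≡; T?)
  open import Data.List.Base using ([]; _∷_; map; null; filterᵇ; upTo; applyUpTo; cartesianProduct; cartesianProductWith)
  open import Data.List.Membership.Propositional using (_∈_; find)
  open import Data.List.Membership.Propositional.Properties using (∈-map⁺; ∈-upTo⁺; ∈-applyUpTo⁺; ∈-applyUpTo⁻; ∈-cartesianProduct⁺; ∈-cartesianProduct⁻; ∈-cartesianProductWith⁺)
  open import Data.List.Relation.Unary.Any using (here; there)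
  open import Data.List.Relation.Unary.Any.Properties using (any⁻)
  open import Data.List.Relation.Unary.All as All using (All; []; _∷_)
  open import Data.List.Relation.Unary.All.Properties using (all⁺; filter⁺)
  open import Data.Product using (_,_; proj₁; proj₂; ∃; ∃₂; map₂)
  open import Data.Sum using (inj₁; inj₂)
  open import Data.Empty using (⊥; ⊥-elim)
  open import Function using (_∘_; Equivalence)
  open import Relation.Nullary using (Dec; yes; no)
  open import Relation.Nullary.Decidable using (from-yes; from-no)
  open import Relation.Binary.PropositionalEquality hiding (_≡_; _≢_)

  -- The terms are moved so that no subtraction occurs; u = 0 would be the case n = 2, i.e. {x, y} = {1, 2}.
  Solution : ℕ → ℕ → ℕ → Set
  Solution q x y =
    (2 * (x + y) + q + 2 * q * x * y ≡ q * (x * x + y * y) + 6) ×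
    (∃ λ u → 1 ≤ u × 2 * (x + y) ≡ 6 + (q ∸ 1) * u)

  -- Junk value: the residue modulo 0 is the number itself.
  infixl 7 _mod_
  _mod_ : ℕ → ℕ → ℕ
  a mod zero  = a
  a mod suc m = a % suc m

  mod-idem : ∀ m a → (a mod m) mod m ≡ a mod m
  mod-idem zero    a = refl
  mod-idem (suc m) a = m%n%n≡m%n a (suc m)

  +-mod : ∀ m {a a′ b b′} → a mod m ≡ a′ mod m → b mod m ≡ b′ mod m → (a + b) mod m ≡ (a′ + b′) mod m
  +-mod zero    a≈ b≈ = cong₂ _+_ a≈ b≈
  +-mod (suc m) {a} {a′} {b} {b′} a≈ b≈ = trans (%-distribˡ-+ a b (suc m))
    (trans (cong₂ (λ s t → (s + t) % suc m) a≈ b≈) (sym (%-distribˡ-+ a′ b′ (suc m))))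

  *-mod : ∀ m {a a′ b b′} → a mod m ≡ a′ mod m → b mod m ≡ b′ mod m → (a * b) mod m ≡ (a′ * b′) mod m
  *-mod zero    a≈ b≈ = cong₂ _*_ a≈ b≈
  *-mod (suc m) {a} {a′} {b} {b′} a≈ b≈ = trans (%-distribˡ-* a b (suc m))
    (trans (cong₂ (λ s t → (s * t) % suc m) a≈ b≈) (sym (%-distribˡ-* a′ b′ (suc m))))

  -- Products of powers of given generators, and their residues

  data Generated : List ℕ → ℕ → Set where
    []  : Generated [] 1
    _∷_ : ∀ {g gs w} t → Generated gs w → Generated (g ∷ gs) (g ^ t * w)

  fixes : ℕ → List ℕ → ℕ → Bool
  fixes m []       a = true
  fixes m (r ∷ rs) a = ((r * a) mod m ≡ᵇ a) ∧ fixes m rs a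

  -- The generators are tested on `x` itself and not on 1. So a generator that is no unit modulo `m`
  -- can still fix `x`, for instance a prime `p` when `m` is a power of `p` dividing `x`.
  fixes⇒mod : ∀ m gs x {w} → T (fixes m (map (_mod m) gs) (x mod m)) → Generated gs w → (x * w) mod m ≡ x mod m
  fixes⇒mod m [] x _ [] = cong (_mod m) (*-identityʳ x)
  fixes⇒mod m (g ∷ gs) x fixed (_∷_ {w = w} t gen) with Equivalence.to (T-∧ {(g mod m * (x mod m)) mod m ≡ᵇ x mod m}) fixed
  ... | g-fixes , gs-fix = trans (cong (_mod m) (sym (*-assoc x (g ^ t) w)))
          (trans (*-mod m {x * g ^ t} {x} {w} {w} (power t) refl) (fixes⇒mod m gs x gs-fix gen))
    where
    once : (g * x) mod m ≡ x mod m
    once = trans (sym (*-mod m {g mod m} {g} {x mod m} {x} (mod-idem m g) (mod-idem m x))) (≡ᵇ⇒≡ _ _ g-fixes)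
    power : ∀ t → (x * g ^ t) mod m ≡ x mod m
    power zero    = cong (_mod m) (*-identityʳ x)
    power (suc t) = trans (cong (_mod m) (lemma x g (g ^ t))) (trans (*-mod m {g} {g} {x * g ^ t} {x} refl (power t)) once)
      where
      lemma : ∀ x g h → x * (g * h) ≡ g * (x * h)
      lemma = solve-∀

  powers : List ℕ → List ℕ → List ℕ
  powers (g ∷ gs) (k ∷ ks) = g ^ k ∷ powers gs ks
  powers gs       _        = gs

  representatives : List ℕ → List ℕ → List ℕ
  representatives (g ∷ gs) (k ∷ ks) = cartesianProductWith _*_ (applyUpTo (g ^_) k) (representatives gs ks)
  representatives _        _        = 1 ∷ []

  -- Each exponent is divided by its `k`, as `t = j + i k`: the factor `g ^ j` joins a finite list
  -- and `(g ^ k) ^ i` stays free. The product of `ks` is positive exactly when no `k` is 0, so that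
  -- all these divisions make sense.
  split : ∀ {gs} ks {w} → T (0 <ᵇ product ks) → Generated gs w →
    ∃₂ λ v w′ → v ∈ representatives gs ks × Generated (powers gs ks) w′ × w ≡ v * w′
  split {[]}     ks       _  []  = 1 , 1 , here refl , [] , refl
  split {g ∷ gs} []       _  (_∷_ {w = w} t gen) = 1 , g ^ t * w , here refl , t ∷ gen , sym (*-identityˡ _)
  split {g ∷ gs} (zero ∷ ks) () _
  split {g ∷ gs} (suc k ∷ ks) nz (_∷_ {w = w} t gen) with split ks (positive (product ks) nz) gen
    where
    positive : ∀ p → T (0 <ᵇ suc k * p) → T (0 <ᵇ p)
    positive zero    h rewrite *-zeroʳ k = h
    positive (suc p) _ = _
  ... | v , w′ , v∈ , gen′ , w≡ = g ^ j * v , (g ^ suc k) ^ i * w′ ,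
      ∈-cartesianProductWith⁺ _*_ (∈-applyUpTo⁺ (g ^_) (m%n<n t (suc k))) v∈ , i ∷ gen′ , (begin
        g ^ t * w                                 ≡⟨ cong₂ _*_ (cong (g ^_) (m≡m%n+[m/n]*n t (suc k))) w≡ ⟩
        g ^ (j + i * suc k) * (v * w′)            ≡⟨ cong (_* (v * w′)) (trans (^-distribˡ-+-* g j (i * suc k)) (cong (g ^ j *_) (trans (cong (g ^_) (*-comm i (suc k))) (sym (^-*-assoc g (suc k) i))))) ⟩
        g ^ j * (g ^ suc k) ^ i * (v * w′)        ≡⟨ lemma (g ^ j) ((g ^ suc k) ^ i) v w′ ⟩
        g ^ j * v * ((g ^ suc k) ^ i * w′)        ∎)
    where
    open ≡-Reasoning
    i = t / suc k
    j = t % suc k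
    lemma : ∀ a b c d → a * b * (c * d) ≡ a * c * (b * d)
    lemma = solve-∀

  -- Either the exponent of `p` is 0 and `p` leaves the generators, or one factor `p` is moved into
  -- the point while the exponent stays free. If `p` is not a generator, the single entry with
  -- factor 1 changes nothing.
  cuts : ℕ → List ℕ → List (ℕ × List ℕ)
  cuts p []       = (1 , []) ∷ []
  cuts p (g ∷ gs) = if p ≡ᵇ g then (1 , gs) ∷ (p , g ∷ gs) ∷ [] else map (map₂ (g ∷_)) (cuts p gs)

  cut-sound : ∀ p {gs w} → Generated gs w → ∃ λ c → c ∈ cuts p gs × ∃ λ w′ → Generated (proj₂ c) w′ × w ≡ proj₁ c * w′
  cut-sound p []  = (1 , []) , here refl , 1 , [] , refl
  cut-sound p {g ∷ gs} (_∷_ {w = w} t gen) with p ≡ᵇ g in eq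
  cut-sound p {g ∷ gs} (_∷_ {w = w} zero gen)    | true = (1 , gs) , here refl , w , gen , refl
  cut-sound p {g ∷ gs} (_∷_ {w = w} (suc t) gen) | true = (p , g ∷ gs) , there (here refl) , g ^ t * w , t ∷ gen ,
    trans (*-assoc g (g ^ t) w) (cong (_* (g ^ t * w)) (sym (≡ᵇ⇒≡ p g (subst T (sym eq) _))))
  cut-sound p {g ∷ gs} (_∷_ {w = w} t gen) | false with cut-sound p gen
  ... | (a , gs′) , c∈ , w′ , gen′ , w≡ = (a , g ∷ gs′) , ∈-map⁺ (map₂ (g ∷_)) c∈ , g ^ t * w′ , t ∷ gen′ ,
    trans (cong (g ^ t *_) w≡) (lemma (g ^ t) a w′)
    where
    lemma : ∀ h a w → h * (a * w) ≡ a * (h * w)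
    lemma = solve-∀

  -- Classes of candidate pairs, and sieving them by a modulus

  record Pattern : Set where
    constructor pattern-of
    field
      gensˣ gensʸ : List ℕ
      points      : List (ℕ × ℕ)

  Fits : ℕ → ℕ → Pattern → Set
  Fits x y (pattern-of gx gy pts) = ∃₂ λ x₀ y₀ → (x₀ , y₀) ∈ pts ×
    ∃₂ λ v w → Generated gx v × Generated gy w × x ≡ x₀ * v × y ≡ y₀ * w

  -- The flag `u` says that `m` divides `q - 1`. In that case the unknown quotient drops out of the
  -- second condition modulo `m`, and a congruence for `a + b` remains.
  solves : ℕ → ℕ → Bool → ℕ → ℕ → Bool
  solves q m u a b =
    ((2 * (a + b) + q + 2 * q * a * b) mod m ≡ᵇ (q * (a * a + b * b) + 6) mod m)
    ∧ (if u then (2 * (a + b)) mod m ≡ᵇ 6 mod m else true)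

  solves-sound : ∀ q m {x y a b} → Solution q x y → a mod m ≡ x mod m → b mod m ≡ y mod m →
    T (solves q m ((q ∸ 1) mod m ≡ᵇ 0 mod m) a b)
  solves-sound q m {x} {y} {a} {b} (eqn , u , _ , sum-eq) a≈ b≈ = Equivalence.from T-∧ (≡⇒≡ᵇ _ _ first , second)
    where
    doubled : (2 * (a + b)) mod m ≡ (2 * (x + y)) mod m
    doubled = *-mod m {2} {2} refl (+-mod m {a} {x} {b} {y} a≈ b≈)
    first : (2 * (a + b) + q + 2 * q * a * b) mod m ≡ (q * (a * a + b * b) + 6) mod m
    first = trans (+-mod m (+-mod m {2 * (a + b)} {2 * (x + y)} {q} {q} doubled refl)
                    (*-mod m {2 * q * a} {2 * q * x} {b} {y} (*-mod m {2 * q} {2 * q} {a} {x} refl a≈) b≈))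
           (trans (cong (_mod m) eqn)
             (sym (+-mod m {q * (a * a + b * b)} {q * (x * x + y * y)} {6} {6}
               (*-mod m {q} {q} refl (+-mod m {a * a} {x * x} {b * b} {y * y} (*-mod m {a} {x} {a} {x} a≈ a≈) (*-mod m {b} {y} {b} {y} b≈ b≈))) refl)))
    second : T (if (q ∸ 1) mod m ≡ᵇ 0 mod m then (2 * (a + b)) mod m ≡ᵇ 6 mod m else true)
    second with (q ∸ 1) mod m ≡ᵇ 0 mod m in eq
    ... | false = _
    ... | true  = ≡⇒≡ᵇ _ _ (trans doubled (trans (cong (_mod m) sum-eq)
      (+-mod m {6} {6} {(q ∸ 1) * u} {0} refl (*-mod m {q ∸ 1} {0} {u} {u} (≡ᵇ⇒≡ _ _ (subst T (sym eq) _)) refl))))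

  -- A congruence that fails at a point rules out its whole class only if the residues are the same
  -- throughout the class; hence the two tests with `fixes`.
  excluded : ℕ → ℕ → Bool → List ℕ → List ℕ → ℕ → ℕ → Bool
  excluded q m u rx ry a b = not (solves q m u a b) ∧ (fixes m rx a ∧ fixes m ry b)

  sieve : ℕ → ℕ → Bool → List ℕ → List ℕ → List (ℕ × ℕ) → List (ℕ × ℕ)
  sieve q m u rx ry []             = []
  sieve q m u rx ry ((x , y) ∷ ps) =
    if excluded q m u rx ry (x mod m) (y mod m) then sieve q m u rx ry ps else (x , y) ∷ sieve q m u rx ry ps

  sieve-∈ : ∀ q m u rx ry {x y} ps → ¬ T (excluded q m u rx ry (x mod m) (y mod m)) → (x , y) ∈ ps → (x , y) ∈ sieve q m u rx ry ps
  sieve-∈ q m u rx ry ((x , y) ∷ ps) ¬ex (here refl) with excluded q m u rx ry (x mod m) (y mod m)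
  ... | true  = ⊥-elim (¬ex _)
  ... | false = here refl
  sieve-∈ q m u rx ry ((x , y) ∷ ps) ¬ex (there ∈ps) with excluded q m u rx ry (x mod m) (y mod m)
  ... | true  = sieve-∈ q m u rx ry ps ¬ex ∈ps
  ... | false = there (sieve-∈ q m u rx ry ps ¬ex ∈ps)

  sift : ℕ → ℕ → Pattern → Pattern
  sift q m (pattern-of gx gy pts) =
    pattern-of gx gy (sieve q m ((q ∸ 1) mod m ≡ᵇ 0 mod m) (map (_mod m) gx) (map (_mod m) gy) pts)

  sift-sound : ∀ q m {x y} P → Solution q x y → Fits x y P → Fits x y (sift q m P)
  sift-sound q m {x} {y} (pattern-of gx gy pts) sol (x₀ , y₀ , ∈pts , v , w , gen-v , gen-w , x≡ , y≡) =
    x₀ , y₀ , sieve-∈ q m u rx ry pts not-excluded ∈pts , v , w , gen-v , gen-w , x≡ , y≡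
    where
    u = (q ∸ 1) mod m ≡ᵇ 0 mod m
    rx = map (_mod m) gx
    ry = map (_mod m) gy
    contra : ∀ {b} → T b → T (not b) → ⊥
    contra {true} _ ()
    not-excluded : ¬ T (excluded q m u rx ry (x₀ mod m) (y₀ mod m))
    not-excluded ex with Equivalence.to (T-∧ {not (solves q m u (x₀ mod m) (y₀ mod m))}) ex
    ... | unsolved , fixed with Equivalence.to (T-∧ {fixes m rx (x₀ mod m)}) fixed
    ... | fx , fy = contra (solves-sound q m sol
      (trans (mod-idem m x₀) (sym (trans (cong (_mod m) x≡) (fixes⇒mod m gx x₀ fx gen-v))))
      (trans (mod-idem m y₀) (sym (trans (cong (_mod m) y≡) (fixes⇒mod m gy y₀ fy gen-w))))) unsolved

  scaled : ℕ × ℕ → ℕ × ℕ → ℕ × ℕ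
  scaled (x , y) (a , b) = x * a , y * b

  refine : List ℕ → List ℕ → Pattern → Pattern
  refine kx ky (pattern-of gx gy pts) = pattern-of (powers gx kx) (powers gy ky)
    (cartesianProductWith scaled pts (cartesianProduct (representatives gx kx) (representatives gy ky)))

  refine-sound : ∀ kx ky {x y} P → T (0 <ᵇ product kx) → T (0 <ᵇ product ky) → Fits x y P → Fits x y (refine kx ky P)
  refine-sound kx ky (pattern-of gx gy pts) nzx nzy (x₀ , y₀ , ∈pts , v , w , gen-v , gen-w , x≡ , y≡)
    with split kx nzx gen-v | split ky nzy gen-w
  ... | a , v′ , a∈ , gen-v′ , v≡ | b , w′ , b∈ , gen-w′ , w≡ =
    x₀ * a , y₀ * b , ∈-cartesianProductWith⁺ scaled ∈pts (∈-cartesianProduct⁺ a∈ b∈) , v′ , w′ , gen-v′ , gen-w′ ,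
    trans x≡ (trans (cong (x₀ *_) v≡) (sym (*-assoc x₀ a v′))) ,
    trans y≡ (trans (cong (y₀ *_) w≡) (sym (*-assoc y₀ b w′)))

  search : (m g a fuel k v : ℕ) → ℕ
  search m g a zero       k v = 0
  search m g a (suc fuel) k v = if v ≡ᵇ a then k else search m g a fuel (suc k) ((v * g) mod m)

  -- The least k ≤ B with x gᵏ ≡ x (mod m), or 0 if there is none.
  period : ℕ → ℕ → ℕ → ℕ → ℕ
  period m B x g = go (g mod m) (x mod m)
    where
    go : ℕ → ℕ → ℕ
    go g a = search m g a B 1 ((a * g) mod m)

  testWith : ℕ → ℕ → ℕ → List ℕ → List ℕ → Pattern → Pattern
  testWith q m B kx ky P =
    if (0 <ᵇ product kx) ∧ (0 <ᵇ product ky) ∧ (product kx * product ky ≤ᵇ B) then sift q m (refine kx ky P) else P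

  -- The periods are a guess, read off from the first point alone. Soundness rests elsewhere:
  -- splitting exponents is correct for any positive periods, and `excluded` checks at each point
  -- anew that the residues are constant.
  test-by : ℕ → ℕ → ℕ → Pattern → Pattern
  test-by q m B (pattern-of gx gy [])             = pattern-of gx gy []
  test-by q m B P@(pattern-of gx gy ((x , y) ∷ _)) = testWith q m B (map (period m B x) gx) (map (period m B y) gy) P

  testWith-sound : ∀ q m B kx ky {x y} P → Solution q x y → Fits x y P → Fits x y (testWith q m B kx ky P)
  testWith-sound q m B kx ky P sol fits with (0 <ᵇ product kx) ∧ (0 <ᵇ product ky) ∧ (product kx * product ky ≤ᵇ B) in eq
  ... | false = fits
  ... | true with Equivalence.to (T-∧ {0 <ᵇ product kx}) (subst T (sym eq) _)
  ... | nzx , rest = sift-sound q m (refine kx ky P) sol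
    (refine-sound kx ky P nzx (proj₁ (Equivalence.to (T-∧ {0 <ᵇ product ky}) rest)) fits)

  test-sound : ∀ q m B {x y} P → Solution q x y → Fits x y P → Fits x y (test-by q m B P)
  test-sound q m B (pattern-of gx gy [])             sol fits = fits
  test-sound q m B P@(pattern-of gx gy ((x , y) ∷ _)) sol fits =
    testWith-sound q m B (map (period m B x) gx) (map (period m B y) gy) P sol fits

  -- Certificates and the soundness of a refutation

  scale-by : ℕ → ℕ → List (ℕ × ℕ) → List (ℕ × ℕ)
  scale-by a b = map (λ p → scaled p (a , b))

  -- cut p separates the multiples of p from the other numbers, on both sides. test m B splits the exponents into
  -- residue classes on which x and y are constant modulo m and discards the classes that violate the equations;
  -- it does nothing if this needs more than B classes per point.
  data Step : Set where
    cut  : ℕ → Step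
    test : ℕ → ℕ → Step

  member : ℕ → List ℕ → Bool
  member p []       = false
  member p (g ∷ gs) = (p ≡ᵇ g) ∨ member p gs

  single : List ℕ → List ℕ → Bool
  single (_ ∷ []) []       = true
  single []       (_ ∷ []) = true
  single _        _        = false

  -- Applied to points without free exponents. The first alternative is there for {1, 2}, which
  -- satisfies the equation for every `q` and contradicts only `1 ≤ u`.
  impossible : ℕ → ℕ × ℕ → Bool
  impossible q (x , y) = (x + y ≤ᵇ 3) ∨ not (2 * (x + y) + q + 2 * q * x * y ≡ᵇ q * (x * x + y * y) + 6)

  -- To keep the number of branches small, a cut is carried out in two situations only. If `p` is
  -- free on both sides, repeated cuts come to an end for `q ≠ 6` because common divisors of x and y
  -- divide `q - 6`. If a single generator is left on the two sides together, cuts peel off the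
  -- small values of its exponent; for even `q` this turns {1, 2} into a bare point, since there the
  -- other side is 1 and only the prime 2 is free.
  refuted : ℕ → List Step → Pattern → Bool
  refuted q ss              (pattern-of gx gy [])          = true
  refuted q []              (pattern-of gx gy pts@(_ ∷ _)) = null gx ∧ null gy ∧ all (impossible q) pts
  refuted q (cut p ∷ ss)    P@(pattern-of gx gy pts@(_ ∷ _)) =
    if (member p gx ∧ member p gy) ∨ single gx gy
    then all (λ c → all (λ d → refuted q ss (pattern-of (proj₂ c) (proj₂ d) (scale-by (proj₁ c) (proj₁ d) pts))) (cuts p gy)) (cuts p gx)
    else refuted q ss P
  refuted q (test m B ∷ ss) P@(pattern-of gx gy (_ ∷ _))   = refuted q ss (test-by q m B P)

  -- With `u ≥ 1` and `q ≥ 2` the second condition gives `2(x + y) ≥ 7`. This is where {1, 2} is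
  -- lost.
  sum>3 : ∀ {q x y} → 2 ≤ q → Solution q x y → ¬ (x + y ≤ 3)
  sum>3 {suc (suc q)} {x} {y} (s≤s (s≤s _)) (_ , suc u , _ , eq) x+y≤3 =
    <-irrefl refl (≤-trans (≤-trans (m≤m+n 7 (u + q * suc u)) (≤-reflexive (sym eq))) (*-monoʳ-≤ 2 x+y≤3))

  impossible-sound : ∀ {q x y} → 2 ≤ q → T (impossible q (x , y)) → ¬ Solution q x y
  impossible-sound {q} {x} {y} 2≤q imp sol with Equivalence.to (T-∨ {x + y ≤ᵇ 3}) imp
  ... | inj₁ small = sum>3 2≤q sol (≤ᵇ⇒≤ (x + y) 3 small)
  ... | inj₂ fails with 2 * (x + y) + q + 2 * q * x * y ≡ᵇ q * (x * x + y * y) + 6 in eq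
  ... | false = subst T eq (≡⇒≡ᵇ _ _ (proj₁ sol))

  lookup-all : ∀ {A : Set} (f : A → Bool) {xs x} → T (all f xs) → x ∈ xs → T (f x)
  lookup-all f {xs} holds x∈ = All.lookup (all⁺ f xs holds) x∈

  refuted-sound : ∀ {q x y} → 2 ≤ q → ∀ ss P → T (refuted q ss P) → Solution q x y → ¬ Fits x y P
  refuted-sound 2≤q ss (pattern-of gx gy []) ref sol (_ , _ , () , _)
  refuted-sound {q} 2≤q [] (pattern-of gx gy pts@(_ ∷ _)) ref sol fits with Equivalence.to (T-∧ {null gx}) ref
  refuted-sound {q} 2≤q [] (pattern-of [] gy pts@(_ ∷ _)) ref sol fits | _ , ref′ with Equivalence.to (T-∧ {null gy}) ref′
  refuted-sound {q} {x} {y} 2≤q [] (pattern-of [] [] pts@(_ ∷ _)) ref sol (x₀ , y₀ , ∈pts , _ , _ , [] , [] , x≡ , y≡) | _ , _ | _ , imps =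
    impossible-sound 2≤q (lookup-all (impossible q) imps ∈pts)
      (subst₂ (Solution q) (trans x≡ (*-identityʳ x₀)) (trans y≡ (*-identityʳ y₀)) sol)
  refuted-sound {q} 2≤q (cut p ∷ ss) P@(pattern-of gx gy pts@(_ ∷ _)) ref sol fits with (member p gx ∧ member p gy) ∨ single gx gy
  ... | false = refuted-sound 2≤q ss P ref sol fits
  refuted-sound {q} 2≤q (cut p ∷ ss) P@(pattern-of gx gy pts@(_ ∷ _)) ref sol (x₀ , y₀ , ∈pts , _ , _ , gen-v , gen-w , x≡ , y≡) | true
    with cut-sound p gen-v | cut-sound p gen-w
  ... | (a , gx′) , c∈ , v′ , gen-v′ , v≡ | (b , gy′) , d∈ , w′ , gen-w′ , w≡ =
    refuted-sound 2≤q ss (pattern-of gx′ gy′ (scale-by a b pts))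
      (lookup-all (λ d → refuted q ss (pattern-of gx′ (proj₂ d) (scale-by a (proj₁ d) pts)))
        (lookup-all (λ c → all (λ d → refuted q ss (pattern-of (proj₂ c) (proj₂ d) (scale-by (proj₁ c) (proj₁ d) pts))) (cuts p gy)) ref c∈) d∈)
      sol
      (x₀ * a , y₀ * b , ∈-map⁺ (λ p → scaled p (a , b)) ∈pts , v′ , w′ , gen-v′ , gen-w′ ,
        trans x≡ (trans (cong (x₀ *_) v≡) (sym (*-assoc x₀ a v′))) ,
        trans y≡ (trans (cong (y₀ *_) w≡) (sym (*-assoc y₀ b w′))))
  refuted-sound {q} 2≤q (test m B ∷ ss) P@(pattern-of gx gy (_ ∷ _)) ref sol fits =
    refuted-sound 2≤q ss (test-by q m B P) ref sol (test-sound q m B P sol fits)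

  -- From the product equation to the starting class

  Solution-sym : ∀ {q x y} → Solution q x y → Solution q y x
  Solution-sym {q} {x} {y} (eqn , u , 1≤u , sum-eq) =
    trans (left q x y) (trans eqn (right q x y)) , u , 1≤u , trans (cong (2 *_) (+-comm y x)) sum-eq
    where
    left : ∀ q x y → 2 * (y + x) + q + 2 * q * y * x ≡ 2 * (x + y) + q + 2 * q * x * y
    left = solve-∀
    right : ∀ q x y → q * (x * x + y * y) + 6 ≡ q * (y * y + x * x) + 6
    right = solve-∀

  ^-distribʳ-* : ∀ k m n → (m * n) ^ k ≡ m ^ k * n ^ k
  ^-distribʳ-* zero    m n = refl
  ^-distribʳ-* (suc k) m n = trans (cong (m * n *_) (^-distribʳ-* k m n)) (lemma m n (m ^ k) (n ^ k))
    where
    lemma : ∀ a b c d → a * b * (c * d) ≡ a * c * (b * d)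
    lemma = solve-∀

  ^-mono-∣ : ∀ k {m n} → m ∣ n → m ^ k ∣ n ^ k
  ^-mono-∣ zero    m∣n = ∣-refl
  ^-mono-∣ (suc k) m∣n = *-pres-∣ m∣n (^-mono-∣ k m∣n)

  prime-∣-^ : ∀ {p} → Prime p → ∀ m k → p ∣ m ^ k → p ∣ m
  prime-∣-^ pp m zero    p∣1 = ∣-trans p∣1 (1∣ m)
  prime-∣-^ pp m (suc k) p∣ with euclidsLemma m (m ^ k) pp p∣
  ... | inj₁ p∣m  = p∣m
  ... | inj₂ p∣mᵏ = prime-∣-^ pp m k p∣mᵏ

  ∤⇒coprime : ∀ {p n} → Prime p → ¬ p ∣ n → Coprime n p
  ∤⇒coprime pp p∤n (d∣n , d∣p) with prime⇒irreducible pp d∣p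
  ... | inj₁ d≡1  = d≡1
  ... | inj₂ refl = ⊥-elim (p∤n d∣n)

  strip : ∀ {p} → Prime p → ∀ k {m x} → x ∣ p ^ k * m → ∃₂ λ t x′ → x ≡ p ^ t * x′ × x′ ∣ m
  strip pp zero    {m} {x} x∣ = 0 , x , sym (+-identityʳ x) , subst (x ∣_) (+-identityʳ m) x∣
  strip {p} pp (suc k) {m} {x} x∣ with p ∣? x
  ... | no p∤x = strip pp k (coprime-divisor (∤⇒coprime pp p∤x) (subst (x ∣_) (*-assoc p (p ^ k) m) x∣))
  ... | yes (divides x₁ refl) with strip pp k (*-cancelˡ-∣ p {{prime⇒nonZero pp}} (subst₂ _∣_ (*-comm x₁ p) (*-assoc p (p ^ k) m) x∣))
  ...   | t , x′ , refl , x′∣m = suc t , x′ , trans (*-comm (p ^ t * x′) p) (sym (*-assoc p (p ^ t) x′)) , x′∣m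

  generated : ∀ {ps} → All Prime ps → ∀ k {x} → x ∣ product ps ^ k → Generated ps x
  generated []         k {x} x∣ = subst (Generated []) (sym (∣1⇒≡1 (subst (x ∣_) (^-zeroˡ k) x∣))) []
  generated {p ∷ ps} (pp ∷ pps) k {x} x∣ with strip pp k (subst (x ∣_) (^-distribʳ-* k p (product ps)) x∣)
  ... | t , x′ , refl , x′∣ = t ∷ generated pps k x′∣

  -- Only the primality of the entries is established. An omission could not do harm unnoticed:
  -- `valid` checks that the divisors found account for all of `q`, and `all-classified` checks that
  -- each prime power in question is found.
  primes : List ℕ
  primes =
    2 ∷ 3 ∷ 5 ∷ 7 ∷ 11 ∷ 13 ∷ 17 ∷ 19 ∷ 23 ∷ 29 ∷ 31 ∷ 37 ∷ 41 ∷ 43 ∷ 47 ∷ 53 ∷ 59 ∷ 61 ∷ 67 ∷ 71 ∷ 73 ∷ 79 ∷ 83 ∷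
    89 ∷ 97 ∷ 101 ∷ 103 ∷ 107 ∷ 109 ∷ 113 ∷ 127 ∷ 131 ∷ 137 ∷ 139 ∷ 149 ∷ 151 ∷ 157 ∷ 163 ∷ 167 ∷ 173 ∷ 179 ∷ 181 ∷
    191 ∷ 193 ∷ 197 ∷ 199 ∷ []

  primes-prime : All Prime primes
  primes-prime = from-yes (All.all? prime? primes)

  primeDivisors : ℕ → List ℕ
  primeDivisors q = filterᵇ (λ p → q mod p ≡ᵇ 0) primes

  primeDivisors-prime : ∀ q → All Prime (primeDivisors q)
  primeDivisors-prime q = filter⁺ (T? ∘ (λ p → q mod p ≡ᵇ 0)) primes-prime

  -- For odd q exactly one of x and y is even, and it is not divisible by 4; by symmetry it is x.
  start : ℕ → Pattern
  start q = pattern-of (primeDivisors q) (primeDivisors q) (((if q mod 2 ≡ᵇ 0 then 1 else 2) , 1) ∷ [])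

  -- No prime occurs more than 9 times in a number below 2¹⁰.
  valid : ℕ × List Step → Bool
  valid (q , ss) = ((product (primeDivisors q) ^ 9) mod q ≡ᵇ 0) ∧ refuted q ss (start q)

  mod≡0⇒∣ : ∀ {m q} → 1 ≤ q → T (m mod q ≡ᵇ 0) → q ∣ m
  mod≡0⇒∣ {m} {suc q} _ eq = m%n≡0⇒n∣m m (suc q) (≡ᵇ⇒≡ _ _ eq)

  valid⇒no-solution : ∀ {q} ss → T (valid (q , ss)) → 2 ≤ q → ∀ {x y M k K} →
    M ∣ q ^ K → x * y * M ≡ 2 * q ^ k → ¬ Solution q x y
  valid⇒no-solution {q} ss ok 2≤q {x} {y} {M} {k} {K} M∣ xyM sol
    with Equivalence.to (T-∧ {(product (primeDivisors q) ^ 9) mod q ≡ᵇ 0}) ok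
  ... | q-smooth , ref = go (2 ∣? q)
    where
    ps = primeDivisors q
    gen : ∀ l {z} → z ∣ q ^ l → Generated ps z
    -- Since `q` divides the ninth power of the product of `ps`, its power `q ^ l` divides the power
    -- with exponent `9 * l`.
    gen l {z} z∣ = generated (primeDivisors-prime q) (9 * l)
      (∣-trans z∣ (subst (q ^ l ∣_) (^-*-assoc (product ps) 9 l) (^-mono-∣ l (mod≡0⇒∣ (≤-trans (s≤s z≤n) 2≤q) q-smooth))))
    2-prime : Prime 2
    2-prime = from-yes (prime? 2)
    refute : ∀ {x y s} → Solution q x y → (if q mod 2 ≡ᵇ 0 then 1 else 2) ≡ s → (∃ λ v → x ≡ s * v × Generated ps v) → Generated ps y → ⊥
    refute {x} {y} sol refl (v , x≡ , gen-v) gen-y = refuted-sound 2≤q ss (start q) ref sol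
      (_ , 1 , here refl , v , y , gen-v , gen-y , x≡ , sym (+-identityʳ y))
    go : Dec (2 ∣ q) → ⊥
    -- For even `q` the extra factor 2 is absorbed: `2 * q ^ k` divides `q ^ (1 + k)`, so x and y
    -- contain only primes of `q`.
    go (yes 2∣q) = refute sol even (x , sym (+-identityʳ x) , gen (suc k) (∣-trans (divides (y * M) (trans (sym xyM) (lemma x y M))) 2q∣))
        (gen (suc k) (∣-trans (divides (x * M) (trans (sym xyM) (lemma′ x y M))) 2q∣))
      where
      2q∣ : 2 * q ^ k ∣ q ^ suc k
      2q∣ = *-monoˡ-∣ (q ^ k) 2∣q
      lemma : ∀ x y M → x * y * M ≡ y * M * x
      lemma = solve-∀
      lemma′ : ∀ x y M → x * y * M ≡ x * M * y
      lemma′ = solve-∀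
      even : (if q mod 2 ≡ᵇ 0 then 1 else 2) ≡ 1
      even rewrite n∣m⇒m%n≡0 q 2 2∣q = refl
    -- For odd `q` also `M` is odd, as a divisor of `q ^ K`. So the factor 2 lies in x or in y;
    -- after halving that one, both divide `q ^ k`.
    go (no 2∤q) with euclidsLemma (x * y) M 2-prime (divides (q ^ k) (trans xyM (*-comm 2 (q ^ k))))
    ... | inj₂ 2∣M = 2∤q (prime-∣-^ 2-prime q K (∣-trans 2∣M M∣))
    ... | inj₁ 2∣xy = split-even (euclidsLemma x y 2-prime 2∣xy)
      where
      odd : (if q mod 2 ≡ᵇ 0 then 1 else 2) ≡ 2
      odd with q mod 2 ≡ᵇ 0 in eq
      ... | true  = ⊥-elim (2∤q (mod≡0⇒∣ {q} {2} (s≤s z≤n) (subst T (sym eq) _)))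
      ... | false = refl
      half : ∀ {x y} → 2 ∣ x → x * y * M ≡ 2 * q ^ k → Solution q x y → ⊥
      half {_} {y} (divides v refl) xyM sol = refute sol odd (v , *-comm v 2 , gen k (divides (y * M) (trans (sym vyM) (lemma′ v y M))))
          (gen k (divides (v * M) (trans (sym vyM) (lemma″ v y M))))
        where
        lemma : ∀ v y M → 2 * (v * y * M) ≡ v * 2 * y * M
        lemma = solve-∀
        lemma′ : ∀ x y M → x * y * M ≡ y * M * x
        lemma′ = solve-∀
        lemma″ : ∀ x y M → x * y * M ≡ x * M * y
        lemma″ = solve-∀
        vyM : v * y * M ≡ q ^ k
        vyM = *-cancelˡ-≡ (v * y * M) (q ^ k) 2 (trans (lemma v y M) xyM)
      split-even : 2 ∣ x ⊎ 2 ∣ y → ⊥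
      split-even (inj₁ 2∣x) = half 2∣x xyM sol
      split-even (inj₂ 2∣y) = half 2∣y (trans (cong (_* M) (*-comm y x)) xyM) (Solution-sym {q} {x} {y} sol)

  -- The case q = 6

  power-of-2 : ∀ {z} → Generated (2 ∷ 3 ∷ []) z → ¬ 3 ∣ z → ∃ λ i → z ≡ 2 ^ i
  power-of-2 (i ∷ (zero ∷ []))  3∤z = i , *-identityʳ (2 ^ i)
  power-of-2 (i ∷ (suc j ∷ [])) 3∤z = ⊥-elim (3∤z (divides (2 ^ i * 3 ^ j) (lemma (2 ^ i) (3 ^ j))))
    where
    lemma : ∀ a b → a * (3 * b * 1) ≡ a * b * 3
    lemma = solve-∀

  2,3-prime : All Prime (2 ∷ 3 ∷ [])
  2,3-prime = from-yes (All.all? prime? (2 ∷ 3 ∷ []))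

  -- Here `z` divides `4 * 6 ^ k`, and `6 ^ (2 + k)` is 9 times that number. So only 2 and 3 can
  -- occur in `z`, and 3 does not.
  divisor-power-of-2 : ∀ k {z w} → z ∣ 2 * w → w ∣ 2 * 6 ^ k → ¬ 3 ∣ z → ∃ λ i → z ≡ 2 ^ i
  divisor-power-of-2 k z∣ w∣ = power-of-2 (generated 2,3-prime (2 + k)
    (∣-trans z∣ (∣-trans (*-monoʳ-∣ 2 w∣) (divides 9 (lemma (6 ^ k))))))
    where
    lemma : ∀ h → 6 * (6 * h) ≡ 9 * (2 * (2 * h))
    lemma = solve-∀

  4∣2^2+ : ∀ i → 4 ∣ 2 ^ (2 + i)
  4∣2^2+ i = divides (2 ^ i) (lemma (2 ^ i))
    where
    lemma : ∀ h → 2 * (2 * h) ≡ h * 4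
    lemma = solve-∀

  2^≥3⇒4∣ : ∀ i {n} → n ≡ 2 ^ i → 3 ≤ n → 4 ∣ n
  2^≥3⇒4∣ zero          refl (s≤s ())
  2^≥3⇒4∣ (suc zero)    refl (s≤s (s≤s ()))
  2^≥3⇒4∣ (suc (suc i)) refl _ = 4∣2^2+ i

  -- For `e ≥ 1` both powers are at least 3 and hence divisible by 4, so they cannot differ by 2.
  powers-of-2-apart-2 : ∀ e i j → 3 * e + 2 ≡ 2 ^ i → 3 * e + 4 ≡ 2 ^ j → e ≡ 0
  powers-of-2-apart-2 zero    i j _ _ = refl
  powers-of-2-apart-2 (suc e) i j eq eq′ = ⊥-elim (from-no (4 ∣? 2) (∣m+n∣m⇒∣n {m = 3 * suc e + 2}
      (subst (4 ∣_) (sym (+-assoc (3 * suc e) 2 2)) (2^≥3⇒4∣ j eq′ (≤-trans 3≤ (m≤m+n (3 * suc e) 4)))) (2^≥3⇒4∣ i eq (≤-trans 3≤ (m≤m+n (3 * suc e) 2)))))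
    where
    3≤ : 3 ≤ 3 * suc e
    3≤ = *-monoʳ-≤ 3 (s≤s z≤n)

  -- For q = 6 and x = y + d the equation reads 2y = d(3d - 1), 2x = d(3d + 1); hence 3d - 1 and 3d + 1
  -- are both powers of 2. Below d = e + 1.
  equation-6 : ∀ y d → 2 * (y + d + y) + 6 + 2 * 6 * (y + d) * y ≡ 6 * ((y + d) * (y + d) + y * y) + 6 → 2 * y + d ≡ 3 * (d * d)
  equation-6 y d eq = *-cancelˡ-≡ (2 * y + d) (3 * (d * d)) 2
      (+-cancelʳ-≡ (12 * ((y + d) * y) + 6) (2 * (2 * y + d)) (2 * (3 * (d * d))) (trans (left y d) (trans eq (right y d))))
    where
    left : ∀ y d → 2 * (2 * y + d) + (12 * ((y + d) * y) + 6) ≡ 2 * (y + d + y) + 6 + 2 * 6 * (y + d) * y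
    left = solve-∀
    right : ∀ y d → 6 * ((y + d) * (y + d) + y * y) + 6 ≡ 2 * (3 * (d * d)) + (12 * ((y + d) * y) + 6)
    right = solve-∀

  difference-6 : ∀ y e k M → 2 * y + suc e ≡ 3 * (suc e * suc e) → (y + suc e) * y * M ≡ 2 * 6 ^ k → e ≡ 0
  difference-6 y e k M key xyM = powers-of-2-apart-2 e (proj₁ low) (proj₁ high) (proj₂ low) (proj₂ high)
    where
    lemma : ∀ x y M → x * y * M ≡ x * M * y
    lemma = solve-∀
    lemma′ : ∀ x y M → x * y * M ≡ y * M * x
    lemma′ = solve-∀
    square : ∀ e → 3 * (suc e * suc e) ≡ suc e * (3 * e + 2) + suc e
    square = solve-∀
    collect : ∀ e → suc e * (3 * e + 2) + 2 * suc e ≡ suc e * (3 * e + 4)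
    collect = solve-∀
    2y : 2 * y ≡ suc e * (3 * e + 2)
    2y = +-cancelʳ-≡ (suc e) (2 * y) (suc e * (3 * e + 2)) (trans key (square e))
    2x : 2 * (y + suc e) ≡ suc e * (3 * e + 4)
    2x = trans (*-distribˡ-+ 2 y (suc e)) (trans (cong (_+ 2 * suc e) 2y) (collect e))
    3∤ : ∀ r → ¬ 3 ∣ r → ¬ 3 ∣ 3 * e + r
    3∤ r 3∤r 3∣ = 3∤r (∣m+n∣m⇒∣n {m = 3 * e} 3∣ (m∣m*n e))
    low : ∃ λ i → 3 * e + 2 ≡ 2 ^ i
    low = divisor-power-of-2 k (divides (suc e) 2y) (divides ((y + suc e) * M) (trans (sym xyM) (lemma (y + suc e) y M))) (3∤ 2 (from-no (3 ∣? 2)))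
    high : ∃ λ i → 3 * e + 4 ≡ 2 ^ i
    high = divisor-power-of-2 k (divides (suc e) 2x) (divides (y * M) (trans (sym xyM) (lemma′ (y + suc e) y M))) (3∤ 4 (from-no (3 ∣? 4)))

  -- What survives is `d = 0` with `y = 0` and `d = 1` with `y = 1`, that is (0, 0) and (2, 1); in
  -- both cases the sum is at most 3.
  no-solution-6-ordered : ∀ y d {M k} → (y + d) * y * M ≡ 2 * 6 ^ k → ¬ Solution 6 (y + d) y
  no-solution-6-ordered y d {M} {k} xyM sol = sum>3 {6} {y + d} {y} (s≤s (s≤s z≤n)) sol (small d (equation-6 y d (proj₁ sol)) xyM)
    where
    small : ∀ d → 2 * y + d ≡ 3 * (d * d) → (y + d) * y * M ≡ 2 * 6 ^ k → y + d + y ≤ 3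
    small zero    key _   = subst (λ z → z + 0 + z ≤ 3) (sym y≡0) z≤n
      where
      y≡0 : y ≡ 0
      y≡0 = *-cancelˡ-≡ y 0 2 (m+n≡0⇒m≡0 (2 * y) key)
    small (suc e) key xyM = subst (λ f → y + suc f + y ≤ 3) (sym e≡0) (subst (λ z → z + 1 + z ≤ 3) (sym y≡1) ≤-refl)
      where
      e≡0 : e ≡ 0
      e≡0 = difference-6 y e k M key xyM
      y≡1 : y ≡ 1
      y≡1 = *-cancelˡ-≡ y 1 2 (+-cancelʳ-≡ 1 (2 * y) 2 (subst (λ f → 2 * y + suc f ≡ 3 * (suc f * suc f)) e≡0 key))

  no-solution-6 : ∀ {x y M k} → x * y * M ≡ 2 * 6 ^ k → ¬ Solution 6 x y
  no-solution-6 {x} {y} {M} {k} xyM sol with ≤-total y x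
  ... | inj₁ y≤x with m≤n⇒∃[o]m+o≡n y≤x
  ...   | d , refl = no-solution-6-ordered y d {M} {k} xyM sol
  no-solution-6 {x} {y} {M} {k} xyM sol | inj₂ x≤y with m≤n⇒∃[o]m+o≡n x≤y
  ...   | d , refl = no-solution-6-ordered x d {M} {k} (trans (cong (_* M) (*-comm (x + d) x)) xyM) (Solution-sym {6} {x} {x + d} sol)

  -- Classification of the alphabet sizes

  smooth⇒∣2310⁹ : ∀ {q} → 1 ≤ q → q ≤ 600 → SmallPrimeDivisors q → q ∣ 2310 ^ 9
  smooth⇒∣2310⁹ {q} 1≤q q≤600 smooth = subst (_∣ 2310 ^ 9) (sym q≡) (∣-trans (product-∣ fs-small) (divides (2310 ^ (9 ∸ length fs))
      (trans (cong (2310 ^_) (sym (m∸n+n≡m len≤9))) (^-distribˡ-+-* 2310 (9 ∸ length fs) (length fs)))))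
    where
    open PrimeFactorisation (factorise q {{>-nonZero 1≤q}}) renaming (factors to fs; isFactorisation to q≡; factorsPrime to fs-prime)
    product-∣ : ∀ {ps} → All (_∣ 2310) ps → product ps ∣ 2310 ^ length ps
    product-∣ []        = ∣-refl
    product-∣ (p∣ ∷ ps∣) = *-pres-∣ p∣ (product-∣ ps∣)
    small : ∀ {p} → p ≡ 2 ⊎ p ≡ 3 ⊎ p ≡ 5 ⊎ p ≡ 7 ⊎ p ≡ 11 → p ∣ 2310
    small (inj₁ refl)                      = divides 1155 refl
    small (inj₂ (inj₁ refl))               = divides 770 refl
    small (inj₂ (inj₂ (inj₁ refl)))        = divides 462 refl
    small (inj₂ (inj₂ (inj₂ (inj₁ refl)))) = divides 330 refl
    small (inj₂ (inj₂ (inj₂ (inj₂ refl)))) = divides 210 refl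
    all-small : ∀ {ps} → All Prime ps → product ps ∣ q → All (_∣ 2310) ps
    all-small []         _  = []
    all-small {p ∷ ps} (pp ∷ pps) ∣q = small (smooth p pp (∣-trans (m∣m*n (product ps)) ∣q)) ∷ all-small pps (∣-trans (n∣m*n p) ∣q)
    fs-small : All (_∣ 2310) fs
    fs-small = all-small fs-prime (∣-reflexive (sym q≡))
    2^length≤ : ∀ {ps} → All Prime ps → 2 ^ length ps ≤ product ps
    2^length≤ []         = ≤-refl
    2^length≤ (pp ∷ pps) = *-mono-≤ (nonTrivial⇒n>1 _ {{prime⇒nonTrivial pp}}) (2^length≤ pps)
    len≤9 : length fs ≤ 9
    len≤9 with length fs ≤? 9
    ... | yes le = le
    -- Ten prime factors would give `2 ^ 10 ≤ q`; here 1024 is written as 1 + 600 + 423.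
    ... | no nle = ⊥-elim (<⇒≱ (s≤s (m≤m+n 600 423)) (≤-trans (^-monoʳ-≤ 2 (≰⇒> nle)) (≤-trans (2^length≤ fs-prime) (≤-trans (≤-reflexive (sym q≡)) q≤600))))

  -- Produced by a greedy search for the order of the moduli that keeps few residue classes alive.
  certificates : List (ℕ × List Step)
  certificates =
    (10 , (cut 2 ∷ cut 2 ∷ cut 2 ∷ test 8 1 ∷ cut 5 ∷ cut 2 ∷ cut 2 ∷ cut 2 ∷ cut 2 ∷ test 64 1 ∷ test 5 4 ∷
        test 8 2 ∷ test 3 2 ∷ test 9 9 ∷ test 7 1 ∷ [])) ∷
    (12 , (cut 2 ∷ cut 2 ∷ test 4 1 ∷ cut 3 ∷ cut 3 ∷ test 9 1 ∷ cut 2 ∷ cut 2 ∷ cut 2 ∷ cut 2 ∷ cut 2 ∷ test 64 1 ∷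
        test 3 2 ∷ test 9 2 ∷ test 11 25 ∷ test 31 6 ∷ [])) ∷
    (14 , (cut 2 ∷ cut 2 ∷ cut 2 ∷ cut 2 ∷ test 16 1 ∷ cut 7 ∷ test 7 1 ∷ cut 2 ∷ cut 2 ∷ test 8 1 ∷ test 7 3 ∷ [])) ∷
    (15 , (cut 3 ∷ cut 3 ∷ cut 3 ∷ test 27 1 ∷ cut 5 ∷ test 5 1 ∷ cut 3 ∷ test 81 1 ∷ cut 5 ∷ test 25 1 ∷ test 3 2 ∷
        test 9 2 ∷ test 27 2 ∷ test 8 2 ∷ test 5 2 ∷ test 25 5 ∷ test 31 9 ∷ [])) ∷
    (18 , (cut 2 ∷ cut 2 ∷ cut 2 ∷ test 8 1 ∷ cut 3 ∷ cut 3 ∷ test 9 1 ∷ cut 2 ∷ cut 2 ∷ test 8 1 ∷ test 16 1 ∷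
        cut 3 ∷ test 27 1 ∷ test 3 2 ∷ test 7 18 ∷ [])) ∷
    (20 , (cut 2 ∷ cut 2 ∷ test 4 1 ∷ cut 5 ∷ cut 2 ∷ cut 2 ∷ test 8 1 ∷ test 5 4 ∷ test 8 2 ∷ [])) ∷
    (21 , (cut 3 ∷ cut 3 ∷ test 9 1 ∷ cut 7 ∷ test 7 1 ∷ test 3 1 ∷ cut 3 ∷ cut 3 ∷ cut 3 ∷ cut 3 ∷ cut 3 ∷
        test 2187 1 ∷ test 7 6 ∷ test 8 2 ∷ [])) ∷
    (22 , (cut 2 ∷ cut 2 ∷ cut 2 ∷ cut 2 ∷ cut 2 ∷ test 32 1 ∷ cut 11 ∷ test 11 1 ∷ cut 2 ∷ test 16 1 ∷ cut 2 ∷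
        test 8 1 ∷ test 5 4 ∷ test 3 2 ∷ test 11 5 ∷ test 8 1 ∷ test 61 6 ∷ [])) ∷
    (24 , (cut 2 ∷ cut 2 ∷ test 4 1 ∷ cut 3 ∷ cut 3 ∷ cut 3 ∷ test 27 1 ∷ cut 2 ∷ cut 2 ∷ test 8 1 ∷ cut 2 ∷ cut 2 ∷
        cut 2 ∷ cut 2 ∷ test 128 1 ∷ test 3 2 ∷ test 9 2 ∷ test 27 2 ∷ test 13 18 ∷ test 7 2 ∷ [])) ∷
    (26 , (cut 2 ∷ cut 2 ∷ cut 2 ∷ test 8 1 ∷ cut 13 ∷ test 13 1 ∷ cut 2 ∷ cut 2 ∷ test 8 1 ∷ cut 2 ∷ test 32 1 ∷
        test 3 2 ∷ test 13 6 ∷ test 8 2 ∷ test 61 15 ∷ [])) ∷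
    (28 , (cut 2 ∷ cut 2 ∷ test 4 1 ∷ cut 7 ∷ cut 2 ∷ cut 2 ∷ test 8 1 ∷ test 7 3 ∷ [])) ∷
    (30 , (cut 2 ∷ cut 2 ∷ cut 2 ∷ cut 2 ∷ test 16 1 ∷ cut 3 ∷ cut 3 ∷ test 9 1 ∷ cut 5 ∷ test 5 1 ∷ cut 2 ∷ cut 3 ∷
        test 27 1 ∷ test 3 4 ∷ test 9 2 ∷ test 5 16 ∷ test 13 18 ∷ test 7 3 ∷ test 27 1 ∷ test 81 3 ∷ test 73 6 ∷
        test 9 4 ∷ test 27 9 ∷ test 7 3 ∷ test 13 36 ∷ test 8 1 ∷ [])) ∷
    (33 , (cut 3 ∷ cut 3 ∷ cut 3 ∷ cut 3 ∷ test 81 1 ∷ cut 11 ∷ test 11 1 ∷ cut 3 ∷ test 243 1 ∷ test 3 2 ∷ test 9 2 ∷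
        test 27 2 ∷ test 61 40 ∷ test 8 1 ∷ [])) ∷
    (34 , (cut 2 ∷ cut 2 ∷ cut 2 ∷ test 8 1 ∷ cut 17 ∷ test 17 1 ∷ cut 2 ∷ cut 2 ∷ test 8 1 ∷ test 16 1 ∷ test 17 8 ∷
        [])) ∷
    (35 , (cut 5 ∷ test 5 1 ∷ cut 7 ∷ test 7 1 ∷ test 5 1 ∷ test 3 2 ∷ test 7 3 ∷ test 19 9 ∷ [])) ∷
    (36 , (cut 2 ∷ cut 2 ∷ test 4 1 ∷ cut 3 ∷ cut 3 ∷ test 9 1 ∷ cut 2 ∷ cut 2 ∷ test 8 1 ∷ cut 3 ∷ test 27 1 ∷
        test 3 2 ∷ test 7 18 ∷ [])) ∷
    (38 , (cut 2 ∷ cut 2 ∷ cut 2 ∷ cut 2 ∷ cut 2 ∷ cut 2 ∷ test 64 1 ∷ cut 19 ∷ test 19 1 ∷ cut 2 ∷ test 16 1 ∷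
        test 32 1 ∷ cut 2 ∷ test 8 1 ∷ test 128 1 ∷ test 3 2 ∷ test 9 3 ∷ test 19 3 ∷ test 27 3 ∷ test 7 2 ∷
        test 128 1 ∷ test 37 12 ∷ [])) ∷
    (39 , (cut 3 ∷ cut 3 ∷ test 9 1 ∷ cut 13 ∷ test 13 1 ∷ test 3 1 ∷ cut 3 ∷ test 27 1 ∷ test 4 2 ∷ test 13 3 ∷
        test 7 2 ∷ test 27 3 ∷ test 19 9 ∷ [])) ∷
    (40 , (cut 2 ∷ cut 2 ∷ test 4 1 ∷ cut 5 ∷ cut 2 ∷ cut 2 ∷ test 8 1 ∷ test 5 4 ∷ test 8 2 ∷ [])) ∷
    (42 , (cut 2 ∷ cut 2 ∷ cut 2 ∷ test 8 1 ∷ cut 3 ∷ cut 3 ∷ cut 3 ∷ test 27 1 ∷ cut 7 ∷ test 7 1 ∷ cut 2 ∷ cut 2 ∷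
        test 8 1 ∷ cut 2 ∷ cut 2 ∷ cut 2 ∷ cut 2 ∷ test 256 1 ∷ cut 3 ∷ test 81 1 ∷ test 3 2 ∷ test 9 2 ∷ test 7 18 ∷
        test 81 3 ∷ test 19 18 ∷ test 27 2 ∷ test 81 9 ∷ test 19 9 ∷ test 16 2 ∷ test 32 2 ∷ test 73 8 ∷ test 27 9 ∷
        test 19 3 ∷ [])) ∷
    (44 , (cut 2 ∷ cut 2 ∷ test 4 1 ∷ cut 11 ∷ cut 2 ∷ cut 2 ∷ test 8 1 ∷ test 11 10 ∷ test 5 2 ∷ [])) ∷
    (45 , (cut 3 ∷ cut 3 ∷ test 9 1 ∷ cut 5 ∷ test 5 1 ∷ test 3 2 ∷ test 8 2 ∷ test 5 2 ∷ test 8 4 ∷ [])) ∷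
    (46 , (cut 2 ∷ cut 2 ∷ cut 2 ∷ cut 2 ∷ test 16 1 ∷ cut 23 ∷ test 23 1 ∷ cut 2 ∷ cut 2 ∷ test 8 1 ∷ test 32 1 ∷
        test 23 11 ∷ test 16 2 ∷ test 32 1 ∷ test 89 44 ∷ [])) ∷
    (48 , (cut 2 ∷ cut 2 ∷ test 4 1 ∷ cut 3 ∷ cut 3 ∷ test 9 1 ∷ cut 2 ∷ cut 2 ∷ cut 2 ∷ cut 2 ∷ cut 2 ∷ cut 2 ∷
        cut 2 ∷ test 256 1 ∷ test 3 2 ∷ test 9 2 ∷ test 13 18 ∷ test 7 2 ∷ [])) ∷
    (50 , (cut 2 ∷ cut 2 ∷ cut 2 ∷ test 8 1 ∷ cut 5 ∷ cut 2 ∷ cut 2 ∷ test 16 1 ∷ test 5 4 ∷ test 3 2 ∷ test 8 1 ∷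
        test 13 6 ∷ [])) ∷
    (51 , (cut 3 ∷ cut 3 ∷ cut 3 ∷ test 27 1 ∷ cut 17 ∷ test 17 1 ∷ test 9 1 ∷ cut 3 ∷ cut 3 ∷ test 243 1 ∷ cut 17 ∷
        test 289 1 ∷ test 3 2 ∷ test 4 2 ∷ test 9 2 ∷ test 27 2 ∷ test 5 4 ∷ test 17 4 ∷ test 8 2 ∷ test 5 4 ∷
        test 81 1 ∷ [])) ∷
    (52 , (cut 2 ∷ cut 2 ∷ test 4 1 ∷ cut 13 ∷ test 13 1 ∷ cut 2 ∷ cut 2 ∷ test 8 1 ∷ test 3 2 ∷ test 13 6 ∷ [])) ∷
    (54 , (cut 2 ∷ cut 2 ∷ cut 2 ∷ cut 2 ∷ cut 2 ∷ test 32 1 ∷ cut 3 ∷ cut 3 ∷ test 9 1 ∷ cut 2 ∷ cut 2 ∷ cut 2 ∷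
        test 128 1 ∷ cut 3 ∷ cut 3 ∷ test 81 1 ∷ test 3 2 ∷ test 7 18 ∷ test 81 1 ∷ test 27 2 ∷ test 16 1 ∷
        test 73 6 ∷ [])) ∷
    (55 , (cut 5 ∷ test 5 1 ∷ cut 11 ∷ test 11 1 ∷ [])) ∷
    (56 , (cut 2 ∷ cut 2 ∷ test 4 1 ∷ cut 7 ∷ cut 2 ∷ cut 2 ∷ test 8 1 ∷ test 7 3 ∷ [])) ∷
    (57 , (cut 3 ∷ cut 3 ∷ test 9 1 ∷ cut 19 ∷ test 19 1 ∷ test 3 1 ∷ test 4 2 ∷ test 8 2 ∷ test 5 2 ∷ test 27 1 ∷
        [])) ∷
    (58 , (cut 2 ∷ cut 2 ∷ cut 2 ∷ test 8 1 ∷ cut 29 ∷ test 29 1 ∷ cut 2 ∷ cut 2 ∷ cut 2 ∷ test 32 1 ∷ test 3 4 ∷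
        test 8 1 ∷ test 5 2 ∷ test 29 7 ∷ test 8 1 ∷ [])) ∷
    (60 , (cut 2 ∷ cut 2 ∷ test 4 1 ∷ cut 3 ∷ cut 3 ∷ cut 3 ∷ cut 3 ∷ test 81 1 ∷ cut 5 ∷ test 5 1 ∷ cut 2 ∷ cut 2 ∷
        cut 2 ∷ cut 2 ∷ test 32 1 ∷ test 81 1 ∷ test 3 4 ∷ test 9 4 ∷ test 27 4 ∷ test 81 2 ∷ test 13 72 ∷ test 5 4 ∷
        test 7 54 ∷ [])) ∷
    (62 , (cut 2 ∷ cut 2 ∷ cut 2 ∷ cut 2 ∷ test 16 1 ∷ cut 31 ∷ test 31 1 ∷ cut 2 ∷ cut 2 ∷ test 8 1 ∷ cut 2 ∷
        test 64 1 ∷ test 31 5 ∷ [])) ∷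
    (63 , (cut 3 ∷ cut 3 ∷ test 9 1 ∷ cut 7 ∷ test 7 1 ∷ test 3 1 ∷ test 4 2 ∷ test 8 2 ∷ test 7 3 ∷ test 13 6 ∷
        test 8 4 ∷ [])) ∷
    (65 , (cut 5 ∷ test 5 1 ∷ cut 13 ∷ test 5 1 ∷ test 13 4 ∷ test 7 6 ∷ [])) ∷
    (66 , (cut 2 ∷ cut 2 ∷ cut 2 ∷ test 8 1 ∷ cut 3 ∷ cut 3 ∷ test 9 1 ∷ cut 11 ∷ test 11 1 ∷ cut 2 ∷ cut 2 ∷
        test 8 1 ∷ test 16 1 ∷ cut 3 ∷ test 27 1 ∷ test 11 5 ∷ test 3 4 ∷ test 9 2 ∷ test 5 16 ∷ test 27 3 ∷
        test 13 18 ∷ test 7 1 ∷ test 9 2 ∷ test 121 1 ∷ test 61 30 ∷ test 11 5 ∷ [])) ∷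
    (68 , (cut 2 ∷ cut 2 ∷ test 4 1 ∷ cut 17 ∷ cut 2 ∷ cut 2 ∷ test 8 1 ∷ test 17 8 ∷ [])) ∷
    (69 , (cut 3 ∷ cut 3 ∷ cut 3 ∷ test 27 1 ∷ cut 23 ∷ test 23 1 ∷ cut 3 ∷ cut 3 ∷ test 243 1 ∷ test 3 2 ∷ test 9 2 ∷
        test 11 5 ∷ test 61 40 ∷ [])) ∷
    (70 , (cut 2 ∷ cut 2 ∷ cut 2 ∷ cut 2 ∷ cut 2 ∷ cut 2 ∷ cut 2 ∷ test 128 1 ∷ cut 5 ∷ test 5 1 ∷ cut 7 ∷ test 7 1 ∷
        cut 2 ∷ test 5 4 ∷ test 3 4 ∷ test 25 1 ∷ test 7 9 ∷ test 25 1 ∷ test 16 1 ∷ test 32 1 ∷ test 64 1 ∷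
        test 9 9 ∷ test 8 1 ∷ test 19 9 ∷ test 8 1 ∷ [])) ∷
    (72 , (cut 2 ∷ cut 2 ∷ test 4 1 ∷ cut 3 ∷ cut 3 ∷ test 9 1 ∷ cut 2 ∷ cut 2 ∷ test 8 1 ∷ cut 3 ∷ test 27 1 ∷
        test 3 2 ∷ test 7 18 ∷ [])) ∷
    (74 , (cut 2 ∷ cut 2 ∷ cut 2 ∷ test 8 1 ∷ cut 37 ∷ test 37 1 ∷ cut 2 ∷ cut 2 ∷ test 8 1 ∷ cut 2 ∷ cut 2 ∷
        test 64 1 ∷ test 3 2 ∷ test 9 3 ∷ test 37 6 ∷ test 19 2 ∷ [])) ∷
    (75 , (cut 3 ∷ cut 3 ∷ test 9 1 ∷ cut 5 ∷ test 5 1 ∷ cut 3 ∷ cut 3 ∷ test 81 1 ∷ cut 5 ∷ cut 5 ∷ test 125 1 ∷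
        test 3 2 ∷ test 4 2 ∷ test 5 2 ∷ test 9 2 ∷ test 8 2 ∷ [])) ∷
    (76 , (cut 2 ∷ cut 2 ∷ test 4 1 ∷ cut 19 ∷ test 19 1 ∷ cut 2 ∷ cut 2 ∷ test 8 1 ∷ test 3 2 ∷ test 5 4 ∷
        test 19 9 ∷ test 8 1 ∷ [])) ∷
    (77 , (cut 7 ∷ test 7 1 ∷ cut 11 ∷ test 11 1 ∷ test 7 3 ∷ [])) ∷
    (78 , (cut 2 ∷ cut 2 ∷ cut 2 ∷ cut 2 ∷ test 16 1 ∷ cut 3 ∷ cut 3 ∷ cut 3 ∷ test 27 1 ∷ cut 13 ∷ test 13 1 ∷
        cut 2 ∷ cut 2 ∷ cut 2 ∷ cut 2 ∷ cut 2 ∷ test 256 1 ∷ test 3 2 ∷ test 9 2 ∷ test 27 2 ∷ test 13 6 ∷ test 7 36 ∷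
        test 8 1 ∷ test 81 1 ∷ test 32 1 ∷ [])) ∷
    (80 , (cut 2 ∷ cut 2 ∷ test 4 1 ∷ cut 5 ∷ cut 2 ∷ cut 2 ∷ test 8 1 ∷ test 5 4 ∷ test 8 2 ∷ [])) ∷
    (82 , (cut 2 ∷ cut 2 ∷ cut 2 ∷ test 8 1 ∷ cut 41 ∷ test 41 1 ∷ cut 2 ∷ cut 2 ∷ test 8 1 ∷ test 16 1 ∷ test 5 4 ∷
        test 41 5 ∷ [])) ∷
    (84 , (cut 2 ∷ cut 2 ∷ test 4 1 ∷ cut 3 ∷ cut 3 ∷ test 9 1 ∷ cut 7 ∷ test 7 1 ∷ cut 2 ∷ cut 2 ∷ test 8 1 ∷ cut 7 ∷
        test 49 1 ∷ test 3 2 ∷ test 9 2 ∷ test 7 6 ∷ test 27 9 ∷ test 19 9 ∷ test 81 3 ∷ test 37 2 ∷ test 4 4 ∷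
        test 8 1 ∷ test 5 8 ∷ test 16 1 ∷ test 27 3 ∷ test 13 3 ∷ [])) ∷
    (85 , (cut 5 ∷ test 5 1 ∷ cut 17 ∷ test 17 1 ∷ test 5 4 ∷ test 3 2 ∷ test 29 7 ∷ [])) ∷
    (86 , (cut 2 ∷ cut 2 ∷ cut 2 ∷ cut 2 ∷ cut 2 ∷ test 32 1 ∷ cut 43 ∷ test 43 1 ∷ cut 2 ∷ test 16 1 ∷ cut 2 ∷
        test 8 1 ∷ test 64 1 ∷ test 3 2 ∷ test 43 7 ∷ [])) ∷
    (87 , (cut 3 ∷ cut 3 ∷ cut 3 ∷ cut 3 ∷ cut 3 ∷ test 243 1 ∷ cut 29 ∷ test 29 1 ∷ test 81 1 ∷ cut 3 ∷ test 729 1 ∷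
        test 3 2 ∷ test 4 2 ∷ test 8 1 ∷ test 7 3 ∷ test 9 2 ∷ test 27 2 ∷ test 81 2 ∷ test 13 3 ∷ test 271 10 ∷
        test 7 6 ∷ [])) ∷
    (88 , (cut 2 ∷ cut 2 ∷ test 4 1 ∷ cut 11 ∷ cut 2 ∷ cut 2 ∷ test 8 1 ∷ test 11 10 ∷ test 25 10 ∷ [])) ∷
    (90 , (cut 2 ∷ cut 2 ∷ cut 2 ∷ test 8 1 ∷ cut 3 ∷ cut 3 ∷ test 9 1 ∷ cut 5 ∷ test 5 1 ∷ cut 2 ∷ test 9 1 ∷
        test 3 4 ∷ test 7 108 ∷ test 9 1 ∷ test 5 2 ∷ test 13 8 ∷ test 32 1 ∷ test 5 1 ∷ test 27 1 ∷ test 16 2 ∷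
        test 32 2 ∷ test 73 18 ∷ [])) ∷
    (91 , (cut 7 ∷ test 7 1 ∷ cut 13 ∷ test 13 1 ∷ test 7 2 ∷ [])) ∷
    (92 , (cut 2 ∷ cut 2 ∷ test 4 1 ∷ cut 23 ∷ cut 2 ∷ cut 2 ∷ test 8 1 ∷ test 23 11 ∷ test 16 2 ∷ [])) ∷
    (93 , (cut 3 ∷ cut 3 ∷ test 9 1 ∷ cut 31 ∷ test 31 1 ∷ test 3 1 ∷ test 13 12 ∷ test 37 6 ∷ [])) ∷
    (95 , (cut 5 ∷ test 5 1 ∷ cut 19 ∷ test 5 1 ∷ test 19 9 ∷ test 5 2 ∷ [])) ∷
    (96 , (cut 2 ∷ cut 2 ∷ test 4 1 ∷ cut 3 ∷ cut 3 ∷ cut 3 ∷ test 27 1 ∷ cut 2 ∷ cut 2 ∷ test 8 1 ∷ cut 2 ∷ cut 2 ∷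
        cut 2 ∷ cut 2 ∷ cut 2 ∷ cut 2 ∷ test 512 1 ∷ test 3 2 ∷ test 9 2 ∷ test 5 16 ∷ test 27 1 ∷ test 41 10 ∷ [])) ∷
    (98 , (cut 2 ∷ cut 2 ∷ cut 2 ∷ test 8 1 ∷ cut 7 ∷ test 7 1 ∷ cut 2 ∷ cut 2 ∷ test 8 1 ∷ test 16 1 ∷ test 7 3 ∷
        [])) ∷
    (99 , (cut 3 ∷ cut 3 ∷ test 9 1 ∷ cut 11 ∷ test 11 1 ∷ test 3 2 ∷ test 4 2 ∷ test 8 2 ∷ test 9 1 ∷ test 5 4 ∷
        test 8 2 ∷ [])) ∷
    (100 , (cut 2 ∷ cut 2 ∷ test 4 1 ∷ cut 5 ∷ cut 2 ∷ cut 2 ∷ test 8 1 ∷ test 5 4 ∷ test 8 2 ∷ [])) ∷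
    (102 , (cut 2 ∷ cut 2 ∷ cut 2 ∷ cut 2 ∷ cut 2 ∷ cut 2 ∷ test 64 1 ∷ cut 3 ∷ cut 3 ∷ test 9 1 ∷ cut 17 ∷
        test 17 1 ∷ cut 2 ∷ test 9 1 ∷ cut 3 ∷ cut 3 ∷ cut 3 ∷ test 243 1 ∷ test 3 2 ∷ test 17 16 ∷ test 3 4 ∷
        test 9 2 ∷ test 5 32 ∷ test 27 1 ∷ test 17 8 ∷ test 27 3 ∷ test 16 1 ∷ test 13 9 ∷ test 81 3 ∷ test 13 9 ∷
        [])) ∷
    (104 , (cut 2 ∷ cut 2 ∷ test 4 1 ∷ cut 13 ∷ test 13 1 ∷ cut 2 ∷ cut 2 ∷ test 8 1 ∷ test 7 6 ∷ test 13 4 ∷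
        test 8 1 ∷ [])) ∷
    (105 , (cut 3 ∷ cut 3 ∷ cut 3 ∷ test 27 1 ∷ cut 5 ∷ test 5 1 ∷ cut 7 ∷ test 7 1 ∷ test 27 1 ∷ cut 5 ∷ test 25 1 ∷
        test 3 2 ∷ test 9 2 ∷ test 4 2 ∷ test 5 4 ∷ test 8 2 ∷ test 81 3 ∷ test 13 6 ∷ test 27 2 ∷ test 7 3 ∷
        test 8 4 ∷ test 5 4 ∷ test 13 18 ∷ [])) ∷
    (106 , (cut 2 ∷ cut 2 ∷ cut 2 ∷ test 8 1 ∷ cut 53 ∷ test 53 1 ∷ cut 2 ∷ cut 2 ∷ test 8 1 ∷ cut 2 ∷ cut 2 ∷ cut 2 ∷
        test 128 1 ∷ test 3 4 ∷ test 5 4 ∷ test 8 1 ∷ test 13 3 ∷ test 53 13 ∷ test 8 1 ∷ [])) ∷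
    (108 , (cut 2 ∷ cut 2 ∷ test 4 1 ∷ cut 3 ∷ cut 3 ∷ test 9 1 ∷ cut 2 ∷ cut 2 ∷ cut 2 ∷ cut 2 ∷ cut 2 ∷ test 64 1 ∷
        cut 3 ∷ cut 3 ∷ test 81 1 ∷ test 3 2 ∷ test 5 16 ∷ test 9 1 ∷ test 13 9 ∷ [])) ∷
    (110 , (cut 2 ∷ cut 2 ∷ cut 2 ∷ cut 2 ∷ test 16 1 ∷ cut 5 ∷ test 5 1 ∷ cut 11 ∷ test 11 1 ∷ cut 2 ∷ cut 2 ∷
        test 32 1 ∷ test 5 4 ∷ test 8 2 ∷ test 11 5 ∷ test 3 4 ∷ test 25 25 ∷ test 41 8 ∷ test 32 1 ∷ [])) ∷
    (111 , (cut 3 ∷ cut 3 ∷ test 9 1 ∷ cut 37 ∷ test 37 1 ∷ test 3 1 ∷ cut 3 ∷ test 27 1 ∷ test 8 2 ∷ test 37 9 ∷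
        [])) ∷
    (112 , (cut 2 ∷ cut 2 ∷ test 4 1 ∷ cut 7 ∷ cut 2 ∷ cut 2 ∷ test 8 1 ∷ test 7 3 ∷ [])) ∷
    (114 , (cut 2 ∷ cut 2 ∷ cut 2 ∷ test 8 1 ∷ cut 3 ∷ cut 3 ∷ cut 3 ∷ cut 3 ∷ test 81 1 ∷ cut 19 ∷ test 19 1 ∷
        cut 2 ∷ cut 2 ∷ test 16 1 ∷ cut 3 ∷ test 243 1 ∷ test 3 2 ∷ test 9 2 ∷ test 27 2 ∷ test 5 32 ∷ test 17 32 ∷
        test 19 9 ∷ test 32 1 ∷ test 41 25 ∷ test 81 1 ∷ test 25 5 ∷ test 11 1 ∷ [])) ∷
    (115 , (cut 5 ∷ test 5 1 ∷ cut 23 ∷ test 23 1 ∷ test 5 4 ∷ test 3 2 ∷ test 25 5 ∷ test 31 3 ∷ test 8 1 ∷ [])) ∷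
    (116 , (cut 2 ∷ cut 2 ∷ test 4 1 ∷ cut 29 ∷ test 29 1 ∷ cut 2 ∷ cut 2 ∷ test 8 1 ∷ test 5 8 ∷ test 29 7 ∷
        test 8 1 ∷ [])) ∷
    (117 , (cut 3 ∷ cut 3 ∷ test 9 1 ∷ cut 13 ∷ test 3 1 ∷ test 13 3 ∷ test 8 2 ∷ [])) ∷
    (118 , (cut 2 ∷ cut 2 ∷ cut 2 ∷ cut 2 ∷ cut 2 ∷ test 32 1 ∷ cut 59 ∷ test 59 1 ∷ cut 2 ∷ test 16 1 ∷ cut 2 ∷
        test 8 1 ∷ cut 2 ∷ cut 2 ∷ cut 2 ∷ test 512 1 ∷ test 59 58 ∷ test 1741 120 ∷ [])) ∷
    (119 , (cut 7 ∷ test 7 1 ∷ cut 17 ∷ test 17 1 ∷ test 7 1 ∷ test 8 2 ∷ test 17 8 ∷ test 5 4 ∷ [])) ∷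
    (120 , (cut 2 ∷ cut 2 ∷ test 4 1 ∷ cut 3 ∷ cut 3 ∷ test 9 1 ∷ cut 5 ∷ test 5 1 ∷ cut 2 ∷ cut 2 ∷ test 8 1 ∷
        test 9 1 ∷ cut 5 ∷ test 25 1 ∷ test 5 4 ∷ test 3 4 ∷ test 9 2 ∷ test 7 54 ∷ test 27 1 ∷ test 13 8 ∷ [])) ∷
    (122 , (cut 2 ∷ cut 2 ∷ cut 2 ∷ test 8 1 ∷ cut 61 ∷ test 61 1 ∷ cut 2 ∷ cut 2 ∷ test 8 1 ∷ cut 2 ∷ test 32 1 ∷
        test 3 2 ∷ test 5 2 ∷ test 61 15 ∷ test 13 3 ∷ [])) ∷
    (123 , (cut 3 ∷ cut 3 ∷ cut 3 ∷ test 27 1 ∷ cut 41 ∷ test 41 1 ∷ cut 3 ∷ test 81 1 ∷ test 9 2 ∷ test 5 4 ∷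
        test 41 2 ∷ [])) ∷
    (124 , (cut 2 ∷ cut 2 ∷ test 4 1 ∷ cut 31 ∷ cut 2 ∷ cut 2 ∷ test 8 1 ∷ test 31 5 ∷ [])) ∷
    (126 , (cut 2 ∷ cut 2 ∷ cut 2 ∷ cut 2 ∷ test 16 1 ∷ cut 3 ∷ cut 3 ∷ test 9 1 ∷ cut 7 ∷ test 7 1 ∷ cut 2 ∷ cut 3 ∷
        test 27 1 ∷ test 3 2 ∷ test 5 64 ∷ test 9 1 ∷ test 25 25 ∷ test 8 1 ∷ test 7 3 ∷ test 27 1 ∷ test 32 2 ∷
        test 11 5 ∷ [])) ∷
    (129 , (cut 3 ∷ cut 3 ∷ test 9 1 ∷ cut 43 ∷ test 43 1 ∷ test 3 1 ∷ cut 3 ∷ cut 3 ∷ test 81 1 ∷ test 4 2 ∷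
        test 7 3 ∷ test 43 7 ∷ [])) ∷
    (130 , (cut 2 ∷ cut 2 ∷ cut 2 ∷ test 8 1 ∷ cut 5 ∷ test 5 1 ∷ cut 13 ∷ test 13 1 ∷ cut 2 ∷ cut 2 ∷ test 8 1 ∷
        test 16 1 ∷ test 5 4 ∷ test 7 18 ∷ test 3 2 ∷ test 13 4 ∷ test 16 1 ∷ test 7 18 ∷ [])) ∷
    (132 , (cut 2 ∷ cut 2 ∷ test 4 1 ∷ cut 3 ∷ cut 3 ∷ cut 3 ∷ test 27 1 ∷ cut 11 ∷ test 11 1 ∷ cut 2 ∷ cut 2 ∷
        test 8 1 ∷ test 27 1 ∷ cut 11 ∷ test 121 1 ∷ test 11 5 ∷ test 3 4 ∷ test 9 4 ∷ test 27 2 ∷ test 5 16 ∷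
        test 8 1 ∷ test 27 2 ∷ test 81 9 ∷ test 121 1 ∷ test 7 9 ∷ test 13 2 ∷ test 61 5 ∷ test 11 1 ∷ [])) ∷
    (133 , (cut 7 ∷ test 7 1 ∷ cut 19 ∷ test 7 1 ∷ test 19 3 ∷ test 49 6 ∷ [])) ∷
    (134 , (cut 2 ∷ cut 2 ∷ cut 2 ∷ cut 2 ∷ cut 2 ∷ cut 2 ∷ cut 2 ∷ cut 2 ∷ test 256 1 ∷ cut 67 ∷ test 67 1 ∷ cut 2 ∷
        test 64 1 ∷ test 128 1 ∷ cut 2 ∷ test 8 1 ∷ test 512 1 ∷ test 3 2 ∷ test 11 5 ∷ test 31 3 ∷ test 9 3 ∷
        test 7 1 ∷ test 67 11 ∷ [])) ∷
    (135 , (cut 3 ∷ cut 3 ∷ test 9 1 ∷ cut 5 ∷ test 5 1 ∷ cut 5 ∷ test 25 1 ∷ test 3 2 ∷ test 4 2 ∷ test 5 2 ∷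
        test 9 2 ∷ test 8 2 ∷ [])) ∷
    (136 , (cut 2 ∷ cut 2 ∷ test 4 1 ∷ cut 17 ∷ cut 2 ∷ cut 2 ∷ test 8 1 ∷ test 17 8 ∷ [])) ∷
    (138 , (cut 2 ∷ cut 2 ∷ cut 2 ∷ test 8 1 ∷ cut 3 ∷ cut 3 ∷ test 9 1 ∷ cut 23 ∷ test 23 1 ∷ cut 2 ∷ cut 2 ∷ cut 2 ∷
        cut 2 ∷ test 64 1 ∷ cut 3 ∷ test 27 1 ∷ test 3 4 ∷ test 9 2 ∷ test 11 50 ∷ test 4 2 ∷ test 8 1 ∷ test 9 2 ∷
        test 31 15 ∷ test 23 11 ∷ test 27 9 ∷ test 13 6 ∷ test 7 2 ∷ test 4 4 ∷ test 16 2 ∷ test 32 4 ∷ test 5 2 ∷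
        test 61 5 ∷ test 8 4 ∷ test 32 2 ∷ test 64 4 ∷ test 5 2 ∷ test 41 5 ∷ test 25 1 ∷ [])) ∷
    (140 , (cut 2 ∷ cut 2 ∷ test 4 1 ∷ cut 5 ∷ test 5 1 ∷ cut 7 ∷ test 7 1 ∷ cut 2 ∷ cut 2 ∷ test 8 1 ∷ test 5 4 ∷
        test 3 4 ∷ test 7 9 ∷ test 9 3 ∷ test 13 4 ∷ test 9 9 ∷ test 19 9 ∷ test 8 1 ∷ [])) ∷
    (141 , (cut 3 ∷ cut 3 ∷ cut 3 ∷ cut 3 ∷ test 81 1 ∷ cut 47 ∷ test 47 1 ∷ cut 3 ∷ cut 3 ∷ test 729 1 ∷ test 3 2 ∷
        test 9 2 ∷ test 27 2 ∷ test 23 11 ∷ [])) ∷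
    (142 , (cut 2 ∷ cut 2 ∷ cut 2 ∷ cut 2 ∷ test 16 1 ∷ cut 71 ∷ test 71 1 ∷ cut 2 ∷ cut 2 ∷ test 8 1 ∷ test 32 1 ∷
        test 71 35 ∷ test 211 30 ∷ test 7 1 ∷ [])) ∷
    (143 , (cut 11 ∷ test 11 1 ∷ cut 13 ∷ test 13 1 ∷ test 11 1 ∷ test 3 2 ∷ test 13 6 ∷ test 7 2 ∷ test 61 3 ∷ [])) ∷
    (144 , (cut 2 ∷ cut 2 ∷ test 4 1 ∷ cut 3 ∷ cut 3 ∷ test 9 1 ∷ cut 2 ∷ cut 2 ∷ test 8 1 ∷ cut 3 ∷ test 27 1 ∷
        test 3 2 ∷ test 7 18 ∷ [])) ∷
    (145 , (cut 5 ∷ test 5 1 ∷ cut 29 ∷ test 29 1 ∷ test 5 2 ∷ test 3 2 ∷ test 16 2 ∷ [])) ∷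
    (146 , (cut 2 ∷ cut 2 ∷ cut 2 ∷ test 8 1 ∷ cut 73 ∷ test 73 1 ∷ cut 2 ∷ cut 2 ∷ test 8 1 ∷ test 16 1 ∷ test 73 9 ∷
        [])) ∷
    (147 , (cut 3 ∷ cut 3 ∷ test 9 1 ∷ cut 7 ∷ test 7 1 ∷ test 3 1 ∷ cut 3 ∷ test 27 1 ∷ test 7 6 ∷ test 8 2 ∷ [])) ∷
    (148 , (cut 2 ∷ cut 2 ∷ test 4 1 ∷ cut 37 ∷ test 37 1 ∷ cut 2 ∷ cut 2 ∷ test 8 1 ∷ test 3 2 ∷ test 37 18 ∷ [])) ∷
    (150 , (cut 2 ∷ cut 2 ∷ cut 2 ∷ cut 2 ∷ cut 2 ∷ test 32 1 ∷ cut 3 ∷ cut 3 ∷ cut 3 ∷ test 27 1 ∷ cut 5 ∷ test 5 1 ∷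
        cut 2 ∷ test 3 4 ∷ test 9 4 ∷ test 27 2 ∷ test 5 16 ∷ test 81 3 ∷ test 7 9 ∷ test 13 18 ∷ test 8 1 ∷
        test 27 4 ∷ test 81 9 ∷ test 7 3 ∷ test 8 1 ∷ test 25 5 ∷ test 125 5 ∷ test 13 4 ∷ test 32 2 ∷ test 13 36 ∷
        test 16 1 ∷ test 64 2 ∷ test 17 2 ∷ test 601 1 ∷ [])) ∷
    (152 , (cut 2 ∷ cut 2 ∷ test 4 1 ∷ cut 19 ∷ test 19 1 ∷ cut 2 ∷ cut 2 ∷ test 8 1 ∷ test 3 2 ∷ test 9 3 ∷
        test 19 3 ∷ test 27 3 ∷ [])) ∷
    (153 , (cut 3 ∷ cut 3 ∷ test 9 1 ∷ cut 17 ∷ test 17 1 ∷ test 9 1 ∷ test 3 2 ∷ test 4 2 ∷ test 8 1 ∷ test 17 8 ∷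
        test 8 2 ∷ [])) ∷
    (154 , (cut 2 ∷ cut 2 ∷ cut 2 ∷ test 8 1 ∷ cut 7 ∷ test 7 1 ∷ cut 11 ∷ test 11 1 ∷ cut 2 ∷ cut 2 ∷ test 8 1 ∷
        cut 2 ∷ test 32 1 ∷ test 7 9 ∷ test 9 4 ∷ test 11 5 ∷ test 61 4 ∷ [])) ∷
    (155 , (cut 5 ∷ test 5 1 ∷ cut 31 ∷ test 31 1 ∷ [])) ∷
    (156 , (cut 2 ∷ cut 2 ∷ test 4 1 ∷ cut 3 ∷ cut 3 ∷ test 9 1 ∷ cut 13 ∷ test 13 1 ∷ cut 2 ∷ cut 2 ∷ cut 2 ∷ cut 2 ∷
        cut 2 ∷ test 64 1 ∷ cut 13 ∷ test 169 1 ∷ test 3 2 ∷ test 9 2 ∷ test 13 3 ∷ test 27 9 ∷ test 7 4 ∷ test 8 1 ∷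
        test 13 6 ∷ test 5 8 ∷ test 27 3 ∷ test 13 3 ∷ [])) ∷
    (158 , (cut 2 ∷ cut 2 ∷ cut 2 ∷ cut 2 ∷ test 16 1 ∷ cut 79 ∷ test 79 1 ∷ cut 2 ∷ cut 2 ∷ test 8 1 ∷ cut 2 ∷
        cut 2 ∷ test 128 1 ∷ test 3 2 ∷ test 13 6 ∷ test 79 13 ∷ [])) ∷
    (159 , (cut 3 ∷ cut 3 ∷ cut 3 ∷ test 27 1 ∷ cut 53 ∷ test 53 1 ∷ test 9 1 ∷ cut 3 ∷ test 81 1 ∷ test 3 2 ∷
        test 4 2 ∷ test 8 1 ∷ test 9 2 ∷ test 27 2 ∷ test 13 3 ∷ test 81 1 ∷ [])) ∷
    (160 , (cut 2 ∷ cut 2 ∷ test 4 1 ∷ cut 5 ∷ cut 2 ∷ cut 2 ∷ test 8 1 ∷ test 5 4 ∷ test 8 2 ∷ [])) ∷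
    (161 , (cut 7 ∷ test 7 1 ∷ cut 23 ∷ test 23 1 ∷ test 7 3 ∷ [])) ∷
    (162 , (cut 2 ∷ cut 2 ∷ cut 2 ∷ test 8 1 ∷ cut 3 ∷ cut 3 ∷ test 9 1 ∷ cut 2 ∷ cut 2 ∷ test 8 1 ∷ cut 2 ∷ cut 2 ∷
        test 64 1 ∷ cut 3 ∷ cut 3 ∷ cut 3 ∷ test 243 1 ∷ test 3 2 ∷ test 5 16 ∷ test 9 1 ∷ test 41 10 ∷ test 64 1 ∷
        [])) ∷
    (164 , (cut 2 ∷ cut 2 ∷ test 4 1 ∷ cut 41 ∷ test 41 1 ∷ cut 2 ∷ cut 2 ∷ test 8 1 ∷ test 5 4 ∷ test 41 5 ∷ [])) ∷
    (165 , (cut 3 ∷ cut 3 ∷ test 9 1 ∷ cut 5 ∷ test 5 1 ∷ cut 11 ∷ test 11 1 ∷ test 9 1 ∷ test 3 2 ∷ test 5 4 ∷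
        test 8 4 ∷ test 11 25 ∷ [])) ∷
    (168 , (cut 2 ∷ cut 2 ∷ test 4 1 ∷ cut 3 ∷ cut 3 ∷ cut 3 ∷ cut 3 ∷ cut 3 ∷ test 243 1 ∷ cut 7 ∷ test 7 1 ∷ cut 2 ∷
        cut 2 ∷ cut 2 ∷ cut 2 ∷ cut 2 ∷ cut 2 ∷ test 128 1 ∷ test 81 1 ∷ test 3 2 ∷ test 9 2 ∷ test 27 2 ∷ test 81 2 ∷
        test 7 6 ∷ test 5 32 ∷ test 13 9 ∷ test 73 6 ∷ test 19 3 ∷ [])) ∷
    (170 , (cut 2 ∷ cut 2 ∷ cut 2 ∷ test 8 1 ∷ cut 5 ∷ test 5 1 ∷ cut 17 ∷ test 17 1 ∷ cut 2 ∷ cut 2 ∷ test 8 1 ∷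
        cut 2 ∷ cut 2 ∷ cut 2 ∷ cut 2 ∷ cut 2 ∷ cut 2 ∷ test 1024 1 ∷ test 5 4 ∷ test 3 4 ∷ test 13 36 ∷ test 7 3 ∷
        test 17 16 ∷ test 3 4 ∷ test 13 18 ∷ [])) ∷
    (171 , (cut 3 ∷ cut 3 ∷ test 9 1 ∷ cut 19 ∷ test 19 1 ∷ test 3 1 ∷ cut 3 ∷ test 27 1 ∷ test 4 2 ∷ test 5 4 ∷
        test 27 1 ∷ test 8 4 ∷ [])) ∷
    (172 , (cut 2 ∷ cut 2 ∷ test 4 1 ∷ cut 43 ∷ test 43 1 ∷ cut 2 ∷ cut 2 ∷ test 8 1 ∷ test 3 2 ∷ test 43 7 ∷ [])) ∷
    (174 , (cut 2 ∷ cut 2 ∷ cut 2 ∷ cut 2 ∷ test 16 1 ∷ cut 3 ∷ cut 3 ∷ test 9 1 ∷ cut 29 ∷ test 29 1 ∷ cut 2 ∷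
        test 3 4 ∷ test 9 2 ∷ test 7 18 ∷ test 27 3 ∷ test 81 3 ∷ test 13 4 ∷ test 5 2 ∷ test 64 2 ∷ test 73 6 ∷
        test 29 14 ∷ test 9 4 ∷ test 5 2 ∷ test 8 1 ∷ [])) ∷
    (175 , (cut 5 ∷ test 5 1 ∷ cut 7 ∷ test 7 1 ∷ test 5 1 ∷ test 3 2 ∷ test 7 3 ∷ [])) ∷
    (176 , (cut 2 ∷ cut 2 ∷ test 4 1 ∷ cut 11 ∷ test 11 1 ∷ cut 2 ∷ cut 2 ∷ test 8 1 ∷ test 5 4 ∷ test 11 5 ∷ [])) ∷
    (177 , (cut 3 ∷ cut 3 ∷ cut 3 ∷ test 27 1 ∷ cut 59 ∷ test 59 1 ∷ cut 3 ∷ test 81 1 ∷ test 3 2 ∷ test 9 2 ∷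
        test 27 2 ∷ test 16 4 ∷ test 59 29 ∷ [])) ∷
    (178 , (cut 2 ∷ cut 2 ∷ cut 2 ∷ test 8 1 ∷ cut 89 ∷ test 89 1 ∷ cut 2 ∷ cut 2 ∷ test 8 1 ∷ test 16 1 ∷
        test 89 11 ∷ [])) ∷
    (180 , (cut 2 ∷ cut 2 ∷ test 4 1 ∷ cut 3 ∷ cut 3 ∷ test 9 1 ∷ cut 5 ∷ test 5 1 ∷ cut 2 ∷ cut 2 ∷ cut 2 ∷ cut 2 ∷
        cut 2 ∷ test 64 1 ∷ test 3 4 ∷ test 13 144 ∷ test 9 1 ∷ test 4 2 ∷ test 5 2 ∷ test 7 3 ∷ test 27 1 ∷
        test 8 1 ∷ test 37 27 ∷ test 19 1 ∷ [])) ∷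
    (182 , (cut 2 ∷ cut 2 ∷ cut 2 ∷ cut 2 ∷ cut 2 ∷ test 32 1 ∷ cut 7 ∷ test 7 1 ∷ cut 13 ∷ test 13 1 ∷ cut 2 ∷
        test 7 6 ∷ test 13 12 ∷ test 19 54 ∷ test 3 2 ∷ test 5 16 ∷ test 17 8 ∷ test 13 9 ∷ test 16 1 ∷ [])) ∷
    (183 , (cut 3 ∷ cut 3 ∷ test 9 1 ∷ cut 61 ∷ test 61 1 ∷ test 3 1 ∷ cut 3 ∷ cut 3 ∷ cut 3 ∷ test 243 1 ∷ test 4 2 ∷
        test 8 1 ∷ test 61 5 ∷ [])) ∷
    (184 , (cut 2 ∷ cut 2 ∷ test 4 1 ∷ cut 23 ∷ cut 2 ∷ cut 2 ∷ test 8 1 ∷ test 23 11 ∷ test 16 2 ∷ [])) ∷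
    (185 , (cut 5 ∷ test 5 1 ∷ cut 37 ∷ test 37 1 ∷ test 5 1 ∷ test 3 2 ∷ test 9 3 ∷ test 37 6 ∷ test 19 2 ∷ [])) ∷
    (186 , (cut 2 ∷ cut 2 ∷ cut 2 ∷ test 8 1 ∷ cut 3 ∷ cut 3 ∷ cut 3 ∷ test 27 1 ∷ cut 31 ∷ test 31 1 ∷ cut 2 ∷
        cut 2 ∷ cut 2 ∷ test 32 1 ∷ test 3 2 ∷ test 9 2 ∷ test 27 2 ∷ test 5 8 ∷ test 8 1 ∷ test 5 16 ∷ test 31 15 ∷
        test 13 12 ∷ [])) ∷
    (187 , (cut 11 ∷ test 11 1 ∷ cut 17 ∷ test 17 1 ∷ test 11 1 ∷ test 8 2 ∷ test 3 2 ∷ test 11 5 ∷ test 17 8 ∷ [])) ∷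
    (188 , (cut 2 ∷ cut 2 ∷ test 4 1 ∷ cut 47 ∷ cut 2 ∷ cut 2 ∷ test 8 1 ∷ test 47 23 ∷ test 16 2 ∷ [])) ∷
    (189 , (cut 3 ∷ cut 3 ∷ test 9 1 ∷ cut 7 ∷ test 3 1 ∷ test 7 6 ∷ test 13 12 ∷ test 8 4 ∷ [])) ∷
    (190 , (cut 2 ∷ cut 2 ∷ cut 2 ∷ cut 2 ∷ test 16 1 ∷ cut 5 ∷ test 5 1 ∷ cut 19 ∷ test 19 1 ∷ cut 2 ∷ test 5 2 ∷
        test 3 4 ∷ test 9 9 ∷ test 7 3 ∷ test 8 1 ∷ test 19 3 ∷ test 27 9 ∷ test 73 4 ∷ test 37 2 ∷ test 5 1 ∷ [])) ∷
    (192 , (cut 2 ∷ cut 2 ∷ test 4 1 ∷ cut 3 ∷ cut 3 ∷ test 9 1 ∷ cut 2 ∷ cut 2 ∷ test 8 1 ∷ cut 2 ∷ cut 2 ∷ cut 2 ∷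
        cut 2 ∷ cut 2 ∷ cut 2 ∷ cut 2 ∷ test 1024 1 ∷ test 3 2 ∷ test 9 2 ∷ test 13 18 ∷ test 27 1 ∷ test 7 2 ∷ [])) ∷
    (194 , (cut 2 ∷ cut 2 ∷ cut 2 ∷ test 8 1 ∷ cut 97 ∷ test 97 1 ∷ cut 2 ∷ cut 2 ∷ test 8 1 ∷ test 16 1 ∷ test 3 2 ∷
        test 7 6 ∷ test 8 1 ∷ test 97 8 ∷ test 8 1 ∷ [])) ∷
    (195 , (cut 3 ∷ cut 3 ∷ cut 3 ∷ cut 3 ∷ test 81 1 ∷ cut 5 ∷ test 5 1 ∷ cut 13 ∷ test 13 1 ∷ test 27 1 ∷
        test 81 1 ∷ cut 5 ∷ test 25 1 ∷ test 3 2 ∷ test 4 2 ∷ test 8 2 ∷ test 9 2 ∷ test 27 2 ∷ test 81 2 ∷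
        test 13 2 ∷ test 5 4 ∷ test 7 9 ∷ test 17 16 ∷ test 97 48 ∷ test 8 2 ∷ test 13 3 ∷ [])) ∷
    (196 , (cut 2 ∷ cut 2 ∷ test 4 1 ∷ cut 7 ∷ cut 2 ∷ cut 2 ∷ test 8 1 ∷ test 7 3 ∷ [])) ∷
    (198 , (cut 2 ∷ cut 2 ∷ cut 2 ∷ cut 2 ∷ cut 2 ∷ cut 2 ∷ cut 2 ∷ test 128 1 ∷ cut 3 ∷ cut 3 ∷ test 9 1 ∷ cut 11 ∷
        cut 2 ∷ test 9 1 ∷ test 11 5 ∷ test 3 4 ∷ test 5 16 ∷ test 9 2 ∷ test 27 3 ∷ test 7 9 ∷ test 11 25 ∷
        test 16 1 ∷ test 61 30 ∷ test 64 1 ∷ test 32 2 ∷ [])) ∷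
    (200 , (cut 2 ∷ cut 2 ∷ test 4 1 ∷ cut 5 ∷ cut 2 ∷ cut 2 ∷ test 8 1 ∷ test 5 4 ∷ test 8 2 ∷ [])) ∷
    (210 , (cut 2 ∷ cut 2 ∷ cut 2 ∷ test 8 1 ∷ cut 3 ∷ cut 3 ∷ test 9 1 ∷ cut 5 ∷ test 5 1 ∷ cut 7 ∷ test 7 1 ∷
        cut 2 ∷ test 9 1 ∷ test 5 4 ∷ test 3 4 ∷ test 9 2 ∷ test 7 18 ∷ test 27 9 ∷ test 19 18 ∷ test 5 8 ∷
        test 13 8 ∷ test 32 1 ∷ test 9 2 ∷ test 5 16 ∷ test 25 5 ∷ test 27 1 ∷ test 16 1 ∷ test 125 25 ∷ test 11 25 ∷
        test 61 6 ∷ test 31 3 ∷ test 7 36 ∷ test 13 18 ∷ test 25 5 ∷ test 8 1 ∷ test 27 1 ∷ test 32 2 ∷ test 9 4 ∷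
        test 27 27 ∷ test 19 27 ∷ test 81 3 ∷ test 37 4 ∷ test 13 4 ∷ test 73 4 ∷ test 7 108 ∷ test 25 1 ∷ test 27 3 ∷
        test 13 8 ∷ test 16 1 ∷ test 5 64 ∷ test 49 7 ∷ test 25 25 ∷ test 27 1 ∷ test 32 2 ∷ test 11 5 ∷ test 61 3 ∷
        [])) ∷
    (216 , (cut 2 ∷ cut 2 ∷ test 4 1 ∷ cut 3 ∷ cut 3 ∷ test 9 1 ∷ cut 2 ∷ cut 2 ∷ test 8 1 ∷ cut 3 ∷ cut 3 ∷
        test 81 1 ∷ test 3 2 ∷ test 7 18 ∷ test 27 2 ∷ [])) ∷
    (220 , (cut 2 ∷ cut 2 ∷ test 4 1 ∷ cut 5 ∷ test 5 1 ∷ cut 11 ∷ test 11 1 ∷ cut 2 ∷ cut 2 ∷ test 8 1 ∷ test 5 4 ∷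
        test 8 2 ∷ test 11 5 ∷ [])) ∷
    (224 , (cut 2 ∷ cut 2 ∷ test 4 1 ∷ cut 7 ∷ cut 2 ∷ cut 2 ∷ test 8 1 ∷ test 7 3 ∷ [])) ∷
    (225 , (cut 3 ∷ cut 3 ∷ test 9 1 ∷ cut 5 ∷ test 5 1 ∷ test 3 2 ∷ test 4 2 ∷ test 5 2 ∷ test 9 2 ∷ test 8 2 ∷
        [])) ∷
    (231 , (cut 3 ∷ cut 3 ∷ cut 3 ∷ test 27 1 ∷ cut 7 ∷ test 7 1 ∷ cut 11 ∷ test 11 1 ∷ test 27 1 ∷ test 7 1 ∷
        test 3 2 ∷ test 9 2 ∷ test 4 2 ∷ test 7 3 ∷ test 8 2 ∷ test 5 4 ∷ test 11 5 ∷ test 5 8 ∷ test 8 2 ∷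
        test 81 3 ∷ test 61 10 ∷ test 13 3 ∷ [])) ∷
    (240 , (cut 2 ∷ cut 2 ∷ test 4 1 ∷ cut 3 ∷ cut 3 ∷ cut 3 ∷ test 27 1 ∷ cut 5 ∷ test 5 1 ∷ cut 2 ∷ cut 2 ∷
        test 8 1 ∷ cut 5 ∷ test 25 1 ∷ test 3 4 ∷ test 9 4 ∷ test 27 2 ∷ test 5 16 ∷ test 81 3 ∷ test 7 9 ∷
        test 27 4 ∷ test 81 9 ∷ test 7 3 ∷ test 13 36 ∷ test 25 5 ∷ test 4 2 ∷ test 16 2 ∷ test 7 3 ∷ [])) ∷
    (242 , (cut 2 ∷ cut 2 ∷ cut 2 ∷ test 8 1 ∷ cut 11 ∷ test 11 1 ∷ cut 2 ∷ cut 2 ∷ test 8 1 ∷ test 16 1 ∷ test 5 4 ∷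
        test 11 5 ∷ test 61 12 ∷ [])) ∷
    (245 , (cut 5 ∷ test 5 1 ∷ cut 7 ∷ test 7 1 ∷ test 5 1 ∷ test 3 2 ∷ test 7 3 ∷ test 9 3 ∷ test 19 3 ∷ [])) ∷
    (250 , (cut 2 ∷ cut 2 ∷ cut 2 ∷ test 8 1 ∷ cut 5 ∷ cut 2 ∷ cut 2 ∷ cut 2 ∷ test 32 1 ∷ test 5 4 ∷ test 8 2 ∷
        test 3 2 ∷ test 13 6 ∷ [])) ∷
    (252 , (cut 2 ∷ cut 2 ∷ test 4 1 ∷ cut 3 ∷ cut 3 ∷ test 9 1 ∷ cut 7 ∷ test 7 1 ∷ cut 2 ∷ cut 2 ∷ cut 2 ∷ cut 2 ∷
        cut 2 ∷ test 64 1 ∷ test 3 2 ∷ test 5 64 ∷ test 27 3 ∷ test 13 9 ∷ test 9 1 ∷ test 7 3 ∷ test 8 1 ∷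
        test 73 54 ∷ [])) ∷
    (264 , (cut 2 ∷ cut 2 ∷ test 4 1 ∷ cut 3 ∷ cut 3 ∷ test 9 1 ∷ cut 11 ∷ test 11 1 ∷ cut 2 ∷ cut 2 ∷ cut 2 ∷ cut 2 ∷
        cut 2 ∷ cut 2 ∷ test 128 1 ∷ test 9 1 ∷ cut 11 ∷ test 121 1 ∷ test 3 4 ∷ test 9 2 ∷ test 11 50 ∷ test 9 4 ∷
        test 121 1 ∷ test 4 2 ∷ test 5 4 ∷ test 61 30 ∷ test 8 1 ∷ [])) ∷
    (270 , (cut 2 ∷ cut 2 ∷ cut 2 ∷ cut 2 ∷ test 16 1 ∷ cut 3 ∷ cut 3 ∷ test 9 1 ∷ cut 5 ∷ cut 2 ∷ test 9 1 ∷
        test 5 4 ∷ test 3 4 ∷ test 13 144 ∷ test 9 1 ∷ test 7 2 ∷ test 5 4 ∷ test 7 3 ∷ test 8 1 ∷ test 16 2 ∷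
        test 32 1 ∷ test 27 1 ∷ [])) ∷
    (275 , (cut 5 ∷ test 5 1 ∷ cut 11 ∷ test 11 1 ∷ [])) ∷
    (280 , (cut 2 ∷ cut 2 ∷ test 4 1 ∷ cut 5 ∷ test 5 1 ∷ cut 7 ∷ test 7 1 ∷ cut 2 ∷ cut 2 ∷ test 8 1 ∷ test 5 4 ∷
        test 3 4 ∷ test 25 1 ∷ test 7 9 ∷ test 25 1 ∷ test 9 9 ∷ test 19 9 ∷ test 8 1 ∷ [])) ∷
    (288 , (cut 2 ∷ cut 2 ∷ test 4 1 ∷ cut 3 ∷ cut 3 ∷ test 9 1 ∷ cut 2 ∷ cut 2 ∷ cut 2 ∷ cut 2 ∷ cut 2 ∷ cut 2 ∷
        cut 2 ∷ cut 2 ∷ test 512 1 ∷ cut 3 ∷ test 27 1 ∷ test 3 2 ∷ test 5 16 ∷ test 9 1 ∷ test 41 10 ∷ [])) ∷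
    (294 , (cut 2 ∷ cut 2 ∷ cut 2 ∷ cut 2 ∷ cut 2 ∷ cut 2 ∷ test 64 1 ∷ cut 3 ∷ cut 3 ∷ cut 3 ∷ test 27 1 ∷ cut 7 ∷
        test 7 1 ∷ cut 2 ∷ cut 2 ∷ test 8 1 ∷ cut 3 ∷ cut 3 ∷ test 243 1 ∷ test 3 2 ∷ test 9 2 ∷ test 27 2 ∷
        test 7 6 ∷ test 81 9 ∷ test 19 9 ∷ test 37 6 ∷ test 7 18 ∷ test 19 54 ∷ test 81 1 ∷ test 37 6 ∷ test 5 16 ∷
        test 13 9 ∷ [])) ∷
    (297 , (cut 3 ∷ cut 3 ∷ test 9 1 ∷ cut 11 ∷ test 11 1 ∷ test 9 1 ∷ test 3 2 ∷ test 4 2 ∷ test 5 2 ∷ test 8 2 ∷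
        test 27 3 ∷ test 37 9 ∷ test 5 4 ∷ [])) ∷
    (300 , (cut 2 ∷ cut 2 ∷ test 4 1 ∷ cut 3 ∷ cut 3 ∷ test 9 1 ∷ cut 5 ∷ cut 2 ∷ test 9 1 ∷ test 5 4 ∷ test 3 4 ∷
        test 9 2 ∷ test 13 72 ∷ test 16 1 ∷ test 9 4 ∷ test 27 9 ∷ test 7 3 ∷ test 13 4 ∷ [])) ∷
    (308 , (cut 2 ∷ cut 2 ∷ test 4 1 ∷ cut 7 ∷ test 7 1 ∷ cut 11 ∷ test 11 1 ∷ cut 2 ∷ cut 2 ∷ test 8 1 ∷ test 7 9 ∷
        test 9 4 ∷ test 11 5 ∷ [])) ∷
    (315 , (cut 3 ∷ cut 3 ∷ test 9 1 ∷ cut 5 ∷ test 5 1 ∷ cut 7 ∷ test 7 1 ∷ test 5 1 ∷ test 3 2 ∷ test 9 2 ∷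
        test 4 2 ∷ test 8 2 ∷ test 5 2 ∷ test 7 3 ∷ test 8 4 ∷ test 13 6 ∷ [])) ∷
    (320 , (cut 2 ∷ cut 2 ∷ test 4 1 ∷ cut 5 ∷ cut 2 ∷ cut 2 ∷ test 8 1 ∷ test 5 4 ∷ test 8 2 ∷ [])) ∷
    (324 , (cut 2 ∷ cut 2 ∷ test 4 1 ∷ cut 3 ∷ cut 3 ∷ test 9 1 ∷ cut 2 ∷ cut 2 ∷ test 8 1 ∷ cut 3 ∷ cut 3 ∷ cut 3 ∷
        test 243 1 ∷ test 3 2 ∷ test 7 18 ∷ [])) ∷
    (330 , (cut 2 ∷ cut 2 ∷ cut 2 ∷ test 8 1 ∷ cut 3 ∷ cut 3 ∷ cut 3 ∷ cut 3 ∷ cut 3 ∷ test 243 1 ∷ cut 5 ∷ test 5 1 ∷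
        cut 11 ∷ test 11 1 ∷ cut 2 ∷ cut 2 ∷ cut 2 ∷ cut 2 ∷ test 64 1 ∷ test 243 1 ∷ test 3 8 ∷ test 9 4 ∷
        test 27 8 ∷ test 81 4 ∷ test 11 5 ∷ test 5 16 ∷ test 7 162 ∷ test 8 1 ∷ test 13 32 ∷ test 37 27 ∷ test 19 1 ∷
        test 4 2 ∷ test 8 2 ∷ test 11 25 ∷ test 61 180 ∷ test 7 9 ∷ test 31 5 ∷ test 13 2 ∷ [])) ∷
    (336 , (cut 2 ∷ cut 2 ∷ test 4 1 ∷ cut 3 ∷ cut 3 ∷ test 9 1 ∷ cut 7 ∷ test 7 1 ∷ cut 2 ∷ cut 2 ∷ test 8 1 ∷
        test 3 2 ∷ test 9 2 ∷ test 7 6 ∷ test 27 9 ∷ test 19 9 ∷ test 81 3 ∷ test 37 2 ∷ test 4 4 ∷ test 8 1 ∷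
        test 5 8 ∷ test 32 2 ∷ test 64 4 ∷ test 128 4 ∷ test 17 2 ∷ test 193 12 ∷ test 27 3 ∷ test 32 2 ∷ [])) ∷
    (350 , (cut 2 ∷ cut 2 ∷ cut 2 ∷ cut 2 ∷ test 16 1 ∷ cut 5 ∷ test 5 1 ∷ cut 7 ∷ test 7 1 ∷ cut 2 ∷ cut 2 ∷
        test 8 1 ∷ test 5 4 ∷ test 3 4 ∷ test 7 9 ∷ test 9 3 ∷ test 13 4 ∷ test 9 9 ∷ test 19 9 ∷ test 27 3 ∷
        test 8 1 ∷ [])) ∷
    (352 , (cut 2 ∷ cut 2 ∷ test 4 1 ∷ cut 11 ∷ test 11 1 ∷ cut 2 ∷ cut 2 ∷ test 8 1 ∷ test 5 4 ∷ test 11 5 ∷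
        test 61 12 ∷ [])) ∷
    (360 , (cut 2 ∷ cut 2 ∷ test 4 1 ∷ cut 3 ∷ cut 3 ∷ test 9 1 ∷ cut 5 ∷ cut 2 ∷ cut 2 ∷ test 8 1 ∷ test 5 4 ∷
        test 3 4 ∷ test 13 144 ∷ test 9 1 ∷ test 4 2 ∷ test 8 1 ∷ test 27 1 ∷ test 7 3 ∷ [])) ∷
    (363 , (cut 3 ∷ cut 3 ∷ test 9 1 ∷ cut 11 ∷ test 11 1 ∷ test 9 1 ∷ cut 3 ∷ test 27 1 ∷ test 3 2 ∷ test 4 2 ∷
        test 8 2 ∷ test 5 2 ∷ test 11 5 ∷ test 61 2 ∷ test 25 5 ∷ test 41 4 ∷ test 181 81 ∷ [])) ∷
    (375 , (cut 3 ∷ cut 3 ∷ cut 3 ∷ test 27 1 ∷ cut 5 ∷ test 5 1 ∷ cut 3 ∷ cut 3 ∷ test 243 1 ∷ cut 5 ∷ cut 5 ∷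
        cut 5 ∷ test 625 1 ∷ test 3 2 ∷ test 9 2 ∷ test 11 25 ∷ test 71 7 ∷ [])) ∷
    (378 , (cut 2 ∷ cut 2 ∷ cut 2 ∷ test 8 1 ∷ cut 3 ∷ cut 3 ∷ test 9 1 ∷ cut 7 ∷ test 7 1 ∷ cut 2 ∷ cut 2 ∷ cut 2 ∷
        test 32 1 ∷ test 3 2 ∷ test 5 64 ∷ test 27 3 ∷ test 13 9 ∷ test 9 1 ∷ test 7 3 ∷ test 16 1 ∷ test 13 9 ∷
        test 27 1 ∷ [])) ∷
    (384 , (cut 2 ∷ cut 2 ∷ test 4 1 ∷ cut 3 ∷ cut 3 ∷ cut 3 ∷ cut 3 ∷ test 81 1 ∷ cut 2 ∷ cut 2 ∷ test 8 1 ∷ cut 2 ∷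
        cut 2 ∷ cut 2 ∷ cut 2 ∷ cut 2 ∷ cut 2 ∷ cut 2 ∷ cut 2 ∷ test 2048 1 ∷ test 3 2 ∷ test 9 2 ∷ test 27 2 ∷
        test 81 2 ∷ test 5 8 ∷ test 17 8 ∷ [])) ∷
    (385 , (cut 5 ∷ test 5 1 ∷ cut 7 ∷ test 7 1 ∷ cut 11 ∷ test 11 1 ∷ test 7 1 ∷ test 5 4 ∷ test 11 5 ∷ test 25 5 ∷
        test 7 6 ∷ test 3 2 ∷ test 181 27 ∷ [])) ∷
    (392 , (cut 2 ∷ cut 2 ∷ test 4 1 ∷ cut 7 ∷ cut 2 ∷ cut 2 ∷ test 8 1 ∷ test 7 3 ∷ [])) ∷
    (396 , (cut 2 ∷ cut 2 ∷ test 4 1 ∷ cut 3 ∷ cut 3 ∷ test 9 1 ∷ cut 11 ∷ test 11 1 ∷ cut 2 ∷ cut 2 ∷ test 8 1 ∷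
        test 3 4 ∷ test 5 16 ∷ test 7 27 ∷ test 8 1 ∷ test 11 5 ∷ [])) ∷
    (400 , (cut 2 ∷ cut 2 ∷ test 4 1 ∷ cut 5 ∷ cut 2 ∷ cut 2 ∷ test 8 1 ∷ test 5 4 ∷ test 8 2 ∷ [])) ∷
    (405 , (cut 3 ∷ cut 3 ∷ test 9 1 ∷ cut 5 ∷ test 5 1 ∷ test 3 2 ∷ test 8 2 ∷ test 5 2 ∷ test 8 4 ∷ [])) ∷
    (420 , (cut 2 ∷ cut 2 ∷ test 4 1 ∷ cut 3 ∷ cut 3 ∷ cut 3 ∷ test 27 1 ∷ cut 5 ∷ test 5 1 ∷ cut 7 ∷ test 7 1 ∷
        cut 2 ∷ cut 2 ∷ test 8 1 ∷ test 3 4 ∷ test 9 4 ∷ test 5 4 ∷ test 7 108 ∷ test 25 1 ∷ test 27 2 ∷ test 5 8 ∷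
        test 25 5 ∷ test 8 1 ∷ test 41 400 ∷ test 16 4 ∷ test 13 6 ∷ test 81 3 ∷ test 43 686 ∷ test 5 16 ∷ test 25 5 ∷
        test 81 1 ∷ test 13 576 ∷ [])) ∷
    (432 , (cut 2 ∷ cut 2 ∷ test 4 1 ∷ cut 3 ∷ cut 3 ∷ test 9 1 ∷ cut 2 ∷ cut 2 ∷ cut 2 ∷ cut 2 ∷ cut 2 ∷ cut 2 ∷
        cut 2 ∷ test 256 1 ∷ cut 3 ∷ cut 3 ∷ test 81 1 ∷ test 3 2 ∷ test 5 16 ∷ test 9 1 ∷ test 17 8 ∷ [])) ∷
    (440 , (cut 2 ∷ cut 2 ∷ test 4 1 ∷ cut 5 ∷ test 5 1 ∷ cut 11 ∷ test 11 1 ∷ cut 2 ∷ cut 2 ∷ test 8 1 ∷ test 5 4 ∷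
        test 8 2 ∷ test 11 5 ∷ [])) ∷
    (441 , (cut 3 ∷ cut 3 ∷ test 9 1 ∷ cut 7 ∷ test 7 1 ∷ test 3 1 ∷ test 4 2 ∷ test 8 2 ∷ test 7 3 ∷ test 5 4 ∷
        test 8 4 ∷ [])) ∷
    (448 , (cut 2 ∷ cut 2 ∷ test 4 1 ∷ cut 7 ∷ cut 2 ∷ cut 2 ∷ test 8 1 ∷ test 7 3 ∷ [])) ∷
    (450 , (cut 2 ∷ cut 2 ∷ cut 2 ∷ test 8 1 ∷ cut 3 ∷ cut 3 ∷ test 9 1 ∷ cut 5 ∷ test 5 1 ∷ cut 2 ∷ cut 2 ∷
        test 8 1 ∷ test 16 1 ∷ test 9 1 ∷ cut 5 ∷ cut 5 ∷ test 125 1 ∷ test 3 4 ∷ test 7 108 ∷ test 9 1 ∷ test 5 2 ∷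
        test 13 8 ∷ test 27 1 ∷ test 73 18 ∷ [])) ∷
    (462 , (cut 2 ∷ cut 2 ∷ cut 2 ∷ cut 2 ∷ test 16 1 ∷ cut 3 ∷ cut 3 ∷ test 9 1 ∷ cut 7 ∷ test 7 1 ∷ cut 11 ∷
        test 11 1 ∷ cut 2 ∷ test 9 1 ∷ test 7 1 ∷ test 3 4 ∷ test 5 64 ∷ test 9 2 ∷ test 7 3 ∷ test 13 54 ∷
        test 27 1 ∷ test 7 9 ∷ test 13 18 ∷ test 16 1 ∷ test 19 9 ∷ test 27 1 ∷ test 11 5 ∷ test 8 2 ∷ test 121 1 ∷
        test 11 25 ∷ test 64 1 ∷ test 7 27 ∷ test 8 1 ∷ test 37 3 ∷ [])) ∷
    (480 , (cut 2 ∷ cut 2 ∷ test 4 1 ∷ cut 3 ∷ cut 3 ∷ test 9 1 ∷ cut 5 ∷ test 5 1 ∷ cut 2 ∷ cut 2 ∷ cut 2 ∷ cut 2 ∷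
        cut 2 ∷ cut 2 ∷ cut 2 ∷ cut 2 ∷ test 512 1 ∷ test 9 1 ∷ cut 5 ∷ test 25 1 ∷ test 3 4 ∷ test 9 2 ∷ test 5 16 ∷
        test 13 18 ∷ test 7 3 ∷ test 81 3 ∷ test 73 6 ∷ test 9 4 ∷ test 27 9 ∷ test 7 3 ∷ test 8 1 ∷ [])) ∷
    (484 , (cut 2 ∷ cut 2 ∷ test 4 1 ∷ cut 11 ∷ cut 2 ∷ cut 2 ∷ test 8 1 ∷ test 11 10 ∷ test 5 2 ∷ [])) ∷
    (486 , (cut 2 ∷ cut 2 ∷ cut 2 ∷ cut 2 ∷ cut 2 ∷ cut 2 ∷ test 64 1 ∷ cut 3 ∷ cut 3 ∷ test 9 1 ∷ cut 2 ∷ cut 2 ∷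
        test 8 1 ∷ cut 3 ∷ cut 3 ∷ cut 3 ∷ cut 3 ∷ test 729 1 ∷ test 3 2 ∷ test 5 16 ∷ test 27 1 ∷ test 9 1 ∷
        test 17 8 ∷ [])) ∷
    (490 , (cut 2 ∷ cut 2 ∷ cut 2 ∷ test 8 1 ∷ cut 5 ∷ test 5 1 ∷ cut 7 ∷ test 7 1 ∷ cut 2 ∷ cut 2 ∷ test 8 1 ∷
        cut 2 ∷ cut 2 ∷ cut 2 ∷ test 128 1 ∷ test 5 4 ∷ test 3 4 ∷ test 25 1 ∷ test 7 9 ∷ test 25 1 ∷ test 16 1 ∷
        test 9 9 ∷ test 19 9 ∷ test 27 3 ∷ test 37 4 ∷ test 32 1 ∷ [])) ∷
    (495 , (cut 3 ∷ cut 3 ∷ test 9 1 ∷ cut 5 ∷ test 5 1 ∷ cut 11 ∷ test 11 1 ∷ test 3 2 ∷ test 11 5 ∷ test 5 4 ∷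
        test 8 4 ∷ test 9 1 ∷ [])) ∷
    (500 , (cut 2 ∷ cut 2 ∷ test 4 1 ∷ cut 5 ∷ cut 2 ∷ cut 2 ∷ test 8 1 ∷ test 5 4 ∷ test 8 2 ∷ [])) ∷
    (504 , (cut 2 ∷ cut 2 ∷ test 4 1 ∷ cut 3 ∷ cut 3 ∷ test 9 1 ∷ cut 7 ∷ test 7 1 ∷ cut 2 ∷ cut 2 ∷ cut 2 ∷ cut 2 ∷
        cut 2 ∷ cut 2 ∷ test 128 1 ∷ test 3 2 ∷ test 13 432 ∷ test 7 2 ∷ test 9 1 ∷ test 27 1 ∷ test 16 4 ∷
        test 73 12 ∷ [])) ∷
    (525 , (cut 3 ∷ cut 3 ∷ test 9 1 ∷ cut 5 ∷ test 5 1 ∷ cut 7 ∷ test 7 1 ∷ test 9 1 ∷ test 5 1 ∷ test 3 2 ∷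
        test 4 2 ∷ test 5 4 ∷ test 8 2 ∷ test 7 9 ∷ test 13 6 ∷ test 4 4 ∷ test 8 1 ∷ test 5 4 ∷ test 9 1 ∷ [])) ∷
    (528 , (cut 2 ∷ cut 2 ∷ test 4 1 ∷ cut 3 ∷ cut 3 ∷ cut 3 ∷ test 27 1 ∷ cut 11 ∷ test 11 1 ∷ cut 2 ∷ cut 2 ∷
        test 8 1 ∷ cut 3 ∷ test 81 1 ∷ cut 11 ∷ test 121 1 ∷ test 11 5 ∷ test 3 4 ∷ test 9 4 ∷ test 27 2 ∷ test 5 16 ∷
        test 27 2 ∷ test 121 1 ∷ test 81 3 ∷ test 7 9 ∷ test 13 2 ∷ test 4 2 ∷ test 11 5 ∷ test 61 30 ∷ test 81 1 ∷
        test 8 1 ∷ [])) ∷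
    (539 , (cut 7 ∷ test 7 1 ∷ cut 11 ∷ test 11 1 ∷ test 7 3 ∷ [])) ∷
    (540 , (cut 2 ∷ cut 2 ∷ test 4 1 ∷ cut 3 ∷ cut 3 ∷ test 9 1 ∷ cut 5 ∷ test 5 1 ∷ cut 2 ∷ cut 2 ∷ test 8 1 ∷
        cut 3 ∷ cut 3 ∷ test 81 1 ∷ cut 5 ∷ test 25 1 ∷ test 3 4 ∷ test 7 108 ∷ test 9 1 ∷ test 5 2 ∷ test 8 1 ∷
        [])) ∷
    (550 , (cut 2 ∷ cut 2 ∷ cut 2 ∷ cut 2 ∷ cut 2 ∷ cut 2 ∷ test 64 1 ∷ cut 5 ∷ test 5 1 ∷ cut 11 ∷ test 11 1 ∷
        cut 2 ∷ cut 2 ∷ test 128 1 ∷ cut 5 ∷ test 25 1 ∷ test 5 4 ∷ test 8 2 ∷ test 11 5 ∷ test 3 4 ∷ test 61 90 ∷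
        test 3 8 ∷ test 9 27 ∷ test 7 1 ∷ test 32 1 ∷ test 19 9 ∷ [])) ∷
    (560 , (cut 2 ∷ cut 2 ∷ test 4 1 ∷ cut 5 ∷ test 5 1 ∷ cut 7 ∷ test 7 1 ∷ cut 2 ∷ cut 2 ∷ test 8 1 ∷ test 5 4 ∷
        test 3 4 ∷ test 7 9 ∷ test 9 3 ∷ test 13 4 ∷ test 9 9 ∷ test 19 9 ∷ test 8 1 ∷ test 27 3 ∷ [])) ∷
    (567 , (cut 3 ∷ cut 3 ∷ test 9 1 ∷ cut 7 ∷ test 3 1 ∷ test 7 6 ∷ test 13 12 ∷ test 8 4 ∷ [])) ∷
    (576 , (cut 2 ∷ cut 2 ∷ test 4 1 ∷ cut 3 ∷ cut 3 ∷ test 9 1 ∷ cut 2 ∷ cut 2 ∷ test 8 1 ∷ cut 3 ∷ test 27 1 ∷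
        test 3 2 ∷ test 7 18 ∷ [])) ∷
    (588 , (cut 2 ∷ cut 2 ∷ test 4 1 ∷ cut 3 ∷ cut 3 ∷ test 9 1 ∷ cut 7 ∷ test 7 1 ∷ cut 2 ∷ cut 2 ∷ test 8 1 ∷
        cut 7 ∷ cut 7 ∷ test 343 1 ∷ test 3 2 ∷ test 9 2 ∷ test 7 6 ∷ test 27 9 ∷ test 19 9 ∷ test 81 3 ∷ test 37 2 ∷
        test 4 4 ∷ test 8 1 ∷ test 5 8 ∷ test 16 1 ∷ test 27 1 ∷ test 17 8 ∷ test 8 1 ∷ [])) ∷
    (594 , (cut 2 ∷ cut 2 ∷ cut 2 ∷ test 8 1 ∷ cut 3 ∷ cut 3 ∷ test 9 1 ∷ cut 11 ∷ test 11 1 ∷ cut 2 ∷ test 9 1 ∷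
        test 3 4 ∷ test 7 54 ∷ test 19 18 ∷ test 16 1 ∷ test 8 1 ∷ test 9 1 ∷ test 37 4 ∷ test 11 5 ∷ [])) ∷
    (600 , (cut 2 ∷ cut 2 ∷ test 4 1 ∷ cut 3 ∷ cut 3 ∷ cut 3 ∷ cut 3 ∷ test 81 1 ∷ cut 5 ∷ test 5 1 ∷ cut 2 ∷ cut 2 ∷
        test 8 1 ∷ cut 3 ∷ test 243 1 ∷ cut 5 ∷ cut 5 ∷ test 125 1 ∷ test 3 4 ∷ test 9 4 ∷ test 27 4 ∷ test 81 2 ∷
        test 5 16 ∷ test 13 18 ∷ test 7 3 ∷ test 32 2 ∷ test 81 4 ∷ test 13 36 ∷ test 125 1 ∷ test 4 2 ∷ test 7 3 ∷
        test 73 36 ∷ test 37 3 ∷ [])) ∷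
    []

  certificates-valid : all valid certificates ≡ true
  certificates-valid = refl

  -- A decidable weakening of `Condition`. The bound 600 is missing from the second alternative
  -- because the range `upTo 601` in `all-classified` supplies it.
  eligible : ℕ → Bool
  eligible q = ((q ≤ᵇ 200) ∧ not (q ≡ᵇ 94) ∧ not (q ≡ᵇ 166)) ∨ ((2310 ^ 9) mod q ≡ᵇ 0)

  -- Exponents from 1 to 9 suffice because `2 ^ 10` exceeds 600, and primes below 200 because every
  -- eligible number above 200 divides a power of 2310.
  certified primePower classified : ℕ → Bool
  certified q  = any (λ c → q ≡ᵇ proj₁ c) certificates
  primePower q = any (λ c → q ≡ᵇ proj₁ c ^ proj₂ c) (cartesianProduct primes (applyUpTo suc 9))
  classified q = not (eligible q) ∨ ((q ≤ᵇ 6) ∨ (certified q ∨ primePower q))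

  all-classified : all classified (upTo 601) ≡ true
  all-classified = refl

  Condition : ℕ → Set
  Condition q = (q ≤ 200 × q ≢ 94 × q ≢ 166) ⊎ (q ≤ 600 × SmallPrimeDivisors q)

  condition⇒≤600 : ∀ {q} → Condition q → q ≤ 600
  condition⇒≤600 (inj₁ (q≤200 , _)) = ≤-trans q≤200 (m≤m+n 200 400)
  condition⇒≤600 (inj₂ (q≤600 , _)) = q≤600

  ≢⇒T-not : ∀ {m n} → m ≢ n → T (not (m ≡ᵇ n))
  ≢⇒T-not {m} {n} m≢n with m ≡ᵇ n in eq
  ... | true  = m≢n (≡ᵇ⇒≡ m n (subst T (sym eq) _))
  ... | false = _

  condition⇒eligible : ∀ {q} → 1 ≤ q → Condition q → T (eligible q)
  condition⇒eligible {q} _ (inj₁ (q≤200 , q≢94 , q≢166)) =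
    Equivalence.from T-∨ (inj₁ (Equivalence.from T-∧ (≤⇒≤ᵇ q≤200 , Equivalence.from T-∧ (≢⇒T-not q≢94 , ≢⇒T-not q≢166))))
  condition⇒eligible {suc q} 1≤q (inj₂ (q≤600 , smooth)) =
    Equivalence.from (T-∨ {(suc q ≤ᵇ 200) ∧ not (suc q ≡ᵇ 94) ∧ not (suc q ≡ᵇ 166)})
      (inj₂ (≡⇒≡ᵇ _ _ (n∣m⇒m%n≡0 (2310 ^ 9) (suc q) (smooth⇒∣2310⁹ 1≤q q≤600 smooth))))

  primePower-sound : ∀ {q} → T (primePower q) → IsPrimePower q
  primePower-sound {q} pp with find (any⁻ (λ c → q ≡ᵇ proj₁ c ^ proj₂ c) (cartesianProduct primes (applyUpTo suc 9)) pp)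
  ... | (p , k) , c∈ , eq with ∈-cartesianProduct⁻ primes (applyUpTo suc 9) c∈
  ... | p∈ , k∈ with ∈-applyUpTo⁻ suc k∈
  ... | _ , _ , refl = p , k , All.lookup primes-prime p∈ , s≤s z≤n , ≡ᵇ⇒≡ q (p ^ k) eq

  all-true : ∀ {A : Set} (f : A → Bool) xs → all f xs ≡ true → ∀ {x} → x ∈ xs → T (f x)
  all-true f xs eq = lookup-all f (Equivalence.from T-≡ eq)

  -- The list is a variable, so the argument proceeds without evaluating the concrete certificates
  -- again.
  certified⇒no-solution : ∀ {q} cs → all valid cs ≡ true → T (any (λ c → q ≡ᵇ proj₁ c) cs) → 2 ≤ q → ∀ {x y M k K} →
    M ∣ q ^ K → x * y * M ≡ 2 * q ^ k → ¬ Solution q x y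
  certified⇒no-solution {q} cs ok cq with find (any⁻ (λ c → q ≡ᵇ proj₁ c) cs cq)
  ... | (q′ , ss) , c∈ , eq = valid⇒no-solution {q} ss (subst (λ r → T (valid (r , ss))) (sym (≡ᵇ⇒≡ q q′ eq)) (all-true valid cs ok c∈))

  no-solution : ∀ {q x y M k K} → 6 ≤ q → ¬ IsPrimePower q → Condition q →
    M ∣ q ^ K → x * y * M ≡ 2 * q ^ k → ¬ Solution q x y
  no-solution {q} {x} {y} {M} {k} {K} 6≤q ¬pp cond M∣ xyM sol =
    go (Equivalence.to (T-∨ {not (eligible q)}) (all-true classified (upTo 601) all-classified (∈-upTo⁺ (s≤s (condition⇒≤600 cond)))))
    where
    2≤q : 2 ≤ q
    2≤q = ≤-trans (m≤m+n 2 4) 6≤q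
    contra : ∀ {b} → T b → ¬ T (not b)
    contra {true} _ ()
    go : T (not (eligible q)) ⊎ T ((q ≤ᵇ 6) ∨ (certified q ∨ primePower q)) → ⊥
    go (inj₁ ineligible) = contra (condition⇒eligible (≤-trans (s≤s z≤n) 6≤q) cond) ineligible
    go (inj₂ rest) with Equivalence.to (T-∨ {q ≤ᵇ 6}) rest
    ... | inj₁ q≤6 = no-solution-6 {x} {y} {M} {k} (subst (λ r → x * y * M ≡ 2 * r ^ k) q≡6 xyM) (subst (λ r → Solution r x y) q≡6 sol)
      where
      q≡6 : q ≡ 6
      q≡6 = ≤-antisym (≤ᵇ⇒≤ q 6 q≤6) 6≤q
    ... | inj₂ rest′ with Equivalence.to (T-∨ {certified q}) rest′
    ... | inj₁ cq = certified⇒no-solution certificates certificates-valid cq 2≤q {x} {y} {M} {k} {K} M∣ xyM sol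
    ... | inj₂ pp = ¬pp (primePower-sound pp)

-- Lloyd's theorem and the equations that follow from it

module Lloyd where

  open import Data.Nat as ℕ using (zero; suc; z≤n; s≤s; _∸_)
  import Data.Nat.Properties as ℕₚ
  import Data.Nat.Combinatorics as Comb
  import Data.Nat.Tactic.RingSolver as ℕ-Solver
  open import Data.Nat.Divisibility using (divides; ∣m+n∣m⇒∣n)
  open import Data.Integer using (ℤ; +_; _+_; _*_; _-_; -_; 0ℤ; 1ℤ; +≤+) renaming (_≤_ to _≤ᶻ_)
  import Data.Integer.Properties as ℤₚ
  open import Data.Integer.Tactic.RingSolver using (solve-∀)
  open import Data.Fin using (zero; suc)
  open import Data.Fin.Properties using (_≟_)
  open import Data.Vec using ([]; _∷_)
  open import Data.List using ([]; _∷_)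
  open import Data.List.Relation.Unary.All as All using (All; []; _∷_)
  open import Data.List.Relation.Unary.AllPairs using ([]; _∷_)
  open import Data.Product using (_,_; proj₁; proj₂; ∃)
  open import Data.Sum using (inj₁; inj₂)
  open import Data.Empty using (⊥-elim)
  open import Function using (_∘_)
  open import Relation.Nullary using (Dec; yes; no)
  open import Relation.Binary.PropositionalEquality hiding (_≡_; _≢_)
  open import Algebra.Properties.Semiring.Sum ℤₚ.+-*-semiring using (sum; sum-cong-≗; ∑-distrib-+; *-distribˡ-sum)
  import Algebra.Properties.AbelianGroup ℤₚ.+-0-abelianGroup as ℤ-Group

  open Sieve using (Solution)

  +-congˡ : ∀ a {b c : ℤ} → b ≡ c → a + b ≡ a + c
  +-congˡ a = cong (λ z → a + z)

  sum-const : ∀ k c → sum {k} (λ _ → c) ≡ + k * c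
  sum-const zero    c = refl
  sum-const (suc k) c = trans (+-congˡ (c) (sum-const k c)) (lemma (+ k) c)
    where
    lemma : ∀ k c → c + k * c ≡ (1ℤ + k) * c
    lemma = solve-∀

  sum-neg : ∀ {k} (f : Fin k → ℤ) → sum (λ i → - f i) ≡ - sum f
  sum-neg {zero}  f = refl
  sum-neg {suc k} f = trans (cong (λ z → - f zero + z) (sum-neg (f ∘ suc))) (sym (ℤₚ.neg-distrib-+ (f zero) _))

  sum-sub : ∀ {k} (f g : Fin k → ℤ) → sum (λ i → f i - g i) ≡ sum f - sum g
  sum-sub f g = trans (∑-distrib-+ f (λ i → - g i)) (cong (λ z → sum f + z) (sum-neg g))

  sum-nonneg : ∀ {k} (f : Fin k → ℤ) → (∀ i → 0ℤ ≤ᶻ f i) → 0ℤ ≤ᶻ sum f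
  sum-nonneg {zero}  f f≥0 = ℤₚ.≤-refl
  sum-nonneg {suc k} f f≥0 = ℤₚ.+-mono-≤ (f≥0 zero) (sum-nonneg (f ∘ suc) (f≥0 ∘ suc))

  nonneg-+≡0 : ∀ {a b} → 0ℤ ≤ᶻ a → 0ℤ ≤ᶻ b → a + b ≡ 0ℤ → a ≡ 0ℤ × b ≡ 0ℤ
  nonneg-+≡0 {+ a} {+ b} _ _ eq with ℕₚ.m+n≡0⇒m≡0 a (ℤₚ.+-injective eq) | ℕₚ.m+n≡0⇒n≡0 a (ℤₚ.+-injective eq)
  ... | refl | refl = refl , refl

  sum≡0⇒≡0 : ∀ {k} (f : Fin k → ℤ) → (∀ i → 0ℤ ≤ᶻ f i) → sum f ≡ 0ℤ → ∀ i → f i ≡ 0ℤ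
  sum≡0⇒≡0 f f≥0 eq zero    = proj₁ (nonneg-+≡0 (f≥0 zero) (sum-nonneg (f ∘ suc) (f≥0 ∘ suc)) eq)
  sum≡0⇒≡0 f f≥0 eq (suc i) =
    sum≡0⇒≡0 (f ∘ suc) (f≥0 ∘ suc) (proj₂ (nonneg-+≡0 (f≥0 zero) (sum-nonneg (f ∘ suc) (f≥0 ∘ suc)) eq)) i

  sum-δ : ∀ {k} (i : Fin k) (f : Fin k → ℤ) → (∀ j → i ≢ j → f j ≡ 0ℤ) → sum f ≡ f i
  sum-δ {suc k} zero f off = trans (+-congˡ (f zero) (trans (sum-cong-≗ (λ j → off (suc j) λ ())) (trans (sum-const k 0ℤ) (ℤₚ.*-zeroʳ (+ k))))) (ℤₚ.+-identityʳ _)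
  sum-δ {suc k} (suc i) f off = trans (cong (_+ sum (f ∘ suc)) (off zero λ ())) (trans (ℤₚ.+-identityˡ _) (sum-δ i (f ∘ suc) (λ j i≢j → off (suc j) λ { refl → i≢j refl })))

  -- Functions on words and the adjacency operator of the Hamming graph

  module _ {q : ℕ} where

    Fn : ℕ → Set
    Fn n = Vec (Fin q) n → ℤ

    Q : ℤ
    Q = + q

    marginal : ∀ {n} → Fn (suc n) → Fn n
    marginal F xs = sum (λ y → F (y ∷ xs))

    -- adj and adj₂ sum a function over the words at distance 1 and 2.
    adj : ∀ {n} → Fn n → Fn n
    adj F []       = 0ℤ
    adj F (x ∷ xs) = adj (F ∘ (x ∷_)) xs + (marginal F xs - F (x ∷ xs))

    adj₂ : ∀ {n} → Fn n → Fn n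
    adj₂ F []       = 0ℤ
    adj₂ F (x ∷ xs) = adj₂ (F ∘ (x ∷_)) xs + (adj (marginal F) xs - adj (F ∘ (x ∷_)) xs)

    total : ∀ {n} → Fn n → ℤ
    total {zero}  F = F []
    total {suc n} F = total (marginal F)

    adj-cong : ∀ {n} {F G : Fn n} → F ≗ G → adj F ≗ adj G
    adj-cong eq []       = refl
    adj-cong eq (x ∷ xs) = cong₂ _+_ (adj-cong (eq ∘ (x ∷_)) xs)
      (cong₂ _-_ (sum-cong-≗ (λ y → eq (y ∷ xs))) (eq (x ∷ xs)))

    marginal-+ : ∀ {n} (F G : Fn (suc n)) → marginal (λ v → F v + G v) ≗ (λ v → marginal F v + marginal G v)
    marginal-+ F G xs = ∑-distrib-+ (λ y → F (y ∷ xs)) (λ y → G (y ∷ xs))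

    marginal-* : ∀ {n} c (F : Fn (suc n)) → marginal (λ v → c * F v) ≗ (λ v → c * marginal F v)
    marginal-* c F xs = sym (*-distribˡ-sum c (λ y → F (y ∷ xs)))

    adj-+ : ∀ {n} (F G : Fn n) → adj (λ v → F v + G v) ≗ (λ v → adj F v + adj G v)
    adj-+ F G []       = refl
    adj-+ F G (x ∷ xs) rewrite adj-+ (F ∘ (x ∷_)) (G ∘ (x ∷_)) xs | marginal-+ F G xs =
      lemma (adj (F ∘ (x ∷_)) xs) (adj (G ∘ (x ∷_)) xs) (marginal F xs) (marginal G xs) (F (x ∷ xs)) (G (x ∷ xs))
      where
      lemma : ∀ a b s t f g → a + b + (s + t - (f + g)) ≡ a + (s - f) + (b + (t - g))
      lemma = solve-∀

    adj-* : ∀ {n} c (F : Fn n) → adj (λ v → c * F v) ≗ (λ v → c * adj F v)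
    adj-* c F []       = sym (ℤₚ.*-zeroʳ c)
    adj-* c F (x ∷ xs) rewrite adj-* c (F ∘ (x ∷_)) xs | marginal-* c F xs =
      lemma c (adj (F ∘ (x ∷_)) xs) (marginal F xs) (F (x ∷ xs))
      where
      lemma : ∀ c a s f → c * a + (c * s - c * f) ≡ c * (a + (s - f))
      lemma = solve-∀

    adj-0 : ∀ {n} → adj {n} (λ _ → 0ℤ) ≗ (λ _ → 0ℤ)
    adj-0 v = adj-* 0ℤ (λ _ → 0ℤ) v

    adj-sub : ∀ {n} (F G : Fn n) → adj (λ v → F v - G v) ≗ (λ v → adj F v - adj G v)
    adj-sub F G v = begin
      adj (λ v → F v - G v) v              ≡⟨ adj-cong (λ u → +-congˡ (F u) (sym (ℤₚ.-1*i≡-i (G u)))) v ⟩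
      adj (λ v → F v + - 1ℤ * G v) v       ≡⟨ adj-+ F (λ u → - 1ℤ * G u) v ⟩
      adj F v + adj (λ v → - 1ℤ * G v) v   ≡⟨ +-congˡ (adj F v) (trans (adj-* (- 1ℤ) G v) (ℤₚ.-1*i≡-i _)) ⟩
      adj F v - adj G v                    ∎
      where open ≡-Reasoning

    adj-sum : ∀ {n k} (F : Fin k → Fn n) → adj (λ v → sum (λ i → F i v)) ≗ (λ v → sum (λ i → adj (F i) v))
    adj-sum {k = zero}  F v = adj-0 v
    adj-sum {k = suc k} F v = trans (adj-+ (F zero) _ v) (+-congˡ (adj (F zero) v) (adj-sum (F ∘ suc) v))

    -- Let `J` be summation over the first coordinate and `A′` the operator on the remaining ones,
    -- so that `adj` is `A′ + (J - I)`. Then `J` commutes with `A′`, and `J(J - I) = (q - 1)J`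
    -- because `J² = qJ`.
    marginal-adj : ∀ {n} (F : Fn (suc n)) xs → marginal (adj F) xs ≡ adj (marginal F) xs + (Q - 1ℤ) * marginal F xs
    marginal-adj F xs = begin
      sum (λ y → adj (F ∘ (y ∷_)) xs + (marginal F xs - F (y ∷ xs)))
        ≡⟨ ∑-distrib-+ (λ y → adj (F ∘ (y ∷_)) xs) (λ y → marginal F xs - F (y ∷ xs)) ⟩
      sum (λ y → adj (F ∘ (y ∷_)) xs) + sum (λ y → marginal F xs - F (y ∷ xs))
        ≡⟨ cong₂ _+_ (sym (adj-sum (λ y → F ∘ (y ∷_)) xs)) (trans (sum-sub {q} (λ _ → marginal F xs) (λ y → F (y ∷ xs))) (cong (_- marginal F xs) (sum-const q (marginal F xs)))) ⟩
      adj (marginal F) xs + (Q * marginal F xs - marginal F xs)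
        ≡⟨ lemma (adj (marginal F) xs) Q (marginal F xs) ⟩
      adj (marginal F) xs + (Q - 1ℤ) * marginal F xs ∎
      where
      open ≡-Reasoning
      lemma : ∀ a q t → a + (q * t - t) ≡ a + (q - 1ℤ) * t
      lemma = solve-∀

    -- The square of `A′ + (J - I)`, where `J` sums over the first coordinate:
    -- `A′² + 2A′(J - I) + (J - I)²`. By `J² = qJ` the last term is `(q - 2)J + I`.
    adj-adj : ∀ {n} (F : Fn (suc n)) x xs → adj (adj F) (x ∷ xs) ≡
      adj (adj (F ∘ (x ∷_))) xs + + 2 * adj (marginal F) xs - + 2 * adj (F ∘ (x ∷_)) xs + (Q - + 2) * marginal F xs + F (x ∷ xs)
    adj-adj F x xs = begin
      adj (λ v → adj (F ∘ (x ∷_)) v + (marginal F v - F (x ∷ v))) xs + (marginal (adj F) xs - adj F (x ∷ xs))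
        ≡⟨ cong₂ (λ a b → a + (b - adj F (x ∷ xs)))
             (trans (adj-+ (adj (F ∘ (x ∷_))) _ xs) (+-congˡ (adj (adj (F ∘ (x ∷_))) xs) (adj-sub (marginal F) (F ∘ (x ∷_)) xs)))
             (marginal-adj F xs) ⟩
      adj (adj (F ∘ (x ∷_))) xs + (adj (marginal F) xs - adj (F ∘ (x ∷_)) xs) + (adj (marginal F) xs + (Q - 1ℤ) * marginal F xs - (adj (F ∘ (x ∷_)) xs + (marginal F xs - F (x ∷ xs))))
        ≡⟨ lemma (adj (adj (F ∘ (x ∷_))) xs) (adj (marginal F) xs) (adj (F ∘ (x ∷_)) xs) Q (marginal F xs) (F (x ∷ xs)) ⟩
      adj (adj (F ∘ (x ∷_))) xs + + 2 * adj (marginal F) xs - + 2 * adj (F ∘ (x ∷_)) xs + (Q - + 2) * marginal F xs + F (x ∷ xs) ∎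
      where
      open ≡-Reasoning
      lemma : ∀ aa at a q t f → aa + (at - a) + (at + (q - 1ℤ) * t - (a + (t - f))) ≡ aa + + 2 * at - + 2 * a + (q - + 2) * t + f
      lemma = solve-∀

    -- The coefficients are intersection numbers of the Hamming scheme: two words at distance 0, 1
    -- or 2 have `n(q - 1)`, `q - 2` or 2 common neighbours.
    adj²≡ : ∀ {n} (F : Fn n) v → adj (adj F) v ≡ + n * (Q - 1ℤ) * F v + (Q - + 2) * adj F v + + 2 * adj₂ F v
    adj²≡ F []       = lemma (F []) Q
      where
      lemma : ∀ f q → 0ℤ ≡ 0ℤ * (q - 1ℤ) * f + (q - + 2) * 0ℤ + + 2 * 0ℤ
      lemma = solve-∀
    adj²≡ {suc n} F (x ∷ xs) = trans (adj-adj F x xs)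
      (trans (cong (λ z → z + + 2 * adj (marginal F) xs - + 2 * adj (F ∘ (x ∷_)) xs + (Q - + 2) * marginal F xs + F (x ∷ xs)) (adj²≡ (F ∘ (x ∷_)) xs))
        (lemma (+ n) Q (F (x ∷ xs)) (adj (F ∘ (x ∷_)) xs) (adj₂ (F ∘ (x ∷_)) xs) (adj (marginal F) xs) (marginal F xs)))
      where
      lemma : ∀ n q f a a2 at t →
        n * (q - 1ℤ) * f + (q - + 2) * a + + 2 * a2 + + 2 * at - + 2 * a + (q - + 2) * t + f ≡
        (1ℤ + n) * (q - 1ℤ) * f + (q - + 2) * (a + (t - f)) + + 2 * (a2 + (at - a))
      lemma = solve-∀

    eigenvalue : ℕ → ℕ → ℤ
    eigenvalue n j = + n * (Q - 1ℤ) - Q * + j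

    marginal-adj² : ∀ {n} (F : Fn (suc n)) xs → marginal (adj (adj F)) xs ≡
      adj (adj (marginal F)) xs + + 2 * (Q - 1ℤ) * adj (marginal F) xs + (Q - 1ℤ) * (Q - 1ℤ) * marginal F xs
    marginal-adj² F xs = begin
      marginal (adj (adj F)) xs
        ≡⟨ marginal-adj (adj F) xs ⟩
      adj (marginal (adj F)) xs + (Q - 1ℤ) * marginal (adj F) xs
        ≡⟨ cong₂ (λ a b → a + (Q - 1ℤ) * b)
             (trans (adj-cong (marginal-adj F) xs) (trans (adj-+ (adj (marginal F)) (λ u → (Q - 1ℤ) * marginal F u) xs) (+-congˡ (adj (adj (marginal F)) xs) (adj-* (Q - 1ℤ) (marginal F) xs))))
             (marginal-adj F xs) ⟩
      adj (adj (marginal F)) xs + (Q - 1ℤ) * adj (marginal F) xs + (Q - 1ℤ) * (adj (marginal F) xs + (Q - 1ℤ) * marginal F xs)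
        ≡⟨ lemma (adj (adj (marginal F)) xs) (Q - 1ℤ) (adj (marginal F) xs) (marginal F xs) ⟩
      adj (adj (marginal F)) xs + + 2 * (Q - 1ℤ) * adj (marginal F) xs + (Q - 1ℤ) * (Q - 1ℤ) * marginal F xs ∎
      where
      open ≡-Reasoning
      lemma : ∀ aa r a t → aa + r * a + r * (a + r * t) ≡ aa + + 2 * r * a + r * r * t
      lemma = solve-∀

    -- Summing over the first coordinate shifts adj by q - 1; on functions whose sum over the first
    -- coordinate vanishes, fixing that coordinate shifts adj by -1.
    no-eigenvalue⇒0 : ∀ n b c (F : Fn n) →
      (∀ v → adj (adj F) v + b * adj F v + c * F v ≡ 0ℤ) →
      (∀ j → j ℕ.≤ n → eigenvalue n j * eigenvalue n j + b * eigenvalue n j + c ≢ 0ℤ) →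
      ∀ v → F v ≡ 0ℤ
    no-eigenvalue⇒0 zero b c F ann nr [] with ℤₚ.i*j≡0⇒i≡0∨j≡0 c (trans (lemma b (c * F [])) (ann []))
      where
      lemma : ∀ b z → z ≡ 0ℤ + b * 0ℤ + z
      lemma = solve-∀
    ... | inj₂ F≡0 = F≡0
    ... | inj₁ c≡0 = ⊥-elim (nr 0 z≤n (trans (lemma Q b c) c≡0))
      where
      lemma : ∀ q b c → (0ℤ * (q - 1ℤ) - q * 0ℤ) * (0ℤ * (q - 1ℤ) - q * 0ℤ) + b * (0ℤ * (q - 1ℤ) - q * 0ℤ) + c ≡ c
      lemma = solve-∀
    no-eigenvalue⇒0 (suc n) b c F ann nr (x ∷ xs) =
      -- For `p(T) = T² + bT + c` these are the coefficients of `p(T - 1)`; those used for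
      -- `marginal` below belong to `p(T + r)`. Correspondingly, the eigenvalue for `suc n` and
      -- `suc j` is the one for `n` and `j` minus 1, and the eigenvalue for `suc n` and `j` is the
      -- one for `n` and `j` plus `r`.
      no-eigenvalue⇒0 n (b - + 2) (c - b + 1ℤ) (F ∘ (x ∷_)) ann-row (λ j j≤n eq → nr (suc j) (s≤s j≤n) (trans (shift₋ (+ n) Q b c (+ j)) eq)) xs
      where
      open ≡-Reasoning
      r = Q - 1ℤ
      ann-marginal : ∀ v → adj (adj (marginal F)) v + (b + + 2 * r) * adj (marginal F) v + (c + b * r + r * r) * marginal F v ≡ 0ℤ
      ann-marginal v = begin
        adj (adj (marginal F)) v + (b + + 2 * r) * adj (marginal F) v + (c + b * r + r * r) * marginal F v
          ≡⟨ lemma (adj (adj (marginal F)) v) b c r (adj (marginal F) v) (marginal F v) ⟩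
        adj (adj (marginal F)) v + + 2 * r * adj (marginal F) v + r * r * marginal F v + b * (adj (marginal F) v + r * marginal F v) + c * marginal F v
          ≡⟨ cong₂ (λ y z → y + b * z + c * marginal F v) (sym (marginal-adj² F v)) (sym (marginal-adj F v)) ⟩
        marginal (adj (adj F)) v + b * marginal (adj F) v + c * marginal F v
          ≡⟨ sym (trans (marginal-+ (λ u → adj (adj F) u + b * adj F u) (λ u → c * F u) v)
               (cong₂ _+_ (trans (marginal-+ (adj (adj F)) (λ u → b * adj F u) v) (+-congˡ (marginal (adj (adj F)) v) (marginal-* b (adj F) v))) (marginal-* c F v))) ⟩
        marginal (λ u → adj (adj F) u + b * adj F u + c * F u) v
          ≡⟨ sum-cong-≗ (λ y → ann (y ∷ v)) ⟩
        sum {q} (λ _ → 0ℤ)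
          ≡⟨ trans (sum-const q 0ℤ) (ℤₚ.*-zeroʳ Q) ⟩
        0ℤ ∎
        where
        lemma : ∀ aa b c r a t → aa + (b + + 2 * r) * a + (c + b * r + r * r) * t ≡ aa + + 2 * r * a + r * r * t + b * (a + r * t) + c * t
        lemma = solve-∀
      shift₊ : ∀ n q b c j → let e = (1ℤ + n) * (q - 1ℤ) - q * j ; e′ = n * (q - 1ℤ) - q * j in
        e * e + b * e + c ≡ e′ * e′ + (b + + 2 * (q - 1ℤ)) * e′ + (c + b * (q - 1ℤ) + (q - 1ℤ) * (q - 1ℤ))
      shift₊ = solve-∀
      shift₋ : ∀ n q b c j → let e = (1ℤ + n) * (q - 1ℤ) - q * (1ℤ + j) ; e′ = n * (q - 1ℤ) - q * j in
        e * e + b * e + c ≡ e′ * e′ + (b - + 2) * e′ + (c - b + 1ℤ)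
      shift₋ = solve-∀
      marginal≡0 : ∀ v → marginal F v ≡ 0ℤ
      marginal≡0 = no-eigenvalue⇒0 n (b + + 2 * r) (c + b * r + r * r) (marginal F) ann-marginal
        (λ j j≤n eq → nr j (ℕₚ.m≤n⇒m≤1+n j≤n) (trans (shift₊ (+ n) Q b c (+ j)) eq))
      adj-marginal≡0 : ∀ v → adj (marginal F) v ≡ 0ℤ
      adj-marginal≡0 v = trans (adj-cong marginal≡0 v) (adj-0 v)
      ann-row : ∀ v → adj (adj (F ∘ (x ∷_))) v + (b - + 2) * adj (F ∘ (x ∷_)) v + (c - b + 1ℤ) * F (x ∷ v) ≡ 0ℤ
      ann-row v = begin
        adj (adj (F ∘ (x ∷_))) v + (b - + 2) * adj (F ∘ (x ∷_)) v + (c - b + 1ℤ) * F (x ∷ v)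
          ≡⟨ lemma (adj (adj (F ∘ (x ∷_))) v) b c Q (adj (F ∘ (x ∷_)) v) (F (x ∷ v)) ⟩
        adj (adj (F ∘ (x ∷_))) v + + 2 * 0ℤ - + 2 * adj (F ∘ (x ∷_)) v + (Q - + 2) * 0ℤ + F (x ∷ v) + b * (adj (F ∘ (x ∷_)) v + (0ℤ - F (x ∷ v))) + c * F (x ∷ v)
          ≡⟨ cong₂ (λ y z → adj (adj (F ∘ (x ∷_))) v + + 2 * y - + 2 * adj (F ∘ (x ∷_)) v + (Q - + 2) * z + F (x ∷ v) + b * (adj (F ∘ (x ∷_)) v + (z - F (x ∷ v))) + c * F (x ∷ v)) (sym (adj-marginal≡0 v)) (sym (marginal≡0 v)) ⟩
        adj (adj (F ∘ (x ∷_))) v + + 2 * adj (marginal F) v - + 2 * adj (F ∘ (x ∷_)) v + (Q - + 2) * marginal F v + F (x ∷ v) + b * adj F (x ∷ v) + c * F (x ∷ v)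
          ≡⟨ cong (λ y → y + b * adj F (x ∷ v) + c * F (x ∷ v)) (sym (adj-adj F x v)) ⟩
        adj (adj F) (x ∷ v) + b * adj F (x ∷ v) + c * F (x ∷ v)
          ≡⟨ ann (x ∷ v) ⟩
        0ℤ ∎
        where
        lemma : ∀ aa b c q a f → aa + (b - + 2) * a + (c - b + 1ℤ) * f ≡
          aa + + 2 * 0ℤ - + 2 * a + (q - + 2) * 0ℤ + f + b * (a + (0ℤ - f)) + c * f
        lemma = solve-∀

  square≡0⇒≡ : ∀ s t → s * s + (- (+ 2 * t)) * s + t * t ≡ 0ℤ → s ≡ t
  square≡0⇒≡ s t eq with ℤₚ.i*j≡0⇒i≡0∨j≡0 (s - t) (trans (lemma s t) eq)
    where
    lemma : ∀ s t → (s - t) * (s - t) ≡ s * s + (- (+ 2 * t)) * s + t * t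
    lemma = solve-∀
  ... | inj₁ s-t≡0 = ℤₚ.i-j≡0⇒i≡j s t s-t≡0
  ... | inj₂ s-t≡0 = ℤₚ.i-j≡0⇒i≡j s t s-t≡0

  -- Spheres, balls and their sizes

  [_≐_] : ℕ → ℕ → ℕ
  [ zero  ≐ zero  ] = 1
  [ zero  ≐ suc _ ] = 0
  [ suc _ ≐ zero  ] = 0
  [ suc k ≐ suc d ] = [ k ≐ d ]

  module _ {q : ℕ} where

    hamming-∷-≡ : ∀ {n} x (u v : Vec (Fin q) n) → hamming (x ∷ u) (x ∷ v) ≡ hamming u v
    hamming-∷-≡ x u v with x ≟ x
    ... | yes _  = refl
    ... | no x≢x = ⊥-elim (x≢x refl)

    hamming-∷-≢ : ∀ {n x y} (u v : Vec (Fin q) n) → x ≢ y → hamming (x ∷ u) (y ∷ v) ≡ suc (hamming u v)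
    hamming-∷-≢ {x = x} {y} u v x≢y with x ≟ y
    ... | yes x≡y = ⊥-elim (x≢y x≡y)
    ... | no _    = refl

    hamming-refl : ∀ {n} (u : Vec (Fin q) n) → hamming u u ≡ 0
    hamming-refl []      = refl
    hamming-refl (x ∷ u) = trans (hamming-∷-≡ x u u) (hamming-refl u)

    hamming-triangle : ∀ {n} (u v w : Vec (Fin q) n) → hamming u v ℕ.≤ hamming u w ℕ.+ hamming v w
    hamming-triangle [] [] [] = z≤n
    hamming-triangle (x ∷ u) (y ∷ v) (z ∷ w) with x ≟ y | x ≟ z | y ≟ z
    ... | yes _    | yes _    | yes _   = hamming-triangle u v w
    ... | yes _    | yes _    | no _    = ℕₚ.≤-trans (hamming-triangle u v w) (ℕₚ.+-monoʳ-≤ (hamming u w) (ℕₚ.n≤1+n _))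
    ... | yes _    | no _     | yes _   = ℕₚ.m≤n⇒m≤1+n (hamming-triangle u v w)
    ... | yes _    | no _     | no _    = ℕₚ.m≤n⇒m≤1+n (ℕₚ.≤-trans (hamming-triangle u v w) (ℕₚ.+-monoʳ-≤ (hamming u w) (ℕₚ.n≤1+n _)))
    ... | no x≢y   | yes refl | yes refl = ⊥-elim (x≢y refl)
    ... | no _     | yes _    | no _    = ℕₚ.≤-trans (s≤s (hamming-triangle u v w)) (ℕₚ.≤-reflexive (sym (ℕₚ.+-suc _ _)))
    ... | no _     | no _     | yes _   = s≤s (hamming-triangle u v w)
    ... | no _     | no _     | no _    = s≤s (ℕₚ.≤-trans (hamming-triangle u v w) (ℕₚ.+-monoʳ-≤ (hamming u w) (ℕₚ.n≤1+n _)))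

    shell : ∀ {n} → ℕ → Vec (Fin q) n → Fn {q} n
    shell k c v = + [ k ≐ hamming c v ]

    shell₀-off : ∀ {n x y} (c v : Vec (Fin q) n) → x ≢ y → shell 0 (x ∷ c) (y ∷ v) ≡ 0ℤ
    shell₀-off c v x≢y rewrite hamming-∷-≢ c v x≢y = refl

    shell-on : ∀ {n} k x (c v : Vec (Fin q) n) → shell k (x ∷ c) (x ∷ v) ≡ shell k c v
    shell-on k x c v rewrite hamming-∷-≡ x c v = refl

    marginal-shell₀ : ∀ {n} x (c v : Vec (Fin q) n) → marginal (shell 0 (x ∷ c)) v ≡ shell 0 c v
    marginal-shell₀ x c v = trans (sum-δ x (λ y → shell 0 (x ∷ c) (y ∷ v)) (λ y → shell₀-off c v)) (shell-on 0 x c v)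

    shell-off : ∀ {n x y} k (c v : Vec (Fin q) n) → x ≢ y → shell (suc k) (x ∷ c) (y ∷ v) ≡ shell k c v
    shell-off k c v x≢y rewrite hamming-∷-≢ c v x≢y = refl

    adj-shell₀ : ∀ {n} (c v : Vec (Fin q) n) → adj (shell 0 c) v ≡ shell 1 c v
    adj-shell₀ []       []      = refl
    adj-shell₀ (x ∷ c) (y ∷ v) = go (x ≟ y)
      where
      open ≡-Reasoning
      lemma : ∀ a b → a + (b - b) ≡ a
      lemma = solve-∀
      go : Dec (x ≡ y) → adj (shell 0 (x ∷ c)) (y ∷ v) ≡ shell 1 (x ∷ c) (y ∷ v)
      go (yes refl) = begin
        adj (shell 0 (x ∷ c) ∘ (x ∷_)) v + (marginal (shell 0 (x ∷ c)) v - shell 0 (x ∷ c) (x ∷ v))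
          ≡⟨ cong₂ _+_ (trans (adj-cong (shell-on 0 x c) v) (adj-shell₀ c v)) (cong₂ _-_ (marginal-shell₀ x c v) (shell-on 0 x c v)) ⟩
        shell 1 c v + (shell 0 c v - shell 0 c v)
          ≡⟨ trans (lemma (shell 1 c v) (shell 0 c v)) (sym (shell-on 1 x c v)) ⟩
        shell 1 (x ∷ c) (x ∷ v) ∎
      -- No word beginning with `y` equals the centre, so only the change of the first letter to `x`
      -- contributes, and `marginal` supplies it.
      go (no x≢y) = begin
        adj (shell 0 (x ∷ c) ∘ (y ∷_)) v + (marginal (shell 0 (x ∷ c)) v - shell 0 (x ∷ c) (y ∷ v))
          ≡⟨ cong₂ _+_ (trans (adj-cong (λ u → shell₀-off c u x≢y) v) (adj-0 v)) (cong₂ _-_ (marginal-shell₀ x c v) (shell₀-off c v x≢y)) ⟩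
        0ℤ + (shell 0 c v - 0ℤ)
          ≡⟨ trans (ℤₚ.+-identityˡ (shell 0 c v - 0ℤ)) (trans (ℤₚ.+-identityʳ (shell 0 c v)) (sym (shell-off 0 c v x≢y))) ⟩
        shell 1 (x ∷ c) (y ∷ v) ∎

    adj₂-cong : ∀ {n} {F G : Fn {q} n} → F ≗ G → adj₂ F ≗ adj₂ G
    adj₂-cong eq []       = refl
    adj₂-cong eq (x ∷ v) = cong₂ _+_ (adj₂-cong (eq ∘ (x ∷_)) v)
      (cong₂ _-_ (adj-cong (λ u → sum-cong-≗ (λ y → eq (y ∷ u))) v) (adj-cong (eq ∘ (x ∷_)) v))

    adj₂-0 : ∀ {n} (v : Vec (Fin q) n) → adj₂ (λ _ → 0ℤ) v ≡ 0ℤ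
    adj₂-0 []      = refl
    adj₂-0 (x ∷ v) = cong₂ _+_ (adj₂-0 v) (cong₂ _-_ (trans (adj-cong (λ u → trans (sum-const q 0ℤ) (ℤₚ.*-zeroʳ (+ q))) v) (adj-0 v)) (adj-0 v))

    adj₂-shell₀ : ∀ {n} (c v : Vec (Fin q) n) → adj₂ (shell 0 c) v ≡ shell 2 c v
    adj₂-shell₀ []       []      = refl
    adj₂-shell₀ (x ∷ c) (y ∷ v) = go (x ≟ y)
      where
      open ≡-Reasoning
      lemma : ∀ a b → a + (b - b) ≡ a
      lemma = solve-∀
      go : Dec (x ≡ y) → adj₂ (shell 0 (x ∷ c)) (y ∷ v) ≡ shell 2 (x ∷ c) (y ∷ v)
      go (yes refl) = begin
        adj₂ (shell 0 (x ∷ c) ∘ (x ∷_)) v + (adj (marginal (shell 0 (x ∷ c))) v - adj (shell 0 (x ∷ c) ∘ (x ∷_)) v)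
          ≡⟨ cong₂ _+_ (trans (adj₂-cong (shell-on 0 x c) v) (adj₂-shell₀ c v)) (cong₂ _-_ (adj-cong (marginal-shell₀ x c) v) (adj-cong (shell-on 0 x c) v)) ⟩
        shell 2 c v + (adj (shell 0 c) v - adj (shell 0 c) v)
          ≡⟨ trans (lemma (shell 2 c v) (adj (shell 0 c) v)) (sym (shell-on 2 x c v)) ⟩
        shell 2 (x ∷ c) (x ∷ v) ∎
      go (no x≢y) = begin
        adj₂ (shell 0 (x ∷ c) ∘ (y ∷_)) v + (adj (marginal (shell 0 (x ∷ c))) v - adj (shell 0 (x ∷ c) ∘ (y ∷_)) v)
          ≡⟨ cong₂ _+_ (trans (adj₂-cong (λ u → shell₀-off c u x≢y) v) (adj₂-0 v))
               (cong₂ _-_ (trans (adj-cong (marginal-shell₀ x c) v) (adj-shell₀ c v)) (trans (adj-cong (λ u → shell₀-off c u x≢y) v) (adj-0 v))) ⟩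
        0ℤ + (shell 1 c v - 0ℤ)
          ≡⟨ trans (ℤₚ.+-identityˡ (shell 1 c v - 0ℤ)) (trans (ℤₚ.+-identityʳ (shell 1 c v)) (sym (shell-off 1 c v x≢y))) ⟩
        shell 2 (x ∷ c) (y ∷ v) ∎

    adj-shell₁ : ∀ {n} (c v : Vec (Fin q) n) → adj (shell 1 c) v ≡
      + n * (+ q - 1ℤ) * shell 0 c v + (+ q - + 2) * shell 1 c v + + 2 * shell 2 c v
    adj-shell₁ {n} c v = begin
      adj (shell 1 c) v            ≡⟨ adj-cong (λ u → sym (adj-shell₀ c u)) v ⟩
      adj (adj (shell 0 c)) v      ≡⟨ adj²≡ (shell 0 c) v ⟩
      + n * (+ q - 1ℤ) * shell 0 c v + (+ q - + 2) * adj (shell 0 c) v + + 2 * adj₂ (shell 0 c) v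
        ≡⟨ cong₂ (λ a b → + n * (+ q - 1ℤ) * shell 0 c v + (+ q - + 2) * a + + 2 * b) (adj-shell₀ c v) (adj₂-shell₀ c v) ⟩
      + n * (+ q - 1ℤ) * shell 0 c v + (+ q - + 2) * shell 1 c v + + 2 * shell 2 c v ∎
      where open ≡-Reasoning

    total-cong : ∀ {n} {F G : Fn {q} n} → F ≗ G → total F ≡ total G
    total-cong {zero}  eq = eq []
    total-cong {suc n} eq = total-cong {n} (λ u → sum-cong-≗ (λ y → eq (y ∷ u)))

    total-+ : ∀ {n} (F G : Fn {q} n) → total (λ v → F v + G v) ≡ total F + total G
    total-+ {zero}  F G = refl
    total-+ {suc n} F G = trans (total-cong {n} (marginal-+ F G)) (total-+ (marginal F) (marginal G))

    total-* : ∀ {n} c (F : Fn {q} n) → total (λ v → c * F v) ≡ c * total F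
    total-* {zero}  c F = refl
    total-* {suc n} c F = trans (total-cong {n} (marginal-* c F)) (total-* c (marginal F))

    total-const : ∀ n c → total {q} {n} (λ _ → c) ≡ + (q ℕ.^ n) * c
    total-const zero    c = sym (ℤₚ.*-identityˡ c)
    total-const (suc n) c = begin
      total {q} {n} (λ _ → sum {q} (λ _ → c)) ≡⟨ total-cong {n} (λ _ → sum-const q c) ⟩
      total {q} {n} (λ _ → + q * c)           ≡⟨ total-const n (+ q * c) ⟩
      + (q ℕ.^ n) * (+ q * c)                 ≡⟨ lemma (+ (q ℕ.^ n)) (+ q) c ⟩
      + q * + (q ℕ.^ n) * c                   ≡⟨ cong (_* c) (sym (ℤₚ.pos-* q (q ℕ.^ n))) ⟩
      + (q ℕ.* q ℕ.^ n) * c                   ∎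
      where
      open ≡-Reasoning
      lemma : ∀ a b c → a * (b * c) ≡ b * a * c
      lemma = solve-∀

    -- The Hamming graph is regular of degree `n(q - 1)`.
    total-adj : ∀ {n} (F : Fn {q} n) → total (adj F) ≡ + n * (+ q - 1ℤ) * total F
    total-adj {zero}  F = refl
    total-adj {suc n} F = begin
      total (marginal (adj F))
        ≡⟨ total-cong {n} (marginal-adj F) ⟩
      total (λ v → adj (marginal F) v + (+ q - 1ℤ) * marginal F v)
        ≡⟨ trans (total-+ (adj (marginal F)) (λ v → (+ q - 1ℤ) * marginal F v)) (cong₂ _+_ (total-adj (marginal F)) (total-* (+ q - 1ℤ) (marginal F))) ⟩
      + n * (+ q - 1ℤ) * total (marginal F) + (+ q - 1ℤ) * total (marginal F)
        ≡⟨ lemma (+ n) (+ q - 1ℤ) (total (marginal F)) ⟩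
      (1ℤ + + n) * (+ q - 1ℤ) * total (marginal F) ∎
      where
      open ≡-Reasoning
      lemma : ∀ n r t → n * r * t + r * t ≡ (1ℤ + n) * r * t
      lemma = solve-∀

    total-shell₀ : ∀ {n} (c : Vec (Fin q) n) → total (shell 0 c) ≡ 1ℤ
    total-shell₀ []      = refl
    total-shell₀ {suc n} (x ∷ c) = trans (total-cong {n} (marginal-shell₀ x c)) (total-shell₀ c)

    total≡0⇒≡0 : ∀ {n} (F : Fn {q} n) → (∀ v → 0ℤ ≤ᶻ F v) → total F ≡ 0ℤ → ∀ v → F v ≡ 0ℤ
    total≡0⇒≡0 F F≥0 eq []      = eq
    total≡0⇒≡0 F F≥0 eq (x ∷ v) = sum≡0⇒≡0 (λ y → F (y ∷ v)) (λ y → F≥0 (y ∷ v))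
      (total≡0⇒≡0 (marginal F) (λ u → sum-nonneg (λ y → F (y ∷ u)) (λ y → F≥0 (y ∷ u))) eq v) x

    -- Twice the size of a ball of radius 2; the doubling avoids the division in `n(n - 1)/2`.
    2∣ball∣ : ℕ → ℤ
    2∣ball∣ n = + 2 + + 2 * (+ n * (+ q - 1ℤ)) + + n * (+ n - 1ℤ) * (+ q - 1ℤ) * (+ q - 1ℤ)

    ball : ∀ {n} → Vec (Fin q) n → Fn {q} n
    ball c v = + ([ 0 ≐ hamming c v ] ℕ.+ [ 1 ≐ hamming c v ] ℕ.+ [ 2 ≐ hamming c v ])

    -- The origin of the quadratic in Lloyd's theorem: eliminating `adj₂` by `adj²≡` turns
    -- `2(I + A + A₂)` into `A² + (4 - q)A + (2 - n(q - 1))`.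
    2ball≡ : ∀ {n} (c v : Vec (Fin q) n) → + 2 * ball c v ≡
      (+ 2 - + n * (+ q - 1ℤ)) * shell 0 c v + ((+ 4 - + q) * adj (shell 0 c) v + adj (adj (shell 0 c)) v)
    2ball≡ {n} c v rewrite trans (adj-cong (adj-shell₀ c) v) (adj-shell₁ c v) | adj-shell₀ c v =
      lemma (+ n) (+ q) (shell 0 c v) (shell 1 c v) (shell 2 c v)
      where
      lemma : ∀ n q a b c → + 2 * (a + b + c) ≡
        (+ 2 - n * (q - 1ℤ)) * a + ((+ 4 - q) * b + (n * (q - 1ℤ) * a + (q - + 2) * b + + 2 * c))
      lemma = solve-∀

    -- On totals, `adj` acts as multiplication by `n(q - 1)`; so the doubled ball size is the value
    -- of that quadratic at `n(q - 1)`.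
    total-ball : ∀ {n} (c : Vec (Fin q) n) → + 2 * total (ball c) ≡ 2∣ball∣ n
    total-ball {n} c = begin
      + 2 * total (ball c)
        ≡⟨ sym (total-* (+ 2) (ball c)) ⟩
      total (λ v → + 2 * ball c v)
        ≡⟨ total-cong (2ball≡ c) ⟩
      total (λ v → α * S v + (β * adj S v + adj (adj S) v))
        ≡⟨ trans (total-+ (λ v → α * S v) (λ v → β * adj S v + adj (adj S) v))
             (cong₂ _+_ (total-* α S) (trans (total-+ (λ v → β * adj S v) (adj (adj S)))
               (cong₂ _+_ (trans (total-* β (adj S)) (cong (β *_) (total-adj S))) (trans (total-adj (adj S)) (cong (+ n * (+ q - 1ℤ) *_) (total-adj S)))))) ⟩
      α * total S + (β * (+ n * (+ q - 1ℤ) * total S) + + n * (+ q - 1ℤ) * (+ n * (+ q - 1ℤ) * total S))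
        ≡⟨ cong (λ t → α * t + (β * (+ n * (+ q - 1ℤ) * t) + + n * (+ q - 1ℤ) * (+ n * (+ q - 1ℤ) * t))) (total-shell₀ c) ⟩
      α * 1ℤ + (β * (+ n * (+ q - 1ℤ) * 1ℤ) + + n * (+ q - 1ℤ) * (+ n * (+ q - 1ℤ) * 1ℤ))
        ≡⟨ lemma (+ n) (+ q) ⟩
      2∣ball∣ n ∎
      where
      open ≡-Reasoning
      S = shell 0 c
      α = + 2 - + n * (+ q - 1ℤ)
      β = + 4 - + q
      lemma : ∀ n q → (+ 2 - n * (q - 1ℤ)) * 1ℤ + ((+ 4 - q) * (n * (q - 1ℤ) * 1ℤ) + n * (q - 1ℤ) * (n * (q - 1ℤ) * 1ℤ)) ≡
        + 2 + + 2 * (n * (q - 1ℤ)) + n * (n - 1ℤ) * (q - 1ℤ) * (q - 1ℤ)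
      lemma = solve-∀

    adj-const : ∀ {n} c (v : Vec (Fin q) n) → adj (λ _ → c) v ≡ + n * (+ q - 1ℤ) * c
    adj-const c []      = refl
    adj-const {suc n} c (x ∷ v) = trans (cong₂ (λ a b → a + (b - c)) (adj-const c v) (sum-const q c)) (lemma (+ n) (+ q) c)
      where
      lemma : ∀ n q c → n * (q - 1ℤ) * c + (q * c - c) ≡ (1ℤ + n) * (q - 1ℤ) * c
      lemma = solve-∀

    -- Covering by the balls of a perfect code

    count : ∀ {n} → List (Vec (Fin q) n) → ℕ → Vec (Fin q) n → ℕ
    count []       k v = 0
    count (c ∷ cs) k v = [ k ≐ hamming c v ] ℕ.+ count cs k v

    cover : ∀ {n} → List (Vec (Fin q) n) → Vec (Fin q) n → ℕ
    cover C v = count C 0 v ℕ.+ count C 1 v ℕ.+ count C 2 v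

    cover-∷ : ∀ {n} c (C : List (Vec (Fin q) n)) v → cover (c ∷ C) v ≡
      [ 0 ≐ hamming c v ] ℕ.+ [ 1 ≐ hamming c v ] ℕ.+ [ 2 ≐ hamming c v ] ℕ.+ cover C v
    cover-∷ c C v = lemma ([ 0 ≐ hamming c v ]) ([ 1 ≐ hamming c v ]) ([ 2 ≐ hamming c v ]) (count C 0 v) (count C 1 v) (count C 2 v)
      where
      lemma : ∀ a b c x y z → a ℕ.+ x ℕ.+ (b ℕ.+ y) ℕ.+ (c ℕ.+ z) ≡ a ℕ.+ b ℕ.+ c ℕ.+ (x ℕ.+ y ℕ.+ z)
      lemma = ℕ-Solver.solve-∀

    adj-count₀ : ∀ {n} (C : List (Vec (Fin q) n)) v → adj (λ u → + count C 0 u) v ≡ + count C 1 v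
    adj-count₀ []      v = adj-0 v
    adj-count₀ (c ∷ C) v = trans (adj-+ (shell 0 c) (λ u → + count C 0 u) v) (cong₂ _+_ (adj-shell₀ c v) (adj-count₀ C v))

    adj-count₁ : ∀ {n} (C : List (Vec (Fin q) n)) v → adj (λ u → + count C 1 u) v ≡
      + n * (+ q - 1ℤ) * + count C 0 v + (+ q - + 2) * + count C 1 v + + 2 * + count C 2 v
    adj-count₁ {n} []      v = trans (adj-0 v) (lemma (+ n) (+ q))
      where
      lemma : ∀ n q → 0ℤ ≡ n * (q - 1ℤ) * 0ℤ + (q - + 2) * 0ℤ + + 2 * 0ℤ
      lemma = solve-∀
    adj-count₁ {n} (c ∷ C) v = trans (adj-+ (shell 1 c) (λ u → + count C 1 u) v)
      (trans (cong₂ _+_ (adj-shell₁ c v) (adj-count₁ C v))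
        (lemma (+ n * (+ q - 1ℤ)) (+ q - + 2) (+ 2) (shell 0 c v) (shell 1 c v) (shell 2 c v) (+ count C 0 v) (+ count C 1 v) (+ count C 2 v)))
      where
      lemma : ∀ r s t a b c x y z → r * a + s * b + t * c + (r * x + s * y + t * z) ≡ r * (a + x) + s * (b + y) + t * (c + z)
      lemma = solve-∀

    total-cover : ∀ {n} (C : List (Vec (Fin q) n)) → + 2 * total (λ v → + cover C v) ≡ + length C * 2∣ball∣ n
    total-cover {n} []      = cong (+ 2 *_) (trans (total-const n 0ℤ) (ℤₚ.*-zeroʳ (+ (q ℕ.^ n))))
    total-cover {n} (c ∷ C) = begin
      + 2 * total (λ v → + cover (c ∷ C) v)
        ≡⟨ cong (+ 2 *_) (trans (total-cong (λ v → cong +_ (cover-∷ c C v))) (total-+ (ball c) (λ v → + cover C v))) ⟩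
      + 2 * (total (ball c) + total (λ v → + cover C v))
        ≡⟨ ℤₚ.*-distribˡ-+ (+ 2) (total (ball c)) (total (λ v → + cover C v)) ⟩
      + 2 * total (ball c) + + 2 * total (λ v → + cover C v)
        ≡⟨ cong₂ _+_ (total-ball c) (total-cover C) ⟩
      2∣ball∣ n + + length C * 2∣ball∣ n
        ≡⟨ lemma (2∣ball∣ n) (+ length C) ⟩
      (1ℤ + + length C) * 2∣ball∣ n ∎
      where
      open ≡-Reasoning
      lemma : ∀ b l → b + l * b ≡ (1ℤ + l) * b
      lemma = solve-∀

    cover-far : ∀ {n} {C : List (Vec (Fin q) n)} {v} → All (λ c → 3 ℕ.≤ hamming c v) C → cover C v ≡ 0
    cover-far []                = refl
    cover-far {C = c ∷ C} {v} (far ∷ fars) = trans (cover-∷ c C v) (cong₂ ℕ._+_ (lemma far) (cover-far fars))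
      where
      lemma : ∀ {d} → 3 ℕ.≤ d → [ 0 ≐ d ] ℕ.+ [ 1 ≐ d ] ℕ.+ [ 2 ≐ d ] ≡ 0
      lemma (s≤s (s≤s (s≤s _))) = refl

    -- If the first codeword lies within distance 2 of `v`, the triangle inequality puts every other
    -- one at distance at least 5 - 2 = 3.
    cover≤1 : ∀ {n} (C : List (Vec (Fin q) n)) → IsECode q 2 n C → ∀ v → cover C v ℕ.≤ 1
    cover≤1 []      code v = z≤n
    cover≤1 (c ∷ C) (c# ∷ code) v with 3 ℕ.≤? hamming c v
    ... | yes far = ℕₚ.≤-trans (ℕₚ.≤-reflexive (trans (cover-∷ c C v) (cong (ℕ._+ cover C v) (lemma far)))) (cover≤1 C code v)
      where
      lemma : ∀ {d} → 3 ℕ.≤ d → [ 0 ≐ d ] ℕ.+ [ 1 ≐ d ] ℕ.+ [ 2 ≐ d ] ≡ 0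
      lemma (s≤s (s≤s (s≤s _))) = refl
    ... | no near = ℕₚ.≤-trans (ℕₚ.≤-reflexive (trans (cover-∷ c C v) (cong (s ℕ.+_) (cover-far (All.map far c#)))))
                      (ℕₚ.≤-trans (ℕₚ.≤-reflexive (ℕₚ.+-identityʳ s)) (lemma (hamming c v)))
      where
      s = [ 0 ≐ hamming c v ] ℕ.+ [ 1 ≐ hamming c v ] ℕ.+ [ 2 ≐ hamming c v ]
      lemma : ∀ d → [ 0 ≐ d ] ℕ.+ [ 1 ≐ d ] ℕ.+ [ 2 ≐ d ] ℕ.≤ 1
      lemma 0 = s≤s z≤n
      lemma 1 = s≤s z≤n
      lemma 2 = s≤s z≤n
      lemma (suc (suc (suc d))) = z≤n
      far : ∀ {c′} → 5 ℕ.≤ hamming c c′ → 3 ℕ.≤ hamming c′ v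
      far {c′} 5≤ = ℕₚ.+-cancelˡ-≤ 2 3 (hamming c′ v) (ℕₚ.≤-trans 5≤ (ℕₚ.≤-trans (hamming-triangle c c′ v) (ℕₚ.+-monoˡ-≤ (hamming c′ v) (ℕₚ.≤-pred (ℕₚ.≰⇒> near)))))

    -- The function `1 - cover` is nonnegative and, by the size condition, has total 0; hence it
    -- vanishes everywhere.
    cover≡1 : ∀ {n} (C : List (Vec (Fin q) n)) → IsECode q 2 n C → + length C * 2∣ball∣ n ≡ + 2 * + (q ℕ.^ n) → ∀ v → cover C v ≡ 1
    cover≡1 {n} C code size v = ℤₚ.+-injective (sym (ℤₚ.i-j≡0⇒i≡j 1ℤ (+ cover C v)
        (total≡0⇒≡0 (λ u → 1ℤ - + cover C u) (λ u → ℤₚ.i≤j⇒0≤j-i (+≤+ (cover≤1 C code u))) total≡0 v)))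
      where
      open ≡-Reasoning
      t = total (λ u → + cover C u)
      total-1-cover : total (λ u → 1ℤ - + cover C u) ≡ + (q ℕ.^ n) * 1ℤ + - 1ℤ * t
      total-1-cover = trans (total-cong (λ u → +-congˡ 1ℤ (sym (ℤₚ.-1*i≡-i (+ cover C u)))))
        (trans (total-+ (λ _ → 1ℤ) (λ u → - 1ℤ * + cover C u)) (cong₂ _+_ (total-const n 1ℤ) (total-* (- 1ℤ) (λ u → + cover C u))))
      twice : + 2 * total (λ u → 1ℤ - + cover C u) ≡ 0ℤ
      twice = begin
        + 2 * total (λ u → 1ℤ - + cover C u)       ≡⟨ cong (+ 2 *_) total-1-cover ⟩
        + 2 * (+ (q ℕ.^ n) * 1ℤ + - 1ℤ * t)        ≡⟨ lemma (+ (q ℕ.^ n)) t ⟩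
        + 2 * + (q ℕ.^ n) - + 2 * t                ≡⟨ cong (λ z → + 2 * + (q ℕ.^ n) - z) (trans (total-cover C) size) ⟩
        + 2 * + (q ℕ.^ n) - + 2 * + (q ℕ.^ n)      ≡⟨ ℤₚ.+-inverseʳ (+ 2 * + (q ℕ.^ n)) ⟩
        0ℤ                                         ∎
        where
        lemma : ∀ a t → + 2 * (a * 1ℤ + - 1ℤ * t) ≡ + 2 * a - + 2 * t
        lemma = solve-∀
      total≡0 : total (λ u → 1ℤ - + cover C u) ≡ 0ℤ
      total≡0 with ℤₚ.i*j≡0⇒i≡0∨j≡0 (+ 2) twice
      ... | inj₂ eq = eq

    count≥ : ∀ {n} c (C : List (Vec (Fin q) n)) v → 1 ℕ.≤ count (c ∷ C) (hamming c v) v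
    count≥ c C v = ℕₚ.≤-trans (ℕₚ.≤-reflexive (sym (lemma (hamming c v)))) (ℕₚ.m≤m+n _ _)
      where
      lemma : ∀ d → [ d ≐ d ] ≡ 1
      lemma zero    = refl
      lemma (suc d) = lemma d

  -- Lloyd's theorem for radius 2

  module _ {q n : ℕ} where

    private
      θ : ℕ → ℤ
      θ = eigenvalue {q} n

      r : ℤ
      r = + q - 1ℤ

      B : ℤ
      B = 2∣ball∣ {q} n

    -- Lloyd's theorem for e = 2. The points v₁ and v₂ guarantee that neither F nor H below vanishes.
    two-eigenvalues : (C : List (Vec (Fin q) n)) → (∀ v → cover C v ≡ 1) → B ≢ 0ℤ →
      ∀ v₁ v₂ → count C 0 v₁ ≡ 0 × count C 1 v₁ ≡ 1 → count C 0 v₂ ≡ 0 × count C 1 v₂ ≡ 0 →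
      ¬ (∀ x y → θ x + θ y ≡ + q - + 4 → θ x * θ y ≢ + 2 - + n * r)
    two-eigenvalues C covered ball≢0 v₁ v₂ counts₁ counts₂ no-roots = F₂≢0 (no-eigenvalue⇒0 n β γ F F-ann no-root₁ v₂)
      where
      open ≡-Reasoning
      β = + 4 - + q
      γ = + 2 - + n * r

      -- The quadratic `T² + βT + γ` in `adj` sends `count C 0` to twice `cover`, which is the
      -- constant 2, and the constant 1 to `B`. The combination `B * count C 0 - 2` is therefore
      -- annihilated.
      F : Fn {q} n
      F v = B * + count C 0 v - + 2

      adjF : ∀ v → adj F v ≡ B * + count C 1 v - + 2 * (+ n * r)
      adjF v = begin
        adj F v
          ≡⟨ adj-sub (λ u → B * + count C 0 u) (λ _ → + 2) v ⟩
        adj (λ u → B * + count C 0 u) v - adj (λ _ → + 2) v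
          ≡⟨ cong₂ _-_ (trans (adj-* B (λ u → + count C 0 u) v) (cong (B *_) (adj-count₀ C v))) (trans (adj-const (+ 2) v) (ℤₚ.*-comm (+ n * r) (+ 2))) ⟩
        B * + count C 1 v - + 2 * (+ n * r) ∎

      adj²F : ∀ v → adj (adj F) v ≡ B * (+ n * r * + count C 0 v + (+ q - + 2) * + count C 1 v + + 2 * + count C 2 v) - + n * r * (+ 2 * (+ n * r))
      adj²F v = begin
        adj (adj F) v
          ≡⟨ trans (adj-cong adjF v) (adj-sub (λ u → B * + count C 1 u) (λ _ → + 2 * (+ n * r)) v) ⟩
        adj (λ u → B * + count C 1 u) v - adj (λ _ → + 2 * (+ n * r)) v
          ≡⟨ cong₂ _-_ (trans (adj-* B (λ u → + count C 1 u) v) (cong (B *_) (adj-count₁ C v))) (adj-const (+ 2 * (+ n * r)) v) ⟩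
        B * (+ n * r * + count C 0 v + (+ q - + 2) * + count C 1 v + + 2 * + count C 2 v) - + n * r * (+ 2 * (+ n * r)) ∎

      F-ann : ∀ v → adj (adj F) v + β * adj F v + γ * F v ≡ 0ℤ
      F-ann v = begin
        adj (adj F) v + β * adj F v + γ * F v
          ≡⟨ cong₂ (λ y z → y + β * z + γ * F v) (adj²F v) (adjF v) ⟩
        B * (+ n * r * k₀ + (+ q - + 2) * k₁ + + 2 * k₂) - + n * r * (+ 2 * (+ n * r)) + β * (B * k₁ - + 2 * (+ n * r)) + γ * (B * k₀ - + 2)
          ≡⟨ lemma (+ n) (+ q) B k₀ k₁ k₂ ⟩
        + 2 * B * (k₀ + k₁ + k₂) - + 2 * B
          ≡⟨ cong (λ z → + 2 * B * + z - + 2 * B) (covered v) ⟩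
        + 2 * B * 1ℤ - + 2 * B
          ≡⟨ lemma′ B ⟩
        0ℤ ∎
        where
        k₀ = + count C 0 v
        k₁ = + count C 1 v
        k₂ = + count C 2 v
        lemma : ∀ n q B k₀ k₁ k₂ →
          B * (n * (q - 1ℤ) * k₀ + (q - + 2) * k₁ + + 2 * k₂) - n * (q - 1ℤ) * (+ 2 * (n * (q - 1ℤ))) + (+ 4 - q) * (B * k₁ - + 2 * (n * (q - 1ℤ))) + (+ 2 - n * (q - 1ℤ)) * (B * k₀ - + 2)
          ≡ + 2 * B * (k₀ + k₁ + k₂) - + 2 * (+ 2 + + 2 * (n * (q - 1ℤ)) + n * (n - 1ℤ) * (q - 1ℤ) * (q - 1ℤ))
        lemma = solve-∀
        lemma′ : ∀ B → + 2 * B * 1ℤ - + 2 * B ≡ 0ℤ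
        lemma′ = solve-∀

      F₂≡ : F v₂ ≡ - + 2
      F₂≡ = trans (cong (λ z → B * + z - + 2) (proj₁ counts₂)) (lemma B)
        where
        lemma : ∀ B → B * 0ℤ - + 2 ≡ - + 2
        lemma = solve-∀

      F₂≢0 : F v₂ ≢ 0ℤ
      F₂≢0 eq with trans (sym F₂≡) eq
      ... | ()

      -- Suppose that `t = θ x` is a root, and let `t′` be the other one. Then `H`, which is
      -- `adj - t` applied to `F`, satisfies `adj H = t′ H`. If `t′` were not an eigenvalue, `H`
      -- would vanish, which its values at `v₁` and `v₂` forbid. A double root is included.
      no-root₁ : ∀ x → x ℕ.≤ n → θ x * θ x + β * θ x + γ ≢ 0ℤ
      no-root₁ x _ root = ball≢0 B≡0
        where
        t = θ x
        t′ = + q - + 4 - t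
        H : Fn {q} n
        H v = adj F v - t * F v
        tt′ : t * t′ ≡ γ
        tt′ = ℤₚ.i-j≡0⇒i≡j (t * t′) γ (trans (lemma t (+ q) γ) (cong -_ root))
          where
          lemma : ∀ t q γ → t * (q - + 4 - t) - γ ≡ - (t * t + (+ 4 - q) * t + γ)
          lemma = solve-∀
        adjH : ∀ v → adj H v ≡ t′ * H v
        adjH v = begin
          adj H v
            ≡⟨ trans (adj-sub (adj F) (λ u → t * F u) v) (cong (λ z → adj (adj F) v - z) (adj-* t F v)) ⟩
          adj (adj F) v - t * adj F v
            ≡⟨ lemma (adj (adj F) v) (adj F v) (F v) t (+ q) ⟩
          adj (adj F) v + β * adj F v + t * t′ * F v + t′ * H v
            ≡⟨ cong (λ z → adj (adj F) v + β * adj F v + z * F v + t′ * H v) tt′ ⟩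
          adj (adj F) v + β * adj F v + γ * F v + t′ * H v
            ≡⟨ cong (_+ t′ * H v) (F-ann v) ⟩
          0ℤ + t′ * H v
            ≡⟨ ℤₚ.+-identityˡ (t′ * H v) ⟩
          t′ * H v ∎
          where
          lemma : ∀ aa a f t q → aa - t * a ≡ aa + (+ 4 - q) * a + t * (q - + 4 - t) * f + (q - + 4 - t) * (a - t * f)
          lemma = solve-∀
        -- The linear relation is squared, to `(T - t′)²`, so that the vanishing result for
        -- quadratics applies to it as well.
        H-ann : ∀ v → adj (adj H) v + (- (+ 2 * t′)) * adj H v + t′ * t′ * H v ≡ 0ℤ
        H-ann v = trans (cong₂ (λ y z → y + (- (+ 2 * t′)) * z + t′ * t′ * H v)
            (trans (adj-cong adjH v) (trans (adj-* t′ H v) (cong (t′ *_) (adjH v)))) (adjH v)) (lemma t′ (H v))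
          where
          lemma : ∀ t h → t * (t * h) + (- (+ 2 * t)) * (t * h) + t * t * h ≡ 0ℤ
          lemma = solve-∀
        no-root₂ : ∀ y → y ℕ.≤ n → θ y * θ y + (- (+ 2 * t′)) * θ y + t′ * t′ ≢ 0ℤ
        no-root₂ y _ root₂ = no-roots x y (trans (+-congˡ t θy≡t′) (lemma′ t (+ q))) (trans (cong (t *_) θy≡t′) tt′)
          where
          lemma′ : ∀ t q → t + (q - + 4 - t) ≡ q - + 4
          lemma′ = solve-∀
          θy≡t′ : θ y ≡ t′
          θy≡t′ = square≡0⇒≡ (θ y) t′ root₂
        H≡0 : ∀ v → H v ≡ 0ℤ
        H≡0 = no-eigenvalue⇒0 n (- (+ 2 * t′)) (t′ * t′) H H-ann no-root₂
        H≡ : ∀ v → H v ≡ B * + count C 1 v - + 2 * (+ n * r) - t * F v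
        H≡ v = cong (λ z → z - t * F v) (adjF v)
        -- Neither point is a codeword and `count C 1` differs by one between them, so `H v₁ - H v₂`
        -- is exactly `B`.
        B≡0 : B ≡ 0ℤ
        B≡0 = begin
          B
            ≡⟨ lemma B t (+ n * r) ⟩
          (B * 1ℤ - + 2 * (+ n * r) - t * (B * 0ℤ - + 2)) - (B * 0ℤ - + 2 * (+ n * r) - t * (B * 0ℤ - + 2))
            ≡⟨ sym (cong₂ _-_ (trans (H≡ v₁) (cong₂ (λ y z → B * + y - + 2 * (+ n * r) - t * (B * + z - + 2)) (proj₂ counts₁) (proj₁ counts₁)))
                              (trans (H≡ v₂) (cong₂ (λ y z → B * + y - + 2 * (+ n * r) - t * (B * + z - + 2)) (proj₂ counts₂) (proj₁ counts₂)))) ⟩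
          H v₁ - H v₂
            ≡⟨ cong₂ _-_ (H≡0 v₁) (H≡0 v₂) ⟩
          0ℤ ∎
          where
          lemma : ∀ B t n → B ≡ (B * 1ℤ - + 2 * n - t * (B * 0ℤ - + 2)) - (B * 0ℤ - + 2 * n - t * (B * 0ℤ - + 2))
          lemma = solve-∀

  other : ∀ {a} → Fin (suc (suc a)) → Fin (suc (suc a))
  other zero    = suc zero
  other (suc _) = zero

  other-≢ : ∀ {a} (i : Fin (suc (suc a))) → i ≢ other i
  other-≢ zero    ()
  other-≢ (suc _) ()

  -- The two points arise from the first codeword by altering one and two coordinates, which
  -- requires two symbols and length at least 2. As exactly one codeword lies within distance 2 of
  -- each point, that codeword determines all the counts.
  lloyd : ∀ {a n} (C : List (Vec (Fin (suc (suc a))) (suc (suc n)))) → 1 ℕ.≤ length C →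
    (∀ v → cover C v ≡ 1) → 2∣ball∣ {suc (suc a)} (suc (suc n)) ≢ 0ℤ →
    let q = suc (suc a) ; θ = eigenvalue {q} (suc (suc n)) in
    ¬ (∀ x y → θ x + θ y ≡ + q - + 4 → θ x * θ y ≢ + 2 - + suc (suc n) * (+ q - 1ℤ))
  lloyd {a} {n} C@(c@(c₁ ∷ c₂ ∷ c₃) ∷ C′) _ covered ball≢0 = two-eigenvalues C covered ball≢0 v₁ v₂ counts₁ counts₂
    where
    v₁ v₂ : Vec (Fin (suc (suc a))) (suc (suc n))
    v₁ = other c₁ ∷ c₂ ∷ c₃
    v₂ = other c₁ ∷ other c₂ ∷ c₃

    d₁ : hamming c v₁ ≡ 1
    d₁ = trans (hamming-∷-≢ (c₂ ∷ c₃) (c₂ ∷ c₃) (other-≢ c₁)) (cong suc (hamming-refl (c₂ ∷ c₃)))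
    d₂ : hamming c v₂ ≡ 2
    d₂ = trans (hamming-∷-≢ (c₂ ∷ c₃) (other c₂ ∷ c₃) (other-≢ c₁)) (cong suc (trans (hamming-∷-≢ c₃ c₃ (other-≢ c₂)) (cong suc (hamming-refl c₃))))

    one-of-three : ∀ {x y z} → x ℕ.+ y ℕ.+ z ≡ 1 → 1 ℕ.≤ y → x ≡ 0 × y ≡ 1
    one-of-three {zero} {suc zero} eq 1≤y = refl , refl
    one-of-three {suc x} {suc y} eq 1≤y rewrite ℕₚ.+-suc x y with eq
    ... | ()
    third-of-three : ∀ {x y z} → x ℕ.+ y ℕ.+ z ≡ 1 → 1 ℕ.≤ z → x ≡ 0 × y ≡ 0
    third-of-three {zero} {zero} eq 1≤z = refl , refl
    third-of-three {zero} {suc y} {suc z} eq 1≤z rewrite ℕₚ.+-suc y z with eq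
    ... | ()
    third-of-three {suc x} {y} {suc z} eq 1≤z rewrite ℕₚ.+-suc (x ℕ.+ y) z with eq
    ... | ()

    counts₁ : count C 0 v₁ ≡ 0 × count C 1 v₁ ≡ 1
    counts₁ = one-of-three (covered v₁) (subst (λ k → 1 ℕ.≤ count C k v₁) d₁ (count≥ c C′ v₁))
    counts₂ : count C 0 v₂ ≡ 0 × count C 1 v₂ ≡ 0
    counts₂ = third-of-three {z = count C 2 v₂} (covered v₂) (subst (λ k → 1 ℕ.≤ count C k v₂) d₂ (count≥ c C′ v₂))

  -- From the eigenvalues to the Diophantine equations

  ballSize≥1 : ∀ q n e → 1 ℕ.≤ ballSize q n e
  ballSize≥1 q n zero    = s≤s z≤n
  ballSize≥1 q n (suc e) = ℕₚ.≤-trans (ballSize≥1 q n e) (ℕₚ.m≤m+n (ballSize q n e) _)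

  2*nC2 : ∀ n → 2 ℕ.* (n Comb.C 2) ℕ.+ n ≡ n ℕ.* n
  2*nC2 zero    = refl
  2*nC2 (suc n) = begin
    2 ℕ.* (suc n Comb.C 2) ℕ.+ suc n
      ≡⟨ cong (λ c → 2 ℕ.* c ℕ.+ suc n) (trans (sym (Comb.nCk+nC[k+1]≡[n+1]C[k+1] n 1)) (cong (ℕ._+ n Comb.C 2) (Comb.nC1≡n n))) ⟩
    2 ℕ.* (n ℕ.+ n Comb.C 2) ℕ.+ suc n
      ≡⟨ lemma n (n Comb.C 2) ⟩
    2 ℕ.* (n Comb.C 2) ℕ.+ n ℕ.+ (2 ℕ.* n ℕ.+ 1)
      ≡⟨ cong (ℕ._+ (2 ℕ.* n ℕ.+ 1)) (2*nC2 n) ⟩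
    n ℕ.* n ℕ.+ (2 ℕ.* n ℕ.+ 1)
      ≡⟨ lemma′ n ⟩
    suc n ℕ.* suc n ∎
    where
    open ≡-Reasoning
    lemma : ∀ n c → 2 ℕ.* (n ℕ.+ c) ℕ.+ suc n ≡ 2 ℕ.* c ℕ.+ n ℕ.+ (2 ℕ.* n ℕ.+ 1)
    lemma = ℕ-Solver.solve-∀
    lemma′ : ∀ n → n ℕ.* n ℕ.+ (2 ℕ.* n ℕ.+ 1) ≡ suc n ℕ.* suc n
    lemma′ = ℕ-Solver.solve-∀

  -- In the natural numbers the binomial coefficient is available as `2 * (n C 2) + n ≡ n * n`,
  -- without subtraction. So `n * b * b` is added on both sides and cancelled at the end.
  2ballSize : ∀ b n → 2∣ball∣ {suc b} n ≡ + (2 ℕ.* ballSize (suc b) n 2)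
  2ballSize b n = ℤ-Group.∙-cancelʳ (+ n * + b * + b) (2∣ball∣ {suc b} n) (+ (2 ℕ.* V)) (sym (begin
    + (2 ℕ.* V) + + n * + b * + b
      ≡⟨ cong (λ z → + (2 ℕ.* V) + z) (sym (trans (ℤₚ.pos-* (n ℕ.* b) b) (cong (_* + b) (ℤₚ.pos-* n b)))) ⟩
    + (2 ℕ.* V ℕ.+ n ℕ.* b ℕ.* b)
      ≡⟨ cong +_ inℕ ⟩
    + (2 ℕ.+ 2 ℕ.* (n ℕ.* b) ℕ.+ n ℕ.* n ℕ.* (b ℕ.* b))
      ≡⟨ cong₂ (λ y z → + 2 + y + z) (trans (ℤₚ.pos-* 2 (n ℕ.* b)) (cong (+ 2 *_) (ℤₚ.pos-* n b)))
           (trans (ℤₚ.pos-* (n ℕ.* n) (b ℕ.* b)) (cong₂ _*_ (ℤₚ.pos-* n n) (ℤₚ.pos-* b b))) ⟩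
    + 2 + + 2 * (+ n * + b) + + n * + n * (+ b * + b)
      ≡⟨ lemma (+ n) (+ b) ⟩
    2∣ball∣ {suc b} n + + n * + b * + b ∎))
    where
    open ≡-Reasoning
    V = ballSize (suc b) n 2
    lemma : ∀ n b → + 2 + + 2 * (n * b) + n * n * (b * b) ≡
      + 2 + + 2 * (n * (1ℤ + b - 1ℤ)) + n * (n - 1ℤ) * (1ℤ + b - 1ℤ) * (1ℤ + b - 1ℤ) + n * b * b
    lemma = solve-∀
    lemmaℕ : ∀ n b c → 2 ℕ.* (1 ℕ.+ n ℕ.* (b ℕ.* 1) ℕ.+ c ℕ.* (b ℕ.* (b ℕ.* 1))) ℕ.+ n ℕ.* b ℕ.* b ≡
      2 ℕ.+ 2 ℕ.* (n ℕ.* b) ℕ.+ (2 ℕ.* c ℕ.+ n) ℕ.* (b ℕ.* b)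
    lemmaℕ = ℕ-Solver.solve-∀
    inℕ : 2 ℕ.* V ℕ.+ n ℕ.* b ℕ.* b ≡ 2 ℕ.+ 2 ℕ.* (n ℕ.* b) ℕ.+ n ℕ.* n ℕ.* (b ℕ.* b)
    inℕ rewrite Comb.nC1≡n n = trans (lemmaℕ n b (n Comb.C 2)) (cong (λ z → 2 ℕ.+ 2 ℕ.* (n ℕ.* b) ℕ.+ z ℕ.* (b ℕ.* b)) (2*nC2 n))

  module _ (b n x y : ℕ) where
    private
      q N : ℕ
      q = suc b
      N = suc (suc n)
      θ : ℕ → ℤ
      θ = eigenvalue {q} N

    -- For `s = θ x` and `t = θ y` this is the discriminant identity `(s - t)² = (s + t)² - 4st`
    -- with `s - t = q(y - x)`. The length is eliminated by `q(x + y) = 2N(q - 1) - (s + t)`, and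
    -- the result appears multiplied by `q`.
    roots⇒equation : θ x + θ y ≡ + q - + 4 → θ x * θ y ≡ + 2 - + N * (+ q - 1ℤ) →
      2 ℕ.* (x ℕ.+ y) ℕ.+ q ℕ.+ 2 ℕ.* q ℕ.* x ℕ.* y ≡ q ℕ.* (x ℕ.* x ℕ.+ y ℕ.* y) ℕ.+ 6
    roots⇒equation Σθ Πθ = ℤₚ.+-injective (begin
      + (2 ℕ.* (x ℕ.+ y) ℕ.+ q ℕ.+ 2 ℕ.* q ℕ.* x ℕ.* y)
        ≡⟨ cong₂ (λ s t → s + + q + t) (ℤₚ.pos-* 2 (x ℕ.+ y))
             (trans (ℤₚ.pos-* (2 ℕ.* q ℕ.* x) y) (cong (_* + y) (trans (ℤₚ.pos-* (2 ℕ.* q) x) (cong (_* + x) (ℤₚ.pos-* 2 q))))) ⟩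
      + 2 * (+ x + + y) + + q + + 2 * + q * + x * + y
        ≡⟨ ℤₚ.*-cancelˡ-≡ (+ q) _ _ (ℤₚ.i-j≡0⇒i≡j _ _ difference) ⟩
      + q * (+ x * + x + + y * + y) + + 6
        ≡⟨ sym (cong (_+ + 6) (trans (ℤₚ.pos-* q (x ℕ.* x ℕ.+ y ℕ.* y)) (cong (+ q *_) (cong₂ _+_ (ℤₚ.pos-* x x) (ℤₚ.pos-* y y))))) ⟩
      + (q ℕ.* (x ℕ.* x ℕ.+ y ℕ.* y) ℕ.+ 6) ∎)
      where
      open ≡-Reasoning
      expand : ∀ q n x y → let s = n * (q - 1ℤ) - q * x ; t = n * (q - 1ℤ) - q * y in
        q * (+ 2 * (x + y) + q + + 2 * q * x * y) - q * (q * (x * x + y * y) + + 6) ≡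
        + 4 * (s * t) - (s + t) * (s + t) - + 2 * (s + t) + + 4 * (n * (q - 1ℤ)) + q * q - + 6 * q
      expand = solve-∀
      collapse : ∀ q n → + 4 * (+ 2 - n * (q - 1ℤ)) - (q - + 4) * (q - + 4) - + 2 * (q - + 4) + + 4 * (n * (q - 1ℤ)) + q * q - + 6 * q ≡ 0ℤ
      collapse = solve-∀
      difference : + q * (+ 2 * (+ x + + y) + + q + + 2 * + q * + x * + y) - + q * (+ q * (+ x * + x + + y * + y) + + 6) ≡ 0ℤ
      difference = trans (expand (+ q) (+ N) (+ x) (+ y))
        (trans (cong₂ (λ π σ → + 4 * π - σ * σ - + 2 * σ + + 4 * (+ N * (+ q - 1ℤ)) + + q * + q - + 6 * + q) Πθ Σθ) (collapse (+ q) (+ N)))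

    -- Vieta for the sum, in terms of `N - 2 = n`: in this form no subtraction is left, and `n = 0`
    -- would mean `x + y = 3`.
    roots⇒sum : θ x + θ y ≡ + q - + 4 → q ℕ.* (x ℕ.+ y) ≡ q ℕ.* 3 ℕ.+ 2 ℕ.* n ℕ.* b
    roots⇒sum Σθ = ℤₚ.+-injective (begin
      + (q ℕ.* (x ℕ.+ y))                                      ≡⟨ ℤₚ.pos-* q (x ℕ.+ y) ⟩
      + q * (+ x + + y)                                        ≡⟨ expand (+ q) (+ N) (+ x) (+ y) ⟩
      + 2 * (+ N * (+ q - 1ℤ)) - (θ x + θ y)                   ≡⟨ cong (λ z → + 2 * (+ N * (+ q - 1ℤ)) - z) Σθ ⟩
      + 2 * (+ N * (+ q - 1ℤ)) - (+ q - + 4)                   ≡⟨ collapse (+ b) (+ n) ⟩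
      + q * + 3 + + 2 * + n * + b                              ≡⟨ sym (cong₂ _+_ (ℤₚ.pos-* q 3) (trans (ℤₚ.pos-* (2 ℕ.* n) b) (cong (_* + b) (ℤₚ.pos-* 2 n)))) ⟩
      + (q ℕ.* 3 ℕ.+ 2 ℕ.* n ℕ.* b)                            ∎)
      where
      open ≡-Reasoning
      expand : ∀ q n x y → q * (x + y) ≡ + 2 * (n * (q - 1ℤ)) - (n * (q - 1ℤ) - q * x + (n * (q - 1ℤ) - q * y))
      expand = solve-∀
      collapse : ∀ b n → + 2 * ((+ 2 + n) * (1ℤ + b - 1ℤ)) - (1ℤ + b - + 4) ≡ (1ℤ + b) * + 3 + + 2 * n * b
      collapse = solve-∀

    -- As `q x = N(q - 1) - θ x`, the left side is the product of the differences between `N(q - 1)`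
    -- and the two roots. This is the quadratic at `N(q - 1)`, hence the doubled ball size.
    roots⇒product : θ x + θ y ≡ + q - + 4 → θ x * θ y ≡ + 2 - + N * (+ q - 1ℤ) →
      q ℕ.* q ℕ.* (x ℕ.* y) ≡ 2 ℕ.* ballSize q N 2
    roots⇒product Σθ Πθ = ℤₚ.+-injective (begin
      + (q ℕ.* q ℕ.* (x ℕ.* y))
        ≡⟨ trans (ℤₚ.pos-* (q ℕ.* q) (x ℕ.* y)) (cong₂ _*_ (ℤₚ.pos-* q q) (ℤₚ.pos-* x y)) ⟩
      + q * + q * (+ x * + y)
        ≡⟨ expand (+ q) (+ N) (+ x) (+ y) ⟩
      + N * (+ q - 1ℤ) * (+ N * (+ q - 1ℤ)) - + N * (+ q - 1ℤ) * (θ x + θ y) + θ x * θ y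
        ≡⟨ cong₂ (λ σ π → + N * (+ q - 1ℤ) * (+ N * (+ q - 1ℤ)) - + N * (+ q - 1ℤ) * σ + π) Σθ Πθ ⟩
      + N * (+ q - 1ℤ) * (+ N * (+ q - 1ℤ)) - + N * (+ q - 1ℤ) * (+ q - + 4) + (+ 2 - + N * (+ q - 1ℤ))
        ≡⟨ collapse (+ q) (+ N) ⟩
      2∣ball∣ {q} N
        ≡⟨ 2ballSize b N ⟩
      + (2 ℕ.* ballSize q N 2) ∎)
      where
      open ≡-Reasoning
      expand : ∀ q n x y → let s = n * (q - 1ℤ) - q * x ; t = n * (q - 1ℤ) - q * y in
        q * q * (x * y) ≡ n * (q - 1ℤ) * (n * (q - 1ℤ)) - n * (q - 1ℤ) * (s + t) + s * t
      expand = solve-∀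
      collapse : ∀ q n → n * (q - 1ℤ) * (n * (q - 1ℤ)) - n * (q - 1ℤ) * (q - + 4) + (+ 2 - n * (q - 1ℤ)) ≡
        + 2 + + 2 * (n * (q - 1ℤ)) + n * (n - 1ℤ) * (q - 1ℤ) * (q - 1ℤ)
      collapse = solve-∀

    -- q and q - 1 are coprime, so q divides 2n.
    sum⇒quotient : 1 ℕ.≤ n → q ℕ.* (x ℕ.+ y) ≡ q ℕ.* 3 ℕ.+ 2 ℕ.* n ℕ.* b → ∃ λ u → 1 ℕ.≤ u × 2 ℕ.* (x ℕ.+ y) ≡ 6 ℕ.+ b ℕ.* u
    -- Coprimality enters through `2nb + 2n = 2nq`: the sum equation shows that `q` divides `2nb`,
    -- so it divides `2n`.
    sum⇒quotient 1≤n eq with ∣m+n∣m⇒∣n (divides (2 ℕ.* n) (lemma n b)) (∣m+n∣m⇒∣n {m = q ℕ.* 3} (divides (x ℕ.+ y) (trans (sym eq) (ℕₚ.*-comm q (x ℕ.+ y)))) (divides 3 (ℕₚ.*-comm q 3)))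
      where
      lemma : ∀ n b → 2 ℕ.* n ℕ.* b ℕ.+ 2 ℕ.* n ≡ 2 ℕ.* n ℕ.* suc b
      lemma = ℕ-Solver.solve-∀
    -- Cancelling `q` leaves `x + y = 3 + mb`, whence `u = 2m`; it is positive because `n` is.
    ... | divides m 2n≡mq = 2 ℕ.* m , positive m 2n≡mq , doubled
      where
      positive : ∀ m → 2 ℕ.* n ≡ m ℕ.* q → 1 ℕ.≤ 2 ℕ.* m
      positive zero    eq′ = ⊥-elim (ℕₚ.<-irrefl (sym eq′) (ℕₚ.≤-trans 1≤n (ℕₚ.m≤m+n n _)))
      positive (suc m) _   = s≤s z≤n
      factored : ∀ q m b → q ℕ.* 3 ℕ.+ m ℕ.* q ℕ.* b ≡ q ℕ.* (3 ℕ.+ m ℕ.* b)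
      factored = ℕ-Solver.solve-∀
      cancelled : x ℕ.+ y ≡ 3 ℕ.+ m ℕ.* b
      cancelled = ℕₚ.*-cancelˡ-≡ (x ℕ.+ y) (3 ℕ.+ m ℕ.* b) q (trans eq (trans (cong (λ z → q ℕ.* 3 ℕ.+ z ℕ.* b) 2n≡mq) (factored q m b)))
      lemma : ∀ m b → 2 ℕ.* (3 ℕ.+ m ℕ.* b) ≡ 6 ℕ.+ b ℕ.* (2 ℕ.* m)
      lemma = ℕ-Solver.solve-∀
      doubled : 2 ℕ.* (x ℕ.+ y) ≡ 6 ℕ.+ b ℕ.* (2 ℕ.* m)
      doubled = trans (cong (2 ℕ.*_) cancelled) (lemma m b)

  -- `lloyd` provides the pair of eigenvalues only up to double negation, so the conclusion denies
  -- that all pairs fail. That is enough for deriving a contradiction.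
  perfect⇒solution : ∀ {q n} → 2 ℕ.≤ q → 3 ℕ.≤ n → (C : List (Vec (Fin q) n)) → 1 ℕ.≤ length C → IsPerfectCode q 2 n C →
    ¬ (∀ x y → Solution q x y → x ℕ.* y ℕ.* length C ≢ 2 ℕ.* q ℕ.^ (n ∸ 2))
  perfect⇒solution {q@(suc b@(suc a))} {N@(suc (suc n))} (s≤s (s≤s _)) (s≤s (s≤s 1≤n)) C 1≤M (code , size) none =
    lloyd {a} {n} C 1≤M (cover≡1 C code size′) ball≢0 λ x y Σθ Πθ →
      none x y (roots⇒equation b n x y Σθ Πθ , sum⇒quotient b n x y 1≤n (roots⇒sum b n x y Σθ))
        (product-eq x y (roots⇒product b n x y Σθ Πθ))
    where
    open ≡-Reasoning
    M = length C
    V = ballSize q N 2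
    2V≡ : 2∣ball∣ {q} N ≡ + (2 ℕ.* V)
    2V≡ = 2ballSize b N
    ball≢0 : 2∣ball∣ {q} N ≢ 0ℤ
    ball≢0 eq = ℕₚ.<⇒≢ (ℕₚ.≤-trans (ballSize≥1 q N 2) (ℕₚ.m≤m+n V (1 ℕ.* V))) (sym (ℤₚ.+-injective (trans (sym 2V≡) eq)))
    size′ : + M * 2∣ball∣ {q} N ≡ + 2 * + (q ℕ.^ N)
    size′ = begin
      + M * 2∣ball∣ {q} N       ≡⟨ cong (+ M *_) 2V≡ ⟩
      + M * + (2 ℕ.* V)         ≡⟨ sym (ℤₚ.pos-* M (2 ℕ.* V)) ⟩
      + (M ℕ.* (2 ℕ.* V))       ≡⟨ cong +_ (trans (lemma M V) (cong (2 ℕ.*_) size)) ⟩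
      + (2 ℕ.* q ℕ.^ N)         ≡⟨ ℤₚ.pos-* 2 (q ℕ.^ N) ⟩
      + 2 * + (q ℕ.^ N)         ∎
      where
      lemma : ∀ m v → m ℕ.* (2 ℕ.* v) ≡ 2 ℕ.* (m ℕ.* v)
      lemma = ℕ-Solver.solve-∀
    product-eq : ∀ x y → q ℕ.* q ℕ.* (x ℕ.* y) ≡ 2 ℕ.* V → x ℕ.* y ℕ.* M ≡ 2 ℕ.* q ℕ.^ n
    product-eq x y eq = ℕₚ.*-cancelˡ-≡ (x ℕ.* y ℕ.* M) (2 ℕ.* q ℕ.^ n) (q ℕ.* q) (begin
      q ℕ.* q ℕ.* (x ℕ.* y ℕ.* M)   ≡⟨ sym (ℕₚ.*-assoc (q ℕ.* q) (x ℕ.* y) M) ⟩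
      q ℕ.* q ℕ.* (x ℕ.* y) ℕ.* M   ≡⟨ cong (ℕ._* M) eq ⟩
      2 ℕ.* V ℕ.* M                 ≡⟨ lemma V M ⟩
      2 ℕ.* (M ℕ.* V)               ≡⟨ cong (2 ℕ.*_) size ⟩
      2 ℕ.* (q ℕ.* (q ℕ.* q ℕ.^ n)) ≡⟨ lemma′ q (q ℕ.^ n) ⟩
      q ℕ.* q ℕ.* (2 ℕ.* q ℕ.^ n)   ∎)
      where
      lemma : ∀ v m → 2 ℕ.* v ℕ.* m ≡ 2 ℕ.* (m ℕ.* v)
      lemma = ℕ-Solver.solve-∀
      lemma′ : ∀ q w → 2 ℕ.* (q ℕ.* (q ℕ.* w)) ≡ q ℕ.* q ℕ.* (2 ℕ.* w)
      lemma′ = ℕ-Solver.solve-∀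

theorem2 : (q : ℕ) → 6 ≤ q → ¬ IsPrimePower q →
    ((q ≤ 200 × q ≢ 94 × q ≢ 166) ⊎ (q ≤ 600 × SmallPrimeDivisors q)) →
    (n : ℕ) → 5 ≤ n → (C : List (Vec (Fin q) n)) → 2 ≤ length C →
    ¬ IsPerfectCode q 2 n C
theorem2 q 6≤q ¬pp cond n 5≤n C 2≤M perfect =
  Lloyd.perfect⇒solution (≤-trans (m≤m+n 2 4) 6≤q) (≤-trans (m≤m+n 3 2) 5≤n) C (≤-trans (m≤m+n 1 1) 2≤M) perfect
    -- Perfectness itself exhibits the number of codewords as a divisor of `q ^ n`, with the ball
    -- size as quotient.
    λ x y sol xyM → Sieve.no-solution {k = n ∸ 2} {n} 6≤q ¬pp cond (divides (ballSize q n 2) (sym (trans (*-comm (ballSize q n 2) (length C)) (proj₂ perfect)))) xyM sol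
  where
  open import Data.Nat using (_∸_)
  open import Data.Nat.Properties using (≤-trans; m≤m+n; *-comm)
  open import Data.Nat.Divisibility using (divides)
  open import Data.Product using (proj₂)
  open import Relation.Binary.PropositionalEquality using (sym; trans)
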